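{- Let $\varepsilon>0$ and let $k\geq 1$ and $d\geq 2$ be fixed integers. Then there exist positive constants $c_1$ and $c_2$ depending only on $d$, $k$ and $\varepsilon$ such that for every prime $p$ the following holds. If $f_1,\ldots,f_k\in\mathbb{F}_p[X]$ are polynomials of positive degree at most $d$ and $\mathscr{C}_0\geq c_1$, then for every $u\in\mathbb{F}_p$, $$ G_k(N)\geq c_2\min\{V_u(N)^{2-\varepsilon},\, p^{1-\varepsilon}\}\qquad\text{for all integers } N\geq 1 . $$
   Context: Let $p$ be a prime, $\mathbb{F}_p$ the field of $p$ elements, $\overline{\mathbb{F}}_p$ its algebraic closure, and $f_1,\ldots,f_k\in\mathbb{F}_p[X]$ polynomials of positive degree. For $u\in\mathbb{F}_p$ and an integer $N\ge 0$ put $$\mathcal{V}_u(N)=\{f_{i_1}\circ\cdots\circ f_{i_n}(u):\ i_1,\ldots,i_n\in\{1,\ldots,k\},\ 0\leq n\leq N\}$$ (the case $n=0$ gives $u$ itself), and $V_u(N)=\#\mathcal{V}_u(N)$. $G_k(N)$ (which depends also on $u$ and $f_1,\dots,f_k$) is the size of the smallest subgroup $\mathcal{G}\subseteq\mathbb{F}_p^*$ which contains all non-zero elements of $\mathcal{V}_u(N)$, i.e. $\mathcal{V}_u(N)\subseteq\mathcal{G}\cup\{0\}$. The functional graph $\mathcal{H}(\overline{\mathbb{F}}_p)$ has vertex set $\overline{\mathbb{F}}_p$ and directed edges $(x,y)$ with $f_i(x)=y$, $1\leq i\leq k$ (an edge labelled $i$ for each $x$ and each $i$). Let $\overline{\mathcal{H}}(\overline{\mathbb{F}}_p)$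 be the corresponding undirected graph obtained by forgetting orientations. $\mathscr{C}_0$ is the length of a shortest cycle in $\overline{\mathcal{H}}(\overline{\mathbb{F}}_p)$ which contains the vertex $0$, with $\mathscr{C}_0=\infty$ if there is no such cycle; a loop is a cycle of length $1$ and two distinct edges joining the same two vertices form a cycle of length $2$. (With this convention, for $k=1$, $\mathscr{C}_0$ equals the period of $0$ under iteration of $f_1$ if $0$ is periodic, and $\infty$ otherwise.) -}

module Defs where

open import Algebra.Bundles using (RawRing; CommutativeRing)
open import Algebra.Morphism.Structures using (module RingMorphisms)
open import Data.Fin.Base using (Fin; toℕ)
open import Data.Fin.Subset using (Subset; _∈_; _∉_; _⊆_)
open import Data.Integer.Base using (ℤ; +_; -[1+_])
open import Data.List.Base using (List; []; _∷_; foldr; length; map)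
open import Data.Nat.Base as ℕ using (ℕ; zero; suc; NonZero)
open import Data.Nat.DivMod using (_mod_)
open import Data.Product.Base using (∃; ∃-syntax; _×_; proj₁; proj₂)
open import Data.Rational.Base as ℚ
  using (ℚ; 0ℚ; 1ℚ; _/_; ↥_; ↧ₙ_; +-*-rawSemiring)
open import Data.Sum.Base using (_⊎_)
open import Function.Bundles using (_⇔_)
open import Level using (0ℓ)
open import Relation.Binary.Definitions using (Decidable)
open import Relation.Binary.PropositionalEquality.Core using (_≡_)
open import Relation.Nullary.Negation.Core using (¬_)
import Algebra.Definitions.RawSemiring as RawSemiringDefinitions

open RingMorphisms using (IsRingHomomorphism)
open RawSemiringDefinitions +-*-rawSemiring using () renaming (_^_ to _^ⁿ_)

infix  4 _<_^ᶻ_ _<_^ℚ_ _·_≤ᴸ_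
infixl 6 _-ᴸ_
infixr 8 _^ᴸ_

-- Real numbers as (located, two-sided) Dedekind cuts.
-- `lower q` means q < x and `upper q` means x < q.
record ℝ : Set₁ where
  field
    lower upper     : ℚ → Set
    lower-inhabited : ∃ lower
    upper-inhabited : ∃ upper
    lower-rounded   : ∀ q → lower q ⇔ (∃[ r ] q ℚ.< r × lower r)
    upper-rounded   : ∀ q → upper q ⇔ (∃[ r ] r ℚ.< q × upper r)
    disjoint        : ∀ q → ¬ (lower q × upper q)
    located         : ∀ q r → q ℚ.< r → lower q ⊎ upper r

Positive : ℝ → Set
Positive x = ℝ.lower x 0ℚ

-- A real quantity that is only ever bounded from above is given by the
-- set of rationals strictly below it.
LowerCut : Set₁
LowerCut = ℚ → Set

fromℕ : ℕ → ℚ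
fromℕ n = + n / 1

-- q < a - x  iff  x < a - q
_-ᴸ_ : ℚ → ℝ → LowerCut
(a -ᴸ x) q = ℝ.upper x (a ℚ.- q)

minᴸ : LowerCut → LowerCut → LowerCut
minᴸ S T r = S r × T r

-- s < n ^ a for an integer a and n ≥ 1; for a < 0 both sides have been
-- multiplied by n ^ (- a).
_<_^ᶻ_ : ℚ → ℕ → ℤ → Set
s < n ^ᶻ (+ a)    = s ℚ.< fromℕ (n ℕ.^ a)
s < n ^ᶻ -[1+ a ] = s ℚ.* fromℕ (n ℕ.^ suc a) ℚ.< 1ℚ

-- r < n ^ q for a rational q = a / b (b > 0) and n ≥ 1: as n ^ q > 0,
-- this says that r ≤ 0 or r ^ b < n ^ a.
_<_^ℚ_ : ℚ → ℕ → ℚ → Set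
r < n ^ℚ q = (r ℚ.≤ 0ℚ) ⊎ (r ^ⁿ (↧ₙ q) < n ^ᶻ (↥ q))

-- n ^ x for a real x and a natural number n ≥ 1 (not meaningful for
-- n = 0): since t ↦ n ^ t is continuous and nondecreasing, n ^ x is the
-- supremum of n ^ q over the rationals q < x.
_^ᴸ_ : ℕ → LowerCut → LowerCut
(n ^ᴸ x) r = ∃[ q ] x q × (r < n ^ℚ q)

-- c · S ≤ g, for rational c > 0
_·_≤ᴸ_ : ℚ → LowerCut → ℚ → Set
c · S ≤ᴸ g = ∀ r → S r → c ℚ.* r ℚ.≤ g

-- Polynomials are lists of coefficients, constant term first; trailing
-- zeros are allowed, so a polynomial has many representations.
module Polynomial (R : RawRing 0ℓ 0ℓ) where
  open RawRing R

  Poly : Set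
  Poly = List Carrier

  coeff : Poly → ℕ → Carrier
  coeff []      _       = 0#
  coeff (a ∷ f) zero    = a
  coeff (a ∷ f) (suc i) = coeff f i

  -- In particular f is nonzero.
  HasDegree : Poly → ℕ → Set
  HasDegree f m = ¬ (coeff f m ≈ 0#) × (∀ j → m ℕ.< j → coeff f j ≈ 0#)

  eval : Poly → Carrier → Carrier
  eval []      x = 0#
  eval (a ∷ f) x = a + x * eval f x

open Polynomial public

-- The integers modulo p, on the representatives 0, …, p - 1.
𝔽 : (p : ℕ) .{{_ : NonZero p}} → RawRing 0ℓ 0ℓ
𝔽 p = record
  { Carrier = Fin p
  ; _≈_     = _≡_
  ; _+_     = λ x y → (toℕ x ℕ.+ toℕ y) mod p
  ; _*_     = λ x y → (toℕ x ℕ.* toℕ y) mod p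
  ; -_      = λ x → (p ℕ.∸ toℕ x) mod p
  ; 0#      = 0 mod p
  ; 1#      = 1 mod p
  }

-- (K , ι) is an algebraic closure of 𝔽 p, for p prime.  Equality in K is
-- required to be decidable, which is automatic classically.
record IsAlgebraicClosure (p : ℕ) .{{_ : NonZero p}}
         (K : CommutativeRing 0ℓ 0ℓ)
         (ι : Fin p → CommutativeRing.Carrier K) : Set where
  open CommutativeRing K
  field
    _≟_              : Decidable _≈_
    1≉0              : ¬ (1# ≈ 0#)
    inverse          : ∀ x → ¬ (x ≈ 0#) → ∃[ y ] x * y ≈ 1#
    homomorphism     : IsRingHomomorphism (𝔽 p) rawRing ι
    algebraic        : ∀ x → ∃[ g ] (∃[ m ] HasDegree (𝔽 p) g m)
                         × (eval rawRing (map ι g) x ≈ 0#)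
    algebraic-closed : ∀ g m → 1 ℕ.≤ m → HasDegree rawRing g m →
                         ∃[ x ] eval rawRing g x ≈ 0#

-- The undirected multigraph obtained from the functional graph of
-- f₁, …, f_k on K.
module Graph {p : ℕ} .{{_ : NonZero p}} (K : CommutativeRing 0ℓ 0ℓ)
             (ι : Fin p → CommutativeRing.Carrier K)
             {k : ℕ} (f : Fin k → Poly (𝔽 p)) where
  open CommutativeRing K

  -- (x , i) is the edge labelled i from x to f i (x).
  Edge : Set
  Edge = Carrier × Fin k

  source target : Edge → Carrier
  source e = proj₁ e
  target e = eval rawRing (map ι (f (proj₂ e))) (proj₁ e)

  Joins : Edge → Carrier → Carrier → Set
  Joins e v w = (source e ≈ v × target e ≈ w) ⊎ (source e ≈ w × target e ≈ v)

  -- Distinctness of the edges only matters for n = 2.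
  record CycleThrough0 (n : ℕ) .{{_ : NonZero n}} : Set where
    field
      vertex            : Fin n → Carrier
      edge              : Fin n → Edge
      joins             : ∀ j → Joins (edge j) (vertex j)
                                      (vertex (suc (toℕ j) mod n))
      vertices-distinct : ∀ i j → vertex i ≈ vertex j → i ≡ j
      edges-distinct    : ∀ i j → source (edge i) ≈ source (edge j) →
                            proj₂ (edge i) ≡ proj₂ (edge j) → i ≡ j
      through-0         : ∃[ j ] vertex j ≈ 0#

  -- The least length of a cycle through 0 is at least c; this holds in
  -- particular when there is no such cycle (least length ∞).
  C₀≥ : ℕ → Set
  C₀≥ c = ∀ n .{{_ : NonZero n}} → CycleThrough0 n → c ℕ.≤ n

open Graph public using (C₀≥)

module _ {p : ℕ} .{{_ : NonZero p}} where
  open RawRing (𝔽 p)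

  -- y is f_{i₁} ∘ ⋯ ∘ f_{iₙ} (u) for some word i₁ ⋯ iₙ with n ≤ N.
  InOrbit : {k : ℕ} → (Fin k → Poly (𝔽 p)) → Fin p → ℕ → Fin p → Set
  InOrbit f u N y =
    ∃[ is ] length is ℕ.≤ N × y ≡ foldr (λ i → eval (𝔽 p) (f i)) u is

  IsOrbit : {k : ℕ} → (Fin k → Poly (𝔽 p)) → Fin p → ℕ → Subset p → Set
  IsOrbit f u N 𝒱 = ∀ y → y ∈ 𝒱 ⇔ InOrbit f u N y

  record IsSubgroup (H : Subset p) : Set where
    field
      0∉        : 0# ∉ H
      1∈        : 1# ∈ H
      *-closed  : ∀ x y → x ∈ H → y ∈ H → (x * y) ∈ H
      inverse   : ∀ x → x ∈ H → ∃[ y ] y ∈ H × x * y ≡ 1#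

  ContainsNonzero : Subset p → Subset p → Set
  ContainsNonzero H 𝒱 = ∀ y → y ∈ 𝒱 → ¬ (y ≡ 0#) → y ∈ H

  record IsSmallestSubgroup (𝒱 𝒢 : Subset p) : Set where
    field
      isSubgroup : IsSubgroup 𝒢
      contains   : ContainsNonzero 𝒢 𝒱
      least      : ∀ H → IsSubgroup H → ContainsNonzero H 𝒱 → 𝒢 ⊆ H

-- Only the iterates h₁, …, hₙ of f₁ are used.  As 0 lies on no short cycle,
-- f₁^m(0) ≠ 0 for 0 < m < n; since h_{i+m} ≡ f₁^m(0) modulo h_i, the h_i are
-- pairwise comaximal.  Every point of the orbit is reached by a word of length
-- at most n from a point x at which each h_i takes a value in 𝒢 ∪ {0}, so it
-- suffices to bound the number J of x with h_i(x) ^ t = 1 for all i, where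
-- t = ∣ 𝒢 ∣.  This is done by Stepanov's method.  Put W_q = ∏ h_i ^ (t q_i)
-- for 0 ≤ q_i < B, F = ∏ h_i and θ = F d/dX.  A dimension count yields H_q of
-- degree < A, not all zero, such that θ^j (∑ H_q W_q) vanishes at these x for
-- all j < M; hence J M ≤ deg (∑ H_q W_q), unless the sum is zero.
--
-- The sum is not zero because the products H_q W_q are linearly independent.
-- In a minimal relation with s + 2 terms there is a differential operator of
-- order ≤ s, with coefficients of small degree, that kills s of the terms, and
-- then also the other two, since two W_q differ by a high power of some h_i.
-- So an operator of order ≤ s kills s + 1 functions.  At a point where its
-- leading coefficient does not vanish, some nontrivial constant combination of
-- these functions vanishes to the order of the operator, hence identically;
-- this is a shorter relation.

module Submission where

open import Defs
open import Algebra.Bundles using (CommutativeRing)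
open import Algebra.Morphism.Structures using (module RingMorphisms)
open import Data.Fin.Base as Fin using (Fin; zero; suc; toℕ; punchIn; punchOut; combine; remQuot; funToFin; finToFun)
import Data.Fin.Properties as Finₚ
open import Data.Fin.Subset as Subset using (Subset; ∣_∣)
import Data.Fin.Subset.Properties as Subsetₚ
open import Data.Integer.Base as ℤ using (ℤ)
import Data.Integer.Properties as ℤₚ
import Data.Integer.Solver as ℤSolver
open import Data.List.Base as List
  using (List; []; _∷_; length; foldr; map; _++_; allFin; filter; take; drop; replicate; cartesianProductWith)
open import Data.List.Membership.Propositional using () renaming (_∈_ to _∈ˡ_)
import Data.List.Membership.Propositional.Properties as ∈ₚ
open import Data.List.Membership.Propositional.Properties.WithK using (unique∧set⇒bag)
import Data.List.Properties as Listₚ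
open import Data.List.Relation.Binary.BagAndSetEquality using (∼bag⇒↭)
open import Data.List.Relation.Binary.Permutation.Propositional using (_↭_; ↭⇒↭ₛ)
import Data.List.Relation.Binary.Permutation.Setoid.Properties as Permutationₚ
open import Data.List.Relation.Unary.All as All using (All; []; _∷_)
import Data.List.Relation.Unary.All.Properties as Allₚ
open import Data.List.Relation.Unary.AllPairs using (AllPairs; []; _∷_)
import Data.List.Relation.Unary.AllPairs.Properties as AllPairsₚ
open import Data.List.Relation.Unary.Any as Any using (here; there; satisfied)
import Data.List.Relation.Unary.Any.Properties as Anyₚ
open import Data.List.Relation.Unary.Unique.Propositional using (Unique)
import Data.List.Relation.Unary.Unique.Propositional.Properties as Uniqueₚ
open import Data.Nat.Base as ℕ using (ℕ; zero; suc; s≤s; z≤n; NonZero; _≤_; _<_)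
open import Data.Nat.DivMod
  using (_mod_; _%_; m<n⇒m%n≡m; m%n<n; %-distribˡ-+; %-distribˡ-*; n%n≡0)
open import Data.Nat.Divisibility using (_∣_; m%n≡0⇒n∣m; n∣m⇒m%n≡0; ∣⇒≤)
open import Data.Nat.Induction using (<-rec)
open import Data.Nat.Primality using (Prime; euclidsLemma; prime⇒nonTrivial)
import Data.Nat.Properties as ℕₚ
open import Data.Nat.Solver using (module +-*-Solver)
open import Data.Product.Base using (_,_; proj₁; proj₂; ∃-syntax; _×_; uncurry; swap)
open import Data.Rational.Base as ℚ using (ℚ; mkℚ; 0ℚ; 1ℚ; ↥_; ↧ₙ_; toℚᵘ)
import Data.Rational.Properties as ℚₚ
open import Data.Rational.Unnormalised.Base as ℚᵘ using (mkℚᵘ; *≡*; *≤*)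
import Data.Rational.Unnormalised.Properties as ℚᵘₚ
open import Data.Sum.Base as Sum using (_⊎_; inj₁; inj₂)
open import Data.Vec.Base using ([]; _∷_; here; there)
open import Data.Vec.Functional using (removeAt)
open import Function.Base using (_∘_; id)
open import Function.Bundles using (mk⇔; module Equivalence)
open import Level using (0ℓ)
open import Relation.Binary.Definitions using (Decidable; tri<; tri≈; tri>)
open import Relation.Binary.PropositionalEquality as ≡ using (_≡_; _≢_)
open import Relation.Nullary.Decidable.Core using (Dec; yes; no)
open import Relation.Nullary.Negation.Core using (¬_; contradiction)
import Algebra.Definitions.RawMonoid as RawMonoidDefinitions
import Algebra.Properties.CommutativeMonoid.Sum as MonoidSum
import Algebra.Properties.Group as GroupProperties
import Algebra.Properties.Ring as RingProperties
import Algebra.Properties.Semiring.Exp as SemiringExp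
import Algebra.Properties.Semiring.Sum as SemiringSum
import Algebra.Solver.Ring.NaturalCoefficients.Default as SemiringSolver
import Relation.Binary.Reasoning.Setoid as SetoidReasoning

-- Divisibility by powers of the h_i settles relations with two terms only: with more terms, several
-- may carry the same power of a given h_i, and nothing can be isolated. The operator exists to cut
-- a long relation down to two terms. Where a Wronskian would need determinants and degree
-- estimates, the coefficients come from the pigeonhole principle over the finite field, which
-- delivers their length bounds at once.
--
-- Two constraints fix the exponents in the theorem. After the operator has been applied, the two
-- remaining coefficients must be no longer than t; this limits B^(2n) to the order of t. In
-- characteristic p, repeated application of θ detects vanishing only up to order p, so the total
-- degree, of order t B, must stay below p; when it does not, t is so large that the entry p^(1-ε)
-- of the minimum takes over. With M of order B^n, Stepanov's bound becomes J ≲ t B / B^n, that is,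
-- J ≲ t^(1/2 + 1/(2n)). The exponent tends to 1/2 only as n grows, so ε dictates how many iterates
-- are used, and thereby how long the cycles through 0 must be.

-- Formal power series: the Cauchy product

module Convolution (R : CommutativeRing 0ℓ 0ℓ) where
  open CommutativeRing R
  open SemiringSolver commutativeSemiring
  open SetoidReasoning setoid

  Series : Set
  Series = ℕ → Carrier

  _≗ˢ_ : Series → Series → Set
  f ≗ˢ g = ∀ n → f n ≈ g n

  conv : Series → Series → Series
  conv f g zero    = f 0 * g 0
  conv f g (suc n) = f 0 * g (suc n) + conv (f ∘ suc) g n

  conv-cong : ∀ {f f′ g g′} → f ≗ˢ f′ → g ≗ˢ g′ → conv f g ≗ˢ conv f′ g′
  conv-cong p q zero    = *-cong (p 0) (q 0)
  conv-cong p q (suc n) =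
    +-cong (*-cong (p 0) (q (suc n))) (conv-cong (p ∘ suc) q n)

  conv-zeroˡ : ∀ {f} g → (∀ n → f n ≈ 0#) → ∀ n → conv f g n ≈ 0#
  conv-zeroˡ g p zero    = trans (*-congʳ (p 0)) (zeroˡ _)
  conv-zeroˡ g p (suc n) =
    trans (+-cong (trans (*-congʳ (p 0)) (zeroˡ _)) (conv-zeroˡ g (p ∘ suc) n))
          (+-identityˡ 0#)

  conv-distribʳ : ∀ f g h n →
    conv (λ i → f i + g i) h n ≈ conv f h n + conv g h n
  conv-distribʳ f g h zero    = distribʳ _ _ _
  conv-distribʳ f g h (suc n) = trans
    (+-congˡ (conv-distribʳ (f ∘ suc) (g ∘ suc) h n))
    (solve 5 (λ a b c x y → (a :+ b) :* c :+ (x :+ y)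
                         := (a :* c :+ x) :+ (b :* c :+ y)) refl _ _ _ _ _)

  conv-scaleˡ : ∀ a f g n → conv (λ i → a * f i) g n ≈ a * conv f g n
  conv-scaleˡ a f g zero    = *-assoc _ _ _
  conv-scaleˡ a f g (suc n) = trans
    (+-congˡ (conv-scaleˡ a (f ∘ suc) g n))
    (solve 4 (λ a b c x → a :* b :* c :+ a :* x := a :* (b :* c :+ x)) refl _ _ _ _)

  -- The recursion peels its left argument only, so the induction goes down by two: peeling on both
  -- sides leaves a core in which both series are shifted.
  conv-comm : ∀ f g n → conv f g n ≈ conv g f n
  conv-comm f g zero          = *-comm _ _
  conv-comm f g (suc zero)    =
    solve 4 (λ a b c d → a :* b :+ c :* d := d :* c :+ b :* a) refl _ _ _ _
  conv-comm f g (suc (suc n)) = begin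
    f 0 * g (2 ℕ.+ n) + conv (f ∘ suc) g (suc n)
      ≈⟨ +-congˡ (conv-comm (f ∘ suc) g (suc n)) ⟩
    f 0 * g (2 ℕ.+ n) + (g 0 * f (2 ℕ.+ n) + conv (g ∘ suc) (f ∘ suc) n)
      ≈⟨ +-congˡ (+-congˡ (conv-comm (g ∘ suc) (f ∘ suc) n)) ⟩
    f 0 * g (2 ℕ.+ n) + (g 0 * f (2 ℕ.+ n) + conv (f ∘ suc) (g ∘ suc) n)
      ≈⟨ solve 3 (λ a b c → a :+ (b :+ c) := b :+ (a :+ c)) refl _ _ _ ⟩
    g 0 * f (2 ℕ.+ n) + conv f (g ∘ suc) (suc n)
      ≈⟨ +-congˡ (conv-comm f (g ∘ suc) (suc n)) ⟩
    g 0 * f (2 ℕ.+ n) + conv (g ∘ suc) f (suc n) ∎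

  conv-assoc : ∀ f g h n → conv (conv f g) h n ≈ conv f (conv g h) n
  conv-assoc f g h zero    = *-assoc _ _ _
  conv-assoc f g h (suc n) = begin
    f 0 * g 0 * h (suc n) + conv (conv f g ∘ suc) h n
      ≈⟨ +-congˡ (conv-distribʳ (λ i → f 0 * g (suc i)) (conv (f ∘ suc) g) h n) ⟩
    f 0 * g 0 * h (suc n) + (conv (λ i → f 0 * g (suc i)) h n + conv (conv (f ∘ suc) g) h n)
      ≈⟨ +-congˡ (+-cong (conv-scaleˡ (f 0) (g ∘ suc) h n) (conv-assoc (f ∘ suc) g h n)) ⟩
    f 0 * g 0 * h (suc n) + (f 0 * conv (g ∘ suc) h n + conv (f ∘ suc) (conv g h) n)
      ≈⟨ solve 5 (λ a b c x y → a :* b :* c :+ (a :* x :+ y)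
                             := a :* (b :* c :+ x) :+ y) refl _ _ _ _ _ ⟩
    f 0 * (g 0 * h (suc n) + conv (g ∘ suc) h n) + conv (f ∘ suc) (conv g h) n ∎

  conv-top : ∀ m n f g → (∀ i → m ℕ.< i → f i ≈ 0#) → (∀ i → n ℕ.< i → g i ≈ 0#) →
             conv f g (m ℕ.+ n) ≈ f m * g n
  conv-top zero    zero    f g p q = refl
  conv-top zero    (suc n) f g p q =
    trans (+-congˡ (conv-zeroˡ g (λ i → p (suc i) (s≤s z≤n)) n)) (+-identityʳ _)
  conv-top (suc m) n       f g p q = begin
    f 0 * g (suc (m ℕ.+ n)) + conv (f ∘ suc) g (m ℕ.+ n)
      ≈⟨ +-cong (trans (*-congˡ (q _ (s≤s (ℕₚ.m≤n+m n m)))) (zeroʳ _))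
                (conv-top m n (f ∘ suc) g (λ i m<i → p (suc i) (s≤s m<i)) q) ⟩
    0# + f (suc m) * g n  ≈⟨ +-identityˡ _ ⟩
    f (suc m) * g n       ∎

  -- One factor is bounded by its degree, the other by its length. This asymmetric form gives the
  -- length of a product without truncated subtraction and still covers `b` = 0.
  conv-vanish : ∀ a b f g → (∀ i → a ℕ.< i → f i ≈ 0#) → (∀ i → b ℕ.≤ i → g i ≈ 0#) →
                ∀ i → a ℕ.+ b ℕ.≤ i → conv f g i ≈ 0#
  conv-vanish zero b f g p q zero a+b≤i = trans (*-congˡ (q 0 a+b≤i)) (zeroʳ _)
  conv-vanish zero b f g p q (suc i) a+b≤i = trans
    (+-cong (trans (*-congˡ (q (suc i) a+b≤i)) (zeroʳ _))
            (conv-zeroˡ g (λ j → p (suc j) (s≤s z≤n)) i))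
    (+-identityˡ 0#)
  conv-vanish (suc a) b f g p q (suc i) (s≤s a+b≤i) = trans
    (+-cong (trans (*-congˡ (q (suc i) (ℕₚ.m≤n⇒m≤1+n (ℕₚ.≤-trans (ℕₚ.m≤n+m b a) a+b≤i)))) (zeroʳ _))
            (conv-vanish a b (f ∘ suc) g (λ j a<j → p (suc j) (s≤s a<j)) q i a+b≤i))
    (+-identityˡ 0#)

-- The ring of polynomials

module PolynomialRing (R : CommutativeRing 0ℓ 0ℓ) where
  open CommutativeRing R
  open RingProperties ring using (-0#≈0#)
  open Convolution R

  Pol : Set
  Pol = Poly rawRing

  cf : Pol → Series
  cf = coeff rawRing

  infix 4 _≋_
  record _≋_ (f g : Pol) : Set where
    constructor mk≋
    field at : ∀ n → cf f n ≈ cf g n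
  open _≋_ public

  infixl 6 _⊞_
  infixl 7 _⊠_
  infix  8 ⊟_

  -- Opaque, so that unification treats the ring operations as rigid.
  opaque
    _⊞_ : Pol → Pol → Pol
    []      ⊞ g       = g
    (a ∷ f) ⊞ []      = a ∷ f
    (a ∷ f) ⊞ (b ∷ g) = (a + b) ∷ (f ⊞ g)

    ⊟_ : Pol → Pol
    ⊟ f = map -_ f

    scale : Carrier → Pol → Pol
    scale a f = map (a *_) f

    _⊠_ : Pol → Pol → Pol
    []      ⊠ g = []
    (a ∷ f) ⊠ g = scale a g ⊞ (0# ∷ (f ⊠ g))

    cf-⊞ : ∀ f g n → cf (f ⊞ g) n ≈ cf f n + cf g n
    cf-⊞ []      g       n       = sym (+-identityˡ _)
    cf-⊞ (a ∷ f) []      n       = sym (+-identityʳ _)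
    cf-⊞ (a ∷ f) (b ∷ g) zero    = refl
    cf-⊞ (a ∷ f) (b ∷ g) (suc n) = cf-⊞ f g n

    cf-⊟ : ∀ f n → cf (⊟ f) n ≈ - cf f n
    cf-⊟ []      n       = sym -0#≈0#
    cf-⊟ (a ∷ f) zero    = refl
    cf-⊟ (a ∷ f) (suc n) = cf-⊟ f n

    cf-scale : ∀ a f n → cf (scale a f) n ≈ a * cf f n
    cf-scale a []      n       = sym (zeroʳ a)
    cf-scale a (b ∷ f) zero    = refl
    cf-scale a (b ∷ f) (suc n) = cf-scale a f n

    cf-⊠ : ∀ f g n → cf (f ⊠ g) n ≈ conv (cf f) (cf g) n
    cf-⊠ []      g n       = sym (conv-zeroˡ (cf g) (λ _ → refl) n)
    cf-⊠ (a ∷ f) g zero    =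
      trans (cf-⊞ (scale a g) _ 0) (trans (+-identityʳ _) (cf-scale a g 0))
    cf-⊠ (a ∷ f) g (suc n) =
      trans (cf-⊞ (scale a g) _ (suc n)) (+-cong (cf-scale a g (suc n)) (cf-⊠ f g n))

    []-⊞ : ∀ g → [] ⊞ g ≡ g
    []-⊞ g = ≡.refl

    ⊞-[] : ∀ g → g ⊞ [] ≡ g
    ⊞-[] []      = ≡.refl
    ⊞-[] (a ∷ g) = ≡.refl

    ∷-⊞ : ∀ a f b g → (a ∷ f) ⊞ (b ∷ g) ≡ (a + b) ∷ (f ⊞ g)
    ∷-⊞ a f b g = ≡.refl

    []-⊠ : ∀ g → [] ⊠ g ≡ []
    []-⊠ g = ≡.refl

    ∷-⊠ : ∀ a f g → (a ∷ f) ⊠ g ≡ scale a g ⊞ (0# ∷ (f ⊠ g))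
    ∷-⊠ a f g = ≡.refl

    scale-[] : ∀ a → scale a [] ≡ []
    scale-[] a = ≡.refl

    scale-∷ : ∀ a b f → scale a (b ∷ f) ≡ (a * b) ∷ scale a f
    scale-∷ a b f = ≡.refl

  opaque
    const : Carrier → Pol
    const a = a ∷ []

    X : Pol
    X = 0# ∷ 1# ∷ []

    const≡∷ : ∀ a → const a ≡ a ∷ []
    const≡∷ a = ≡.refl

    cf-const-0 : ∀ a → cf (const a) 0 ≈ a
    cf-const-0 a = refl

    cf-const-suc : ∀ a n → cf (const a) (suc n) ≈ 0#
    cf-const-suc a n = refl

    cf-X-0 : cf X 0 ≈ 0#
    cf-X-0 = refl

    cf-X-suc : ∀ n → cf X (suc n) ≈ cf (const 1#) n
    cf-X-suc n = refl

  polyRing : CommutativeRing 0ℓ 0ℓ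
  polyRing = record
    { Carrier = Pol ; _≈_ = _≋_ ; _+_ = _⊞_ ; _*_ = _⊠_ ; -_ = ⊟_
    ; 0# = [] ; 1# = const 1#
    ; isCommutativeRing = record
      { isRing = record
        { +-isAbelianGroup = record
          { isGroup = record
            { isMonoid = record
              { isSemigroup = record
                { isMagma = record
                  { isEquivalence = record
                    { refl  = mk≋ λ n → refl
                    ; sym   = λ p → mk≋ λ n → sym (at p n)
                    ; trans = λ p q → mk≋ λ n → trans (at p n) (at q n) }
                  ; ∙-cong = λ {f} {f′} {g} {g′} p q → mk≋ λ n →
                      trans (cf-⊞ f g n) (trans (+-cong (at p n) (at q n)) (sym (cf-⊞ f′ g′ n))) }
                ; assoc = λ f g h → mk≋ λ n →
                    trans (cf-⊞ (f ⊞ g) h n) (trans (+-congʳ (cf-⊞ f g n))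
                      (trans (+-assoc _ _ _)
                        (sym (trans (cf-⊞ f (g ⊞ h) n) (+-congˡ (cf-⊞ g h n)))))) }
              ; identity = (λ f → mk≋ λ n → trans (cf-⊞ [] f n) (+-identityˡ _))
                         , (λ f → mk≋ λ n → trans (cf-⊞ f [] n) (+-identityʳ _)) }
            ; inverse = (λ f → mk≋ λ n → trans (cf-⊞ (⊟ f) f n)
                          (trans (+-congʳ (cf-⊟ f n)) (-‿inverseˡ _)))
                      , (λ f → mk≋ λ n → trans (cf-⊞ f (⊟ f) n)
                          (trans (+-congˡ (cf-⊟ f n)) (-‿inverseʳ _)))
            ; ⁻¹-cong = λ {f} {g} p → mk≋ λ n →
                trans (cf-⊟ f n) (trans (-‿cong (at p n)) (sym (cf-⊟ g n))) }
          ; comm = λ f g → mk≋ λ n →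
              trans (cf-⊞ f g n) (trans (+-comm _ _) (sym (cf-⊞ g f n))) }
        ; *-cong = λ {f} {f′} {g} {g′} p q → mk≋ λ n →
            trans (cf-⊠ f g n) (trans (conv-cong (at p) (at q) n) (sym (cf-⊠ f′ g′ n)))
        ; *-assoc = λ f g h → mk≋ λ n →
            trans (cf-⊠ (f ⊠ g) h n) (trans (conv-cong (cf-⊠ f g) (λ _ → refl) n)
              (trans (conv-assoc (cf f) (cf g) (cf h) n)
                (sym (trans (cf-⊠ f (g ⊠ h) n) (conv-cong (λ _ → refl) (cf-⊠ g h) n)))))
        ; *-identity = ⊠-identityˡ , λ f → mk≋ λ n →
            trans (⊠-comm f (const 1#) n) (at (⊠-identityˡ f) n)
        ; distrib = (λ f g h → mk≋ λ n →
                      trans (⊠-comm f (g ⊞ h) n) (trans (⊠-distribʳ f g h n)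
                        (sym (trans (cf-⊞ (f ⊠ g) (f ⊠ h) n)
                           (+-cong (⊠-comm f g n) (⊠-comm f h n))))))
                  , (λ f g h → mk≋ λ n →
                      trans (⊠-distribʳ f g h n) (sym (cf-⊞ (g ⊠ f) (h ⊠ f) n))) }
      ; *-comm = λ f g → mk≋ (⊠-comm f g) } }
    where
    ⊠-comm : ∀ f g n → cf (f ⊠ g) n ≈ cf (g ⊠ f) n
    ⊠-comm f g n = trans (cf-⊠ f g n) (trans (conv-comm (cf f) (cf g) n) (sym (cf-⊠ g f n)))
    ⊠-identityˡ : ∀ f → const 1# ⊠ f ≋ f
    ⊠-identityˡ f = mk≋ λ
      { zero    → trans (cf-⊠ (const 1#) f 0) (trans (*-congʳ (cf-const-0 1#)) (*-identityˡ _))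
      ; (suc n) → trans (cf-⊠ (const 1#) f (suc n))
          (trans (+-cong (trans (*-congʳ (cf-const-0 1#)) (*-identityˡ _))
                         (conv-zeroˡ (cf f) (cf-const-suc 1#) n))
                 (+-identityʳ _)) }
    ⊠-distribʳ : ∀ f g h n → cf ((g ⊞ h) ⊠ f) n ≈ cf (g ⊠ f) n + cf (h ⊠ f) n
    ⊠-distribʳ f g h n =
      trans (cf-⊠ (g ⊞ h) f n) (trans (conv-cong (cf-⊞ g h) (λ _ → refl) n)
        (trans (conv-distribʳ (cf g) (cf h) (cf f) n)
          (sym (+-cong (cf-⊠ g f n) (cf-⊠ h f n)))))

-- Evaluation, derivative, length and degree of polynomials

module PolynomialCalculus (R : CommutativeRing 0ℓ 0ℓ) where
  private
    module K where
      open CommutativeRing R public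
      open SemiringSolver commutativeSemiring public using (solve; _:=_; _:+_; _:*_; con)
  open Convolution R
  open PolynomialRing R public
  open CommutativeRing polyRing hiding (zero)
  open SemiringSum semiring using (sum)
  open SemiringSolver commutativeSemiring
  open SetoidReasoning setoid

  -- This avoids a simultaneous recursion over two lists of different shape: if `T` is additive and
  -- sends every representation of zero to zero, then `T f` and `T g` are both the negative of
  -- `T (- g)`.
  additive-cong : (S : CommutativeRing 0ℓ 0ℓ) → let module S = CommutativeRing S in
    (T : Pol → S.Carrier) → (∀ f g → T (f + g) S.≈ T f S.+ T g) →
    (∀ f → f ≈ 0# → T f S.≈ S.0#) → ∀ {f g} → f ≈ g → T f S.≈ T g
  additive-cong S T add zer {f} {g} f≈g = S.trans (inv f f≈g) (S.sym (inv g refl))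
    where
    module S = CommutativeRing S
    inv : ∀ h → h ≈ g → T h S.≈ S.- T (- g)
    inv h h≈g = GroupProperties.inverseˡ-unique S.+-group _ _
      (S.trans (S.sym (add h (- g))) (zer _ (trans (+-congʳ h≈g) (-‿inverseʳ g))))

  tail≈0 : ∀ {a f} → a ∷ f ≈ 0# → f ≈ 0#
  tail≈0 p = mk≋ λ n → at p (suc n)

  ∷-cong : ∀ {a b f g} → a K.≈ b → f ≈ g → (a ∷ f) ≈ (b ∷ g)
  ∷-cong p q = mk≋ λ { zero → p ; (suc n) → at q n }

  const≈0 : ∀ {a} → a K.≈ K.0# → const a ≈ 0#
  const≈0 {a} p = mk≋ λ { zero → K.trans (cf-const-0 a) p ; (suc n) → cf-const-suc a n }

  0∷≈X* : ∀ f → (K.0# ∷ f) ≈ X * f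
  0∷≈X* f = mk≋ λ
    { zero    → K.sym (K.trans (cf-⊠ X f 0) (K.trans (K.*-congʳ cf-X-0) (K.zeroˡ _)))
    ; (suc n) → K.sym (K.trans (cf-⊠ X f (suc n))
        (K.trans (K.+-cong (K.trans (K.*-congʳ cf-X-0) (K.zeroˡ _))
           (K.trans (conv-cong cf-X-suc (λ _ → K.refl) n)
             (K.trans (K.sym (cf-⊠ (const K.1#) f n)) (at (*-identityˡ f) n))))
                 (K.+-identityˡ _))) }

  ∷≈const+X* : ∀ a f → (a ∷ f) ≈ const a + X * f
  ∷≈const+X* a f = trans
    (mk≋ λ { zero    → K.sym (K.trans (cf-⊞ (const a) _ 0)
                         (K.trans (K.+-congʳ (cf-const-0 a)) (K.+-identityʳ a)))
           ; (suc n) → K.sym (K.trans (cf-⊞ (const a) _ (suc n))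
                         (K.trans (K.+-congʳ (cf-const-suc a n)) (K.+-identityˡ _))) })
    (+-congˡ (0∷≈X* f))

  scale≈const* : ∀ a f → scale a f ≈ const a * f
  scale≈const* a f = mk≋ λ
    { zero    → K.trans (cf-scale a f 0)
        (K.sym (K.trans (cf-⊠ (const a) f 0) (K.*-congʳ (cf-const-0 a))))
    ; (suc n) → K.trans (cf-scale a f (suc n))
        (K.sym (K.trans (cf-⊠ (const a) f (suc n))
          (K.trans (K.+-cong (K.*-congʳ (cf-const-0 a)) (conv-zeroˡ (cf f) (cf-const-suc a) n))
                   (K.+-identityʳ _)))) }

  const-+ : ∀ a b → const (a K.+ b) ≈ const a + const b
  const-+ a b = mk≋ λ
    { zero    → K.trans (cf-const-0 _) (K.sym (K.trans (cf-⊞ (const a) (const b) 0)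
                  (K.+-cong (cf-const-0 a) (cf-const-0 b))))
    ; (suc n) → K.trans (cf-const-suc _ n) (K.sym (K.trans (cf-⊞ (const a) (const b) (suc n))
                  (K.trans (K.+-cong (cf-const-suc a n) (cf-const-suc b n)) (K.+-identityˡ _)))) }

  const-* : ∀ a b → const (a K.* b) ≈ const a * const b
  const-* a b = trans
    (mk≋ λ { zero    → K.trans (cf-const-0 _) (K.sym (K.trans (cf-scale a (const b) 0) (K.*-congˡ (cf-const-0 b))))
           ; (suc n) → K.trans (cf-const-suc _ n) (K.sym (K.trans (cf-scale a (const b) (suc n))
                         (K.trans (K.*-congˡ (cf-const-suc b n)) (K.zeroʳ a)))) })
    (scale≈const* a (const b))

  ev : K.Carrier → Pol → K.Carrier
  ev x f = eval K.rawRing f x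

  module Evaluation (x : K.Carrier) where
    ev-+ : ∀ f g → ev x (f + g) K.≈ ev x f K.+ ev x g
    ev-+ []      g       rewrite []-⊞ g = K.sym (K.+-identityˡ _)
    ev-+ (a ∷ f) []      rewrite ⊞-[] (a ∷ f) = K.sym (K.+-identityʳ _)
    ev-+ (a ∷ f) (b ∷ g) rewrite ∷-⊞ a f b g = K.trans (K.+-congˡ (K.*-congˡ (ev-+ f g)))
      (K.solve 5 (λ a b x f g → (a K.:+ b) K.:+ x K.:* (f K.:+ g)
                             K.:= (a K.:+ x K.:* f) K.:+ (b K.:+ x K.:* g)) K.refl _ _ _ _ _)

    ev-0 : ∀ f → f ≈ 0# → ev x f K.≈ K.0#
    ev-0 []      p = K.refl
    ev-0 (a ∷ f) p = K.trans (K.+-cong (at p 0) (K.trans (K.*-congˡ (ev-0 f (tail≈0 p))) (K.zeroʳ x)))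
                             (K.+-identityˡ _)

    ev-cong : ∀ {f g} → f ≈ g → ev x f K.≈ ev x g
    ev-cong = additive-cong R (ev x) ev-+ ev-0

    ev-scale : ∀ a f → ev x (scale a f) K.≈ a K.* ev x f
    ev-scale a []      rewrite scale-[] a = K.sym (K.zeroʳ a)
    ev-scale a (b ∷ f) rewrite scale-∷ a b f = K.trans (K.+-congˡ (K.*-congˡ (ev-scale a f)))
      (K.solve 4 (λ a b x f → a K.:* b K.:+ x K.:* (a K.:* f)
                           K.:= a K.:* (b K.:+ x K.:* f)) K.refl _ _ _ _)

    ev-* : ∀ f g → ev x (f * g) K.≈ ev x f K.* ev x g
    ev-* []      g rewrite []-⊠ g = K.sym (K.zeroˡ _)
    ev-* (a ∷ f) g rewrite ∷-⊠ a f g = K.trans (ev-+ (scale a g) (K.0# ∷ (f * g)))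
      (K.trans (K.+-cong (ev-scale a g) (K.+-congˡ (K.*-congˡ (ev-* f g))))
        (K.solve 4 (λ a x f g → a K.:* g K.:+ (K.con 0 K.:+ x K.:* (f K.:* g))
                             K.:= (a K.:+ x K.:* f) K.:* g) K.refl _ _ _ _))

    ev-const : ∀ a → ev x (const a) K.≈ a
    ev-const a rewrite const≡∷ a = K.trans (K.+-congˡ (K.zeroʳ x)) (K.+-identityʳ a)

  open Evaluation public

  X- : K.Carrier → Pol
  X- x = const (K.- x) + X

  ev-X : ∀ y → ev y X K.≈ y
  ev-X y = K.trans (ev-cong y (sym X≈))
    (K.trans (K.+-congˡ (K.*-congˡ (ev-const y K.1#)))
      (K.trans (K.+-identityˡ _) (K.*-identityʳ y)))
    where
    X≈ : (K.0# ∷ const K.1#) ≈ X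
    X≈ = trans (0∷≈X* 1#) (*-identityʳ X)

  ev-X- : ∀ y x → ev y (X- x) K.≈ y K.- x
  ev-X- y x = K.trans (ev-+ y (const (K.- x)) X)
    (K.trans (K.+-cong (ev-const y _) (ev-X y)) (K.+-comm _ _))

  X-+const : ∀ x → X- x + const x ≈ X
  X-+const x = begin
    const (K.- x) + X + const x   ≈⟨ solve 3 (λ a b c → a :+ b :+ c := (a :+ c) :+ b) refl
                                          (const (K.- x)) X (const x) ⟩
    const (K.- x) + const x + X   ≈⟨ +-congʳ (const-+ (K.- x) x) ⟨
    const (K.- x K.+ x) + X       ≈⟨ +-congʳ (const≈0 (K.-‿inverseˡ x)) ⟩
    0# + X                        ≈⟨ +-identityˡ X ⟩
    X                             ∎

  factor : ∀ x f → ∃[ q ] f ≈ const (ev x f) + X- x * q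
  factor x []      = [] , sym (trans (+-cong (const≈0 K.refl) (zeroʳ (X- x))) (+-identityˡ 0#))
  factor x (a ∷ f) = let q , f≈ = factor x f ; r = ev x f in const r + X * q , (begin
    a ∷ f                                       ≈⟨ ∷≈const+X* a f ⟩
    const a + X * f                             ≈⟨ +-congˡ (*-congˡ f≈) ⟩
    const a + X * (const r + X- x * q)          ≈⟨ +-congˡ (distribˡ X _ _) ⟩
    const a + (X * const r + X * (X- x * q))    ≈⟨ +-congˡ (+-congʳ (*-congʳ (X-+const x))) ⟨
    const a + ((X- x + const x) * const r + X * (X- x * q))
      ≈⟨ solve 6 (λ a l c r X q → a :+ ((l :+ c) :* r :+ X :* (l :* q))
                             := (a :+ c :* r) :+ l :* (r :+ X :* q)) refl
              (const a) (X- x) (const x) (const r) X q ⟩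
    (const a + const x * const r) + X- x * (const r + X * q)
      ≈⟨ +-congʳ (trans (const-+ a (x K.* r)) (+-congˡ (const-* x r))) ⟨
    const (a K.+ x K.* r) + X- x * (const r + X * q) ∎)

  factor-root : ∀ x f → ev x f K.≈ K.0# → ∃[ q ] f ≈ X- x * q
  factor-root x f f[x]≈0 = let q , f≈ = factor x f in q ,
    trans f≈ (trans (+-congʳ (const≈0 f[x]≈0)) (+-identityˡ _))

  deriv : Pol → Pol
  deriv []      = []
  deriv (a ∷ f) = f + (K.0# ∷ deriv f)

  deriv-+ : ∀ f g → deriv (f + g) ≈ deriv f + deriv g
  deriv-+ []      g       rewrite []-⊞ g = sym (+-identityˡ _)
  deriv-+ (a ∷ f) []      rewrite ⊞-[] (a ∷ f) = sym (+-identityʳ _)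
  deriv-+ (a ∷ f) (b ∷ g) rewrite ∷-⊞ a f b g = begin
    f + g + (K.0# ∷ deriv (f + g))
      ≈⟨ +-congˡ (trans (∷-cong (K.sym (K.+-identityˡ K.0#)) (deriv-+ f g))
                        (reflexive (≡.sym (∷-⊞ K.0# (deriv f) K.0# (deriv g))))) ⟩
    f + g + ((K.0# ∷ deriv f) + (K.0# ∷ deriv g))
      ≈⟨ solve 4 (λ a b c d → a :+ b :+ (c :+ d) := a :+ c :+ (b :+ d)) refl
               f g (K.0# ∷ deriv f) (K.0# ∷ deriv g) ⟩
    f + (K.0# ∷ deriv f) + (g + (K.0# ∷ deriv g)) ∎

  0∷0≈0 : (K.0# ∷ 0#) ≈ 0#
  0∷0≈0 = mk≋ λ { zero → K.refl ; (suc n) → K.refl }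

  deriv-0 : ∀ f → f ≈ 0# → deriv f ≈ 0#
  deriv-0 []      p = refl
  deriv-0 (a ∷ f) p = trans (+-cong (tail≈0 p) (∷-cong K.refl (deriv-0 f (tail≈0 p))))
                            (trans (+-identityˡ _) 0∷0≈0)

  deriv-cong : ∀ {f g} → f ≈ g → deriv f ≈ deriv g
  deriv-cong = additive-cong polyRing deriv deriv-+ deriv-0

  deriv-scale : ∀ a f → deriv (scale a f) ≈ const a * deriv f
  deriv-scale a []      rewrite scale-[] a = sym (zeroʳ (const a))
  deriv-scale a (b ∷ f) rewrite scale-∷ a b f = begin
    scale a f + (K.0# ∷ deriv (scale a f))
      ≈⟨ +-cong (scale≈const* a f) (trans (0∷≈X* _) (*-congˡ (deriv-scale a f))) ⟩
    const a * f + X * (const a * deriv f)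
      ≈⟨ solve 4 (λ a f X d → a :* f :+ X :* (a :* d) := a :* (f :+ X :* d)) refl
               (const a) f X (deriv f) ⟩
    const a * (f + X * deriv f)  ≈⟨ *-congˡ (+-congˡ (0∷≈X* (deriv f))) ⟨
    const a * (f + (K.0# ∷ deriv f)) ∎

  deriv-* : ∀ f g → deriv (f * g) ≈ deriv f * g + f * deriv g
  deriv-* []      g rewrite []-⊠ g | []-⊠ (deriv g) = sym (+-identityʳ _)
  deriv-* (a ∷ f) g rewrite ∷-⊠ a f g = begin
    deriv (scale a g + (K.0# ∷ (f * g)))
      ≈⟨ deriv-+ (scale a g) _ ⟩
    deriv (scale a g) + (f * g + (K.0# ∷ deriv (f * g)))
      ≈⟨ +-cong (deriv-scale a g) (+-congˡ (trans (0∷≈X* _) (*-congˡ (deriv-* f g)))) ⟩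
    const a * deriv g + (f * g + X * (deriv f * g + f * deriv g))
      ≈⟨ solve 6 (λ a f g f′ g′ X → a :* g′ :+ (f :* g :+ X :* (f′ :* g :+ f :* g′))
                               := (f :+ X :* f′) :* g :+ (a :+ X :* f) :* g′) refl
               (const a) f g (deriv f) (deriv g) X ⟩
    (f + X * deriv f) * g + (const a + X * f) * deriv g
      ≈⟨ +-cong (*-congʳ (+-congˡ (0∷≈X* (deriv f)))) (*-congʳ (∷≈const+X* a f)) ⟨
    deriv (a ∷ f) * g + (a ∷ f) * deriv g ∎

  -- The degree is below `L`. Counting coefficients instead of bounding degrees includes the zero
  -- polynomial and makes `L` the dimension that enters the counting arguments.
  record Len (L : ℕ) (f : Pol) : Set where
    constructor mkLen
    field vanish : ∀ i → L ℕ.≤ i → cf f i K.≈ K.0#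
  open Len public

  Len-cong : ∀ {L f g} → f ≈ g → Len L f → Len L g
  Len-cong p (mkLen v) = mkLen λ i L≤i → K.trans (K.sym (at p i)) (v i L≤i)

  Len-mono : ∀ {L L′ f} → L ℕ.≤ L′ → Len L f → Len L′ f
  Len-mono L≤L′ (mkLen v) = mkLen λ i L′≤i → v i (ℕₚ.≤-trans L≤L′ L′≤i)

  Len-0 : ∀ {L} → Len L 0#
  Len-0 = mkLen λ _ _ → K.refl

  Len-const : ∀ a → Len 1 (const a)
  Len-const a = mkLen λ { (suc i) (s≤s _) → cf-const-suc a i }

  Len-+ : ∀ {L f g} → Len L f → Len L g → Len L (f + g)
  Len-+ {L} {f} {g} (mkLen v) (mkLen w) = mkLen λ i L≤i → K.trans (cf-⊞ f g i)
    (K.trans (K.+-cong (v i L≤i) (w i L≤i)) (K.+-identityˡ _))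

  Len-* : ∀ {a b f g} → Len (suc a) f → Len b g → Len (a ℕ.+ b) (f * g)
  Len-* {a} {b} {f} {g} (mkLen v) (mkLen w) = mkLen λ i a+b≤i →
    K.trans (cf-⊠ f g i) (conv-vanish a b (cf f) (cf g) v w i a+b≤i)

  Len-sum : ∀ {L n} (f : Fin n → Pol) → (∀ i → Len L (f i)) → Len L (sum f)
  Len-sum {n = zero}  f l = Len-0
  Len-sum {n = suc n} f l = Len-+ (l zero) (Len-sum (f ∘ suc) (l ∘ suc))

  Len-deriv : ∀ {L} f → Len L f → Len L (deriv f)
  Len-deriv     []      l         = Len-0
  Len-deriv {L} (a ∷ f) (mkLen v) = Len-+
    (mkLen λ i L≤i → v (suc i) (ℕₚ.m≤n⇒m≤1+n L≤i))
    (mkLen λ { zero    L≤i → K.refl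
             ; (suc i) L≤i → vanish (Len-deriv f (mkLen λ j L-1≤j → v (suc j)
                                 (ℕₚ.≤-trans (ℕₚ.m≤n+m∸n L 1) (s≤s L-1≤j))))
                               i (ℕₚ.≤-trans (ℕₚ.∸-monoˡ-≤ 1 L≤i) ℕₚ.≤-refl) })

  Len-length : ∀ f → Len (length f) f
  Len-length []      = Len-0
  Len-length (a ∷ f) = mkLen λ { (suc i) (s≤s p) → vanish (Len-length f) i p }

  Len0⇒≈0 : ∀ {f} → Len 0 f → f ≈ 0#
  Len0⇒≈0 (mkLen v) = mk≋ λ n → v n z≤n

  deriv-const : ∀ {f} → Len 1 f → deriv f ≈ 0#
  deriv-const {[]}    l = refl
  deriv-const {a ∷ f} (mkLen v) =
    trans (+-cong f≈0 (∷-cong K.refl (deriv-0 f f≈0))) (trans (+-identityˡ _) 0∷0≈0)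
    where
    f≈0 : f ≈ 0#
    f≈0 = mk≋ λ n → v (suc n) (s≤s z≤n)

  deriv-X- : ∀ x → deriv (X- x) ≈ 1#
  deriv-X- x = begin
    deriv (const (K.- x) + X)           ≈⟨ deriv-+ (const (K.- x)) X ⟩
    deriv (const (K.- x)) + deriv X     ≈⟨ +-cong (deriv-const (Len-const _)) deriv-X ⟩
    0# + 1#                             ≈⟨ +-identityˡ 1# ⟩
    1#                                  ∎
    where
    deriv-X : deriv X ≈ 1#
    deriv-X = begin
      deriv X                     ≈⟨ deriv-cong (trans (0∷≈X* 1#) (*-identityʳ X)) ⟨
      1# + (K.0# ∷ deriv 1#)      ≈⟨ +-congˡ (∷-cong K.refl (deriv-const (Len-const _))) ⟩
      1# + (K.0# ∷ 0#)            ≈⟨ +-congˡ 0∷0≈0 ⟩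
      1# + 0#                     ≈⟨ +-identityʳ 1# ⟩
      1#                          ∎

  record Deg (f : Pol) (m : ℕ) : Set where
    constructor mkDeg
    field
      lead≉0 : ¬ (cf f m K.≈ K.0#)
      len    : Len (suc m) f
  open Deg public

  Deg-cong : ∀ {f g m} → f ≈ g → Deg f m → Deg g m
  Deg-cong p (mkDeg l≉0 l) = mkDeg (λ e → l≉0 (K.trans (at p _) e)) (Len-cong p l)

  module Domain (_≟_ : Decidable K._≈_) (1≉0 : ¬ (K.1# K.≈ K.0#))
                (zero-product : ∀ x y → x K.* y K.≈ K.0# → x K.≈ K.0# ⊎ y K.≈ K.0#) where

    zero? : ∀ f → Dec (f ≈ 0#)
    zero? []      = yes refl
    zero? (a ∷ f) with a ≟ K.0# | zero? f
    ... | yes p | yes q = yes (mk≋ λ { zero → p ; (suc n) → at q n })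
    ... | no ¬p | _     = no λ e → ¬p (at e 0)
    ... | _     | no ¬q = no λ e → ¬q (tail≈0 e)

    cf-top : ∀ {m n f g} → Len (suc m) f → Len (suc n) g →
             cf (f * g) (m ℕ.+ n) K.≈ cf f m K.* cf g n
    cf-top {m} {n} {f} {g} (mkLen v) (mkLen w) =
      K.trans (cf-⊠ f g _) (conv-top m n (cf f) (cf g) v w)

    Deg-* : ∀ {f g m n} → Deg f m → Deg g n → Deg (f * g) (m ℕ.+ n)
    Deg-* {f} {g} {m} {n} (mkDeg f≉0 lf) (mkDeg g≉0 lg) = mkDeg
      (λ e → case (zero-product _ _ (K.trans (K.sym (cf-top lf lg)) e)))
      (≡.subst (λ L → Len L (f * g)) (ℕₚ.+-suc m n) (Len-* lf lg))
      where
      case : ¬ (cf f m K.≈ K.0# ⊎ cf g n K.≈ K.0#)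
      case (inj₁ e) = f≉0 e
      case (inj₂ e) = g≉0 e

    Deg-1 : Deg 1# 0
    Deg-1 = mkDeg (λ e → 1≉0 (K.trans (K.sym (cf-const-0 _)) e)) (Len-const _)

    Deg-X- : ∀ x → Deg (X- x) 1
    Deg-X- x = mkDeg
      (λ e → 1≉0 (K.trans (K.sym (lead 0 (cf-const-0 _))) e))
      (mkLen λ { (suc (suc i)) _ → lead (suc i) (cf-const-suc _ i) ; (suc zero) (s≤s ()) })
      where
      lead : ∀ i {a} → cf 1# i K.≈ a → cf (X- x) (suc i) K.≈ a
      lead i e = K.trans (cf-⊞ (const (K.- x)) X (suc i))
        (K.trans (K.+-cong (cf-const-suc _ i) (K.trans (cf-X-suc i) e)) (K.+-identityˡ _))

    ∃Deg : ∀ f → ¬ (f ≈ 0#) → ∃[ m ] Deg f m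
    ∃Deg []      f≉0 = contradiction refl f≉0
    ∃Deg (a ∷ f) f≉0 with zero? f
    ... | no ¬p = let m , mkDeg l≉0 (mkLen v) = ∃Deg f ¬p in
      suc m , mkDeg l≉0 (mkLen λ { (suc i) (s≤s p) → v i p })
    ... | yes p = 0 , mkDeg (λ e → f≉0 (mk≋ λ { zero → e ; (suc n) → at p n }))
                            (mkLen λ { (suc i) _ → at p i })

    -- If `h` has length `L + k + 1`, its last coefficient times the leading coefficient of `f` is a
    -- coefficient of `f * h` in the range that vanishes. In a domain the former is therefore zero,
    -- and `k` descends to 0.
    Len-quotient : ∀ {f m} L h → Deg f m → Len (m ℕ.+ L) (f * h) → Len L h
    Len-quotient {f} {m} L h (mkDeg f≉0 lf) (mkLen v) =
      go (length h) (Len-mono (ℕₚ.m≤n+m (length h) L) (Len-length h))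
      where
      go : ∀ k → Len (L ℕ.+ k) h → Len L h
      go zero    l = ≡.subst (λ L → Len L h) (ℕₚ.+-identityʳ L) l
      go (suc k) l = go k (mkLen low)
        where
        l′ : Len (suc (L ℕ.+ k)) h
        l′ = ≡.subst (λ L → Len L h) (ℕₚ.+-suc L k) l
        low : ∀ i → L ℕ.+ k ℕ.≤ i → cf h i K.≈ K.0#
        low i L+k≤i with ℕₚ.m≤n⇒m<n∨m≡n L+k≤i
        ... | inj₁ L+k<i = vanish l′ i L+k<i
        ... | inj₂ ≡.refl with zero-product _ _ (K.trans (K.sym (cf-top lf l′))
                                 (v _ (ℕₚ.+-monoʳ-≤ m (ℕₚ.m≤m+n L k))))
        ...   | inj₁ e = contradiction e f≉0
        ...   | inj₂ e = e

    *-cancel-0 : ∀ {f m} h → Deg f m → f * h ≈ 0# → h ≈ 0#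
    *-cancel-0 h d e = Len0⇒≈0 (Len-quotient 0 h d (Len-cong (sym e) Len-0))

-- Polynomials over a field with p elements: comaximality, multiple zeros, Siegel's lemma

-- Up to `≈`, `elem` is a bijection from `Fin p`: the pigeonhole argument and the search for a
-- nonroot depend on there being exactly p elements. By `characteristic`, the multiples m · 1 with 0
-- < m < p can be cancelled when θ is used to measure vanishing orders.
record FinitePrimeField (p : ℕ) : Set₁ where
  field
    commutativeRing : CommutativeRing 0ℓ 0ℓ
  open CommutativeRing commutativeRing public
  open RawMonoidDefinitions +-rawMonoid public using () renaming (_×_ to _×ⁿ_)
  field
    _≟_          : Decidable _≈_
    1≉0          : ¬ (1# ≈ 0#)
    zero-product : ∀ x y → x * y ≈ 0# → x ≈ 0# ⊎ y ≈ 0#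
    inverse      : ∀ x → ¬ (x ≈ 0#) → ∃[ y ] x * y ≈ 1#
    characteristic : ∀ n → 0 ℕ.< n → n ℕ.< p → ¬ (n ×ⁿ 1# ≈ 0#)
    1<p          : 1 ℕ.< p
    index        : Carrier → Fin p
    elem         : Fin p → Carrier
    elem-index   : ∀ x → elem (index x) ≈ x
    index-elem   : ∀ i j → elem i ≈ elem j → i ≡ j

module FieldPolynomials {p : ℕ} (𝕂 : FinitePrimeField p) where
  module K where
    open FinitePrimeField 𝕂 public
    open SemiringSolver commutativeSemiring public using (solve; _:=_; _:+_; _:*_; con)
  open PolynomialCalculus K.commutativeRing public
  open Domain K._≟_ K.1≉0 K.zero-product public
  open CommutativeRing polyRing public hiding (zero)
  open SemiringSum semiring public using (sum; sum-cong-≋; ∑-distrib-+; sum-remove)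
  open SemiringExp semiring public using (_^_; ^-homo-*; ^-assocʳ)
  open MonoidSum *-commutativeMonoid public using () renaming (sum to product; sum-remove to product-remove)
  open SemiringSolver commutativeSemiring public using (solve; _:=_; _:+_; _:*_; con)
  open SetoidReasoning setoid public

  +-cancel-0 : ∀ {f} g → f + g ≈ g → f ≈ 0#
  +-cancel-0 {f} g e = GroupProperties.identityˡ-unique +-group f g e

  infix 4 _∣ᴾ_
  _∣ᴾ_ : Pol → Pol → Set
  f ∣ᴾ g = ∃[ h ] g ≈ f * h

  Comaximal : Pol → Pol → Set
  Comaximal f g = ∃[ a ] ∃[ b ] a * f + b * g ≈ 1#

  comaximal-sym : ∀ {f g} → Comaximal f g → Comaximal g f
  comaximal-sym (a , b , e) = b , a , trans (+-comm _ _) e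

  comaximal-1 : ∀ f → Comaximal f 1#
  comaximal-1 f = 0# , 1# , trans (+-cong (zeroˡ f) (*-identityˡ 1#)) (+-identityˡ 1#)

  comaximal-* : ∀ {f g h} → Comaximal f g → Comaximal f h → Comaximal f (g * h)
  comaximal-* {f} {g} {h} (a , b , e) (c , d , e′) = a * (c * f + d * h) + b * c * g , b * d , (begin
    (a * (c * f + d * h) + b * c * g) * f + b * d * (g * h)
      ≈⟨ solve 7 (λ a b c d f g h → (a :* (c :* f :+ d :* h) :+ b :* c :* g) :* f :+ b :* d :* (g :* h)
                                 := (a :* f :+ b :* g) :* (c :* f :+ d :* h)) refl a b c d f g h ⟩
    (a * f + b * g) * (c * f + d * h)  ≈⟨ *-cong e e′ ⟩
    1# * 1#                            ≈⟨ *-identityˡ 1# ⟩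
    1#                                 ∎)

  comaximal-^ : ∀ {f g} n → Comaximal f g → Comaximal f (g ^ n)
  comaximal-^ {f} zero    e = comaximal-1 f
  comaximal-^     (suc n) e = comaximal-* e (comaximal-^ n e)

  comaximal-product : ∀ {f n} (g : Fin n → Pol) → (∀ i → Comaximal f (g i)) → Comaximal f (product g)
  comaximal-product {f} {zero}  g e = comaximal-1 f
  comaximal-product {f} {suc n} g e = comaximal-* (e zero) (comaximal-product (g ∘ suc) (e ∘ suc))

  -- Euclid's lemma, read off from the Bezout identity. With comaximality in place of coprimality,
  -- neither gcds nor unique factorisation enter.
  comaximal-∣ : ∀ {f g} h → Comaximal f g → f ∣ᴾ g * h → f ∣ᴾ h
  comaximal-∣ {f} {g} h (a , b , e) (q , gh≈fq) = a * h + b * q , (begin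
    h                          ≈⟨ *-identityˡ h ⟨
    1# * h                     ≈⟨ *-congʳ e ⟨
    (a * f + b * g) * h        ≈⟨ solve 5 (λ a b f g h → (a :* f :+ b :* g) :* h
                                         := a :* f :* h :+ b :* (g :* h)) refl a b f g h ⟩
    a * f * h + b * (g * h)    ≈⟨ +-congˡ (*-congˡ gh≈fq) ⟩
    a * f * h + b * (f * q)    ≈⟨ solve 5 (λ a b f q h → a :* f :* h :+ b :* (f :* q)
                                         := f :* (a :* h :+ b :* q)) refl a b f q h ⟩
    f * (a * h + b * q)        ∎)

  comaximal-factor : ∀ {f g h} → Comaximal f (g * h) → Comaximal f g
  comaximal-factor {f} {g} {h} (a , b , e) = a , b * h ,
    trans (+-congˡ (trans (*-assoc b h g) (*-congˡ (*-comm h g)))) e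

  const-inverse : ∀ {a} → ¬ (a K.≈ K.0#) → ∃[ b ] const b * const a ≈ 1#
  const-inverse {a} a≉0 = let b , ab≈1 = K.inverse a a≉0 in b ,
    trans (sym (const-* b a)) (mk≋ λ
      { zero    → K.trans (cf-const-0 _) (K.trans (K.*-comm b a) (K.trans ab≈1 (K.sym (cf-const-0 _))))
      ; (suc n) → K.trans (cf-const-suc _ n) (K.sym (cf-const-suc _ n)) })

  comaximal-shift : ∀ {f g a} → ¬ (a K.≈ K.0#) → f ≈ const a + g → Comaximal f g
  comaximal-shift {f} {g} {a} a≉0 f≈ = let b , ba≈1 = const-inverse a≉0 in const b , - const b , (begin
    const b * f + - const b * g          ≈⟨ +-congʳ (*-congˡ f≈) ⟩
    const b * (const a + g) + - const b * g
      ≈⟨ solve 4 (λ b a g c → b :* (a :+ g) :+ c :* g := b :* a :+ (b :+ c) :* g) refl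
               (const b) (const a) g (- const b) ⟩
    const b * const a + (const b + - const b) * g  ≈⟨ +-cong ba≈1 (*-congʳ (-‿inverseʳ _)) ⟩
    1# + 0# * g                                    ≈⟨ +-congˡ (zeroˡ g) ⟩
    1# + 0#                                        ≈⟨ +-identityʳ 1# ⟩
    1#                                             ∎)

  comaximal-X- : ∀ {x y} → ¬ (x K.≈ y) → Comaximal (X- y) (X- x)
  comaximal-X- {x} {y} x≉y = comaximal-shift {a = x K.- y}
    (λ e → x≉y (K.trans (GroupProperties.inverseˡ-unique K.+-group x (K.- y) e)
                        (GroupProperties.⁻¹-involutive K.+-group y)))
    (begin
      const (K.- y) + X
        ≈⟨ +-congˡ (X-+const x) ⟨
      const (K.- y) + (const (K.- x) + X + const x)
        ≈⟨ solve 4 (λ y x′ X x → y :+ (x′ :+ X :+ x) := (x :+ y) :+ (x′ :+ X)) refl _ _ _ _ ⟩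
      const x + const (K.- y) + X- x
        ≈⟨ +-congʳ (const-+ x (K.- y)) ⟨
      const (x K.- y) + X- x ∎)

  Deg-^ : ∀ {f m} n → Deg f m → Deg (f ^ n) (n ℕ.* m)
  Deg-^ zero    d = Deg-1
  Deg-^ (suc n) d = Deg-* d (Deg-^ n d)

  Distinct : List K.Carrier → Set
  Distinct = AllPairs (λ x y → ¬ (x K.≈ y))

  -- One point is divided out at a time. The cofactor keeps its `M`-fold zeros at the other points,
  -- because powers of distinct linear factors are comaximal, and its length drops by `M`.
  too-many-zeros : ∀ M xs g {L} → Distinct xs → All (λ x → X- x ^ M ∣ᴾ g) xs →
                   Len L g → L ℕ.≤ length xs ℕ.* M → g ≈ 0#
  too-many-zeros M []       g _          _             l L≤ = Len0⇒≈0 (Len-mono L≤ l)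
  too-many-zeros M (x ∷ xs) g {L} (x≉ ∷ d) ((h , g≈) ∷ v) l L≤ =
    trans g≈ (trans (*-congˡ h≈0) (zeroʳ _))
    where
    l′ : Len (L ℕ.∸ M) h
    l′ = Len-quotient (L ℕ.∸ M) h (Deg-^ M (Deg-X- x)) (Len-cong g≈ (Len-mono
           (≡.subst (λ m → L ℕ.≤ m ℕ.+ (L ℕ.∸ M)) (≡.sym (ℕₚ.*-identityʳ M)) (ℕₚ.m≤n+m∸n L M)) l))
    rest : ∀ {ys} → All (λ y → ¬ (x K.≈ y)) ys → All (λ y → X- y ^ M ∣ᴾ g) ys → All (λ y → X- y ^ M ∣ᴾ h) ys
    rest []          []             = []
    rest (x≉y ∷ x≉) ((q , e) ∷ v) =
      comaximal-∣ h (comaximal-sym (comaximal-^ M (comaximal-sym (comaximal-^ M (comaximal-X- x≉y)))))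
        (q , trans (sym g≈) e) ∷ rest x≉ v
    h≈0 : h ≈ 0#
    h≈0 = too-many-zeros M xs h d (rest x≉ v) l′
      (ℕₚ.≤-trans (ℕₚ.∸-monoˡ-≤ M L≤) (ℕₚ.≤-reflexive (ℕₚ.m+n∸m≡n M (length xs ℕ.* M))))

  ^1-∣ : ∀ {f g} → f ∣ᴾ g → f ^ 1 ∣ᴾ g
  ^1-∣ {f} (h , e) = h , trans e (*-congʳ (sym (*-identityʳ f)))

  zero-by-values : ∀ xs g {L} → Distinct xs → All (λ x → ev x g K.≈ K.0#) xs →
                   Len L g → L ℕ.≤ length xs → g ≈ 0#
  zero-by-values xs g d v l L≤ = too-many-zeros 1 xs g d
    (All.map (λ {x} e → ^1-∣ (factor-root x g e)) v) l
    (ℕₚ.≤-trans L≤ (ℕₚ.≤-reflexive (≡.sym (ℕₚ.*-identityʳ _))))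

  -- Over a field with p elements a nonzero polynomial such as X^p - X may vanish everywhere; length
  -- at most p excludes this.
  nonroot : ∀ f → ¬ (f ≈ 0#) → Len p f → ∃[ x ] ¬ (ev x f K.≈ K.0#)
  nonroot f f≉0 l = satisfied (Allₚ.¬All⇒Any¬ (λ x → ev x f K.≟ K.0#) (List.tabulate K.elem)
    λ a → f≉0 (zero-by-values (List.tabulate K.elem) f
      (AllPairsₚ.tabulate⁺ (λ i≢j e → i≢j (K.index-elem _ _ e))) a l
      (ℕₚ.≤-reflexive (≡.sym (Listₚ.length-tabulate K.elem)))))

  funToFin-cong : ∀ {m n} (f g : Fin m → Fin n) → (∀ i → f i ≡ g i) → funToFin f ≡ funToFin g
  funToFin-cong {zero}  f g e = ≡.refl
  funToFin-cong {suc m} f g e = ≡.cong₂ combine (e zero) (funToFin-cong (f ∘ suc) (g ∘ suc) (e ∘ suc))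

  cf-tabulate : ∀ {n} (h : Fin n → K.Carrier) i → cf (List.tabulate h) (toℕ i) ≡ h i
  cf-tabulate h zero    = ≡.refl
  cf-tabulate h (suc i) = cf-tabulate (h ∘ suc) i

  Len-tabulate : ∀ {n} (h : Fin n → K.Carrier) → Len n (List.tabulate h)
  Len-tabulate h = ≡.subst (λ n → Len n (List.tabulate h)) (Listₚ.length-tabulate h) (Len-length _)

  -- Siegel's lemma, by the pigeonhole principle: there are more tuples c of
  -- polynomials of length ≤ L than possible values of Φ c.
  module Siegel (m L e L′ : ℕ) (eL′<mL : e ℕ.* L′ ℕ.< m ℕ.* L)
    (Φ : (Fin m → Pol) → Fin e → Pol)
    (Φ-+ : ∀ c d j → Φ (λ i → c i + d i) j ≈ Φ c j + Φ d j)
    (Φ-cong : ∀ c d → (∀ i → c i ≈ d i) → ∀ j → Φ c j ≈ Φ d j)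
    (Φ-len : ∀ c → (∀ i → Len L (c i)) → ∀ j → Len L′ (Φ c j)) where

    private
      decode : Fin (p ℕ.^ (m ℕ.* L)) → Fin m → Pol
      decode n i = List.tabulate λ j → K.elem (finToFun n (combine i j))

      encode : (Fin e → Pol) → Fin (p ℕ.^ (e ℕ.* L′))
      encode d = funToFin λ k → let (i , j) = remQuot L′ k in K.index (cf (d i) (toℕ j))

      decode-injective : ∀ n n′ → (∀ i → decode n i ≈ decode n′ i) → n ≡ n′
      decode-injective n n′ eq = ≡.trans (≡.sym (Finₚ.funToFin-finToFin {m ℕ.* L} {p} n))
        (≡.trans (funToFin-cong (finToFun n) (finToFun n′) eq′) (Finₚ.funToFin-finToFin {m ℕ.* L} {p} n′))
        where
        eq″ : ∀ i j → finToFun n (combine i j) ≡ finToFun n′ (combine i j)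
        eq″ i j = K.index-elem _ _ (K.trans (K.reflexive (≡.sym (cf-tabulate _ j)))
          (K.trans (at (eq i) (toℕ j)) (K.reflexive (cf-tabulate _ j))))
        eq′ : ∀ k → finToFun n k ≡ finToFun n′ k
        eq′ k = ≡.subst (λ k → finToFun n k ≡ finToFun n′ k) (Finₚ.combine-remQuot {m} L k) (uncurry eq″ (remQuot L k))

      encode-injective : ∀ d d′ → (∀ j → Len L′ (d j)) → (∀ j → Len L′ (d′ j)) →
                         encode d ≡ encode d′ → ∀ j → d j ≈ d′ j
      encode-injective d d′ l l′ eq j = mk≋ same
        where
        code : (Fin e → Pol) → Fin (e ℕ.* L′) → Fin p
        code d k = let (i , j) = remQuot L′ k in K.index (cf (d i) (toℕ j))
        eq′ : ∀ k → code d k ≡ code d′ k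
        eq′ k = ≡.trans (≡.sym (Finₚ.finToFun-funToFin (code d) k))
          (≡.trans (≡.cong (λ n → finToFun n k) eq) (Finₚ.finToFun-funToFin (code d′) k))
        eq″ : ∀ t → K.index (cf (d j) (toℕ t)) ≡ K.index (cf (d′ j) (toℕ t))
        eq″ t = ≡.subst (λ (jt : Fin e × Fin L′) → K.index (cf (d (proj₁ jt)) (toℕ (proj₂ jt)))
                                                 ≡ K.index (cf (d′ (proj₁ jt)) (toℕ (proj₂ jt))))
                  (Finₚ.remQuot-combine j t) (eq′ (combine j t))
        same : ∀ n → cf (d j) n K.≈ cf (d′ j) n
        same n with n ℕₚ.<? L′
        ... | no n≮L′ = K.trans (vanish (l j) n (ℕₚ.≮⇒≥ n≮L′)) (K.sym (vanish (l′ j) n (ℕₚ.≮⇒≥ n≮L′)))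
        ... | yes n<L′ = ≡.subst (λ n → cf (d j) n K.≈ cf (d′ j) n) (Finₚ.toℕ-fromℕ< n<L′)
          (K.trans (K.sym (K.elem-index _)) (K.trans (K.reflexive (≡.cong K.elem (eq″ (Fin.fromℕ< n<L′)))) (K.elem-index _)))

    opaque
      kernel : ∃[ c ] (∀ i → Len L (c i)) × ¬ (∀ i → c i ≈ 0#) × (∀ j → Φ c j ≈ 0#)
      kernel with Finₚ.pigeonhole (ℕₚ.^-monoʳ-< p K.1<p eL′<mL) (λ n → encode (Φ (decode n)))
      ... | n , n′ , n<n′ , eq = c , len-c , nonzero , null
        where
        len-decode : ∀ n i → Len L (decode n i)
        len-decode n i = Len-tabulate _
        c : Fin m → Pol
        c i = decode n i + - decode n′ i
        c+ : ∀ i → c i + decode n′ i ≈ decode n i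
        c+ i = trans (+-assoc _ _ _) (trans (+-congˡ (-‿inverseˡ _)) (+-identityʳ _))
        len-c : ∀ i → Len L (c i)
        len-c i = Len-+ (len-decode n i) (mkLen λ t L≤t → K.trans (cf-⊟ (decode n′ i) t)
          (K.trans (K.-‿cong (vanish (len-decode n′ i) t L≤t)) (GroupProperties.ε⁻¹≈ε K.+-group)))
        nonzero : ¬ (∀ i → c i ≈ 0#)
        nonzero z = Finₚ.<⇒≢ n<n′ (decode-injective n n′ λ i →
          trans (sym (c+ i)) (trans (+-congʳ (z i)) (+-identityˡ _)))
        -- `Φ` is only known to be additive, so the value at the difference is obtained by adding
        -- `Φ (decode n′)` and cancelling it.
        null : ∀ j → Φ c j ≈ 0#
        null j = +-cancel-0 (Φ (decode n′) j) (begin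
          Φ c j + Φ (decode n′) j      ≈⟨ Φ-+ c (decode n′) j ⟨
          Φ (λ i → c i + decode n′ i) j ≈⟨ Φ-cong _ (decode n) c+ j ⟩
          Φ (decode n) j               ≈⟨ encode-injective _ _ (Φ-len _ (len-decode n)) (Φ-len _ (len-decode n′)) eq j ⟩
          Φ (decode n′) j              ∎)

-- Linear differential operators and orders of vanishing

module Differential {p : ℕ} (𝕂 : FinitePrimeField p) where
  open FieldPolynomials 𝕂

  iter : (Pol → Pol) → ℕ → Pol → Pol
  iter D zero    g = g
  iter D (suc j) g = iter D j (D g)

  -- The operator ∑ c_i D^i, of order below `m`, applied to a polynomial. The coefficients stand on
  -- the left, so for fixed `g` the result is additive in `c`; this lets Siegel's lemma choose the
  -- operator.
  diffOp : (Pol → Pol) → ∀ {m} → (Fin m → Pol) → Pol → Pol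
  diffOp D {zero}  c g = 0#
  diffOp D {suc m} c g = c zero * g + diffOp D (c ∘ suc) (D g)

  record Additive (D : Pol → Pol) : Set where
    constructor mkAdditive
    field
      +-hom : ∀ f g → D (f + g) ≈ D f + D g
      cong  : ∀ {f g} → f ≈ g → D f ≈ D g

    0-hom : D 0# ≈ 0#
    0-hom = +-cancel-0 (D 0#) (trans (sym (+-hom 0# 0#)) (cong (+-identityˡ 0#)))

    sum-hom : ∀ {n} (f : Fin n → Pol) → D (sum f) ≈ sum (D ∘ f)
    sum-hom {zero}  f = 0-hom
    sum-hom {suc n} f = trans (+-hom _ _) (+-congˡ (sum-hom (f ∘ suc)))

  module _ {D : Pol → Pol} (D-additive : Additive D) where
    open Additive D-additive

    iter-additive : ∀ j → Additive (iter D j)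
    iter-additive zero    = mkAdditive (λ _ _ → refl) id
    iter-additive (suc j) = let open Additive (iter-additive j) renaming (+-hom to +-hom′; cong to cong′) in
      mkAdditive (λ f g → trans (cong′ (+-hom f g)) (+-hom′ _ _)) (cong′ ∘ cong)

    diffOp-additive : ∀ {m} (c : Fin m → Pol) → Additive (diffOp D c)
    diffOp-additive {zero}  c = mkAdditive (λ _ _ → sym (+-identityˡ 0#)) (λ _ → refl)
    diffOp-additive {suc m} c = let open Additive (diffOp-additive (c ∘ suc)) renaming (+-hom to +-hom′; cong to cong′) in
      mkAdditive
        (λ f g → trans (+-congˡ (trans (cong′ (+-hom f g)) (+-hom′ _ _)))
          (solve 5 (λ c f g x y → c :* (f :+ g) :+ (x :+ y) := c :* f :+ x :+ (c :* g :+ y)) refl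
                 (c zero) f g _ _))
        (λ e → +-cong (*-congˡ e) (cong′ (cong e)))

  diffOp-+ : ∀ D {m} (c d : Fin m → Pol) g → diffOp D (λ i → c i + d i) g ≈ diffOp D c g + diffOp D d g
  diffOp-+ D {zero}  c d g = sym (+-identityˡ 0#)
  diffOp-+ D {suc m} c d g = trans (+-congˡ (diffOp-+ D (c ∘ suc) (d ∘ suc) (D g)))
    (solve 5 (λ c d g x y → (c :+ d) :* g :+ (x :+ y) := c :* g :+ x :+ (d :* g :+ y)) refl
           (c zero) (d zero) g _ _)

  diffOp-cong : ∀ D {m} (c d : Fin m → Pol) g → (∀ i → c i ≈ d i) → diffOp D c g ≈ diffOp D d g
  diffOp-cong D {zero}  c d g e = refl
  diffOp-cong D {suc m} c d g e = +-cong (*-congʳ (e zero)) (diffOp-cong D (c ∘ suc) (d ∘ suc) (D g) (e ∘ suc))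

  diffOp-0 : ∀ D {m} (c : Fin m → Pol) g → (∀ i → c i ≈ 0#) → diffOp D c g ≈ 0#
  diffOp-0 D {zero}  c g e = refl
  diffOp-0 D {suc m} c g e = trans (+-cong (trans (*-congʳ (e zero)) (zeroˡ g)) (diffOp-0 D (c ∘ suc) (D g) (e ∘ suc)))
                               (+-identityˡ 0#)

  module _ (D : Pol → Pol) (Δ : ℕ) (D-len : ∀ {L f} → Len L f → Len (Δ ℕ.+ L) (D f)) where
    Len-iter : ∀ {L} j {f} → Len L f → Len (L ℕ.+ j ℕ.* Δ) (iter D j f)
    Len-iter {L} zero    {f} l = ≡.subst (λ n → Len n f) (≡.sym (ℕₚ.+-identityʳ L)) l
    Len-iter {L} (suc j) {f} l = ≡.subst (λ n → Len n (iter D j (D f)))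
      (≡.trans (≡.cong (ℕ._+ j ℕ.* Δ) (ℕₚ.+-comm Δ L)) (ℕₚ.+-assoc L Δ (j ℕ.* Δ)))
      (Len-iter j (D-len l))

    Len-diffOp : ∀ {E L m} {c : Fin m → Pol} {f} → (∀ i → Len E (c i)) → Len L f →
             Len (E ℕ.+ (L ℕ.+ m ℕ.* Δ)) (diffOp D c f)
    Len-diffOp {m = zero}  lc l = Len-0
    Len-diffOp {E} {L} {suc m} {c} {f} lc l = Len-+
      (Len-mono (ℕₚ.+-monoʳ-≤ E (ℕₚ.m≤m+n L _)) (Len-* (Len-mono (ℕₚ.n≤1+n E) (lc zero)) l))
      (≡.subst (λ n → Len (E ℕ.+ n) (diffOp D (c ∘ suc) (D f)))
        (≡.trans (≡.cong (ℕ._+ m ℕ.* Δ) (ℕₚ.+-comm Δ L)) (ℕₚ.+-assoc L Δ (m ℕ.* Δ)))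
        (Len-diffOp (lc ∘ suc) (D-len l)))

  -- Siegel's lemma does not say which coefficients are nonzero. Zero coefficients at the top are
  -- cut off to reach the true order `r`; only with `l` nonzero can the equation be solved for its
  -- highest derivative.
  leading-coefficient : ∀ D {E m} (c : Fin m → Pol) → ¬ (∀ i → c i ≈ 0#) → (∀ i → Len E (c i)) →
    ∃[ r ] ∃[ c′ ] ∃[ l ] r ℕ.< m × ¬ (l ≈ 0#) × Len E l ×
      (∀ g → diffOp D c g ≈ diffOp D {r} c′ g + l * iter D r g)
  leading-coefficient D {m = zero}  c c≉0 lc = contradiction (λ ()) c≉0
  leading-coefficient D {m = suc m} c c≉0 lc with Finₚ.all? (λ i → zero? (c (suc i)))
  ... | yes z = 0 , (λ ()) , c zero , s≤s z≤n ,
        (λ e → c≉0 λ { zero → e ; (suc i) → z i }) , lc zero ,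
        λ g → trans (+-congˡ (diffOp-0 D (c ∘ suc) (D g) z)) (+-comm _ _)
  ... | no ¬z with leading-coefficient D (c ∘ suc) ¬z (lc ∘ suc)
  ...   | r , c′ , l , r<m , l≉0 , ll , eq = suc r , (λ { zero → c zero ; (suc i) → c′ i }) , l ,
          s≤s r<m , l≉0 , ll , λ g → trans (+-congˡ (eq (D g))) (sym (+-assoc _ _ _))

  diffOp-absorb : ∀ D {m} (c : Fin (suc m) → Pol) e → ∃[ c′ ] ∀ g → diffOp D c g + e * iter D m g ≈ diffOp D {suc m} c′ g
  diffOp-absorb D {zero}  c e = (λ _ → c zero + e) ,
    λ g → solve 3 (λ c g e → c :* g :+ con 0 :+ e :* g := (c :+ e) :* g :+ con 0) refl (c zero) g e
  diffOp-absorb D {suc m} c e with diffOp-absorb D (c ∘ suc) e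
  ... | c′ , eq = (λ { zero → c zero ; (suc i) → c′ i }) ,
    λ g → trans (+-assoc _ _ _) (+-congˡ (eq (D g)))

  ev-diffOp : ∀ D x {m} (c : Fin m → Pol) g → (∀ j → j ℕ.< m → ev x (iter D j g) K.≈ K.0#) → ev x (diffOp D c g) K.≈ K.0#
  ev-diffOp D x {zero}  c g v = ev-0 x 0# refl
  ev-diffOp D x {suc m} c g v = K.trans (ev-+ x _ _) (K.trans
    (K.+-cong (K.trans (ev-* x (c zero) g) (K.trans (K.*-congˡ (v 0 (s≤s z≤n))) (K.zeroʳ _)))
              (ev-diffOp D x (c ∘ suc) (D g) (λ j j<m → v (suc j) (s≤s j<m))))
    (K.+-identityˡ _))

  module _ (F : Pol) where
    opaque
      -- The factor `F` clears denominators: for a product w of powers of the factors of `F`, the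
      -- logarithmic derivative F w′ / w is a polynomial, of a degree bounded independently of the
      -- exponents. At points where `F` does not vanish the factor is harmless.
      θ : Pol → Pol
      θ f = F * deriv f

      θ-additive : Additive θ
      θ-additive = mkAdditive
        (λ f g → trans (*-congˡ (deriv-+ f g)) (distribˡ F _ _))
        (λ e → *-congˡ (deriv-cong e))

      θ-* : ∀ f g → θ (f * g) ≈ θ f * g + f * θ g
      θ-* f g = trans (*-congˡ (deriv-* f g))
        (solve 5 (λ F f′ g f g′ → F :* (f′ :* g :+ f :* g′) := F :* f′ :* g :+ f :* (F :* g′)) refl
               F (deriv f) g f (deriv g))

      θ-const : ∀ {c} → Len 1 c → θ c ≈ 0#
      θ-const l = trans (*-congˡ (deriv-const l)) (zeroʳ F)

      θ-X- : ∀ x → θ (X- x) ≈ F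
      θ-X- x = trans (*-congˡ (deriv-X- x)) (*-identityʳ F)

      Len-θ : ∀ {Δ L f} → Len (suc Δ) F → Len L f → Len (Δ ℕ.+ L) (θ f)
      Len-θ lF l = Len-* lF (Len-deriv _ l)

      θ-self : θ F ≈ deriv F * F
      θ-self = *-comm F (deriv F)

    open Additive θ-additive using () renaming (+-hom to θ-+; cong to θ-cong)

    θ-const-* : ∀ {c} g → Len 1 c → θ (c * g) ≈ c * θ g
    θ-const-* {c} g l = trans (θ-* c g)
      (trans (+-congʳ (trans (*-congʳ (θ-const l)) (zeroˡ g))) (+-identityˡ _))

    -- One application of θ lowers the power of `X- x` by one and multiplies the value of the
    -- cofactor at `x` by (m + 1) F(x), since the term with `X- x * θ R` vanishes there.
    θ-power : ∀ x m R → θ (X- x ^ suc m * R) ≈ X- x ^ m * (const (suc m K.×ⁿ K.1#) * (F * R) + X- x * θ R)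
    θ-power x zero R = begin
      θ (X- x ^ 1 * R)                 ≈⟨ θ-cong (*-congʳ (*-identityʳ (X- x))) ⟩
      θ (X- x * R)                     ≈⟨ θ-* (X- x) R ⟩
      θ (X- x) * R + X- x * θ R        ≈⟨ +-congʳ (*-congʳ (θ-X- x)) ⟩
      F * R + X- x * θ R               ≈⟨ solve 3 (λ F R y → F :* R :+ y := con 1 :* ((con 1 :+ con 0) :* (F :* R) :+ y)) refl F R _ ⟩
      1# * ((1# + 0#) * (F * R) + X- x * θ R)
        ≈⟨ *-congˡ (+-congʳ (*-congʳ (trans (const-+ K.1# K.0#) (+-congˡ (const≈0 K.refl))))) ⟨
      1# * (const (1 K.×ⁿ K.1#) * (F * R) + X- x * θ R) ∎
    θ-power x (suc m) R = begin
      θ (X- x * Y * R)                  ≈⟨ θ-cong (*-assoc (X- x) Y R) ⟩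
      θ (X- x * (Y * R))                ≈⟨ θ-* (X- x) (Y * R) ⟩
      θ (X- x) * (Y * R) + X- x * θ (Y * R)
        ≈⟨ +-cong (*-congʳ (θ-X- x)) (*-congˡ (θ-power x m R)) ⟩
      F * (X- x * X- x ^ m * R) + X- x * (X- x ^ m * (n * (F * R) + X- x * θ R))
        ≈⟨ solve 6 (λ F x y R n d → F :* (x :* y :* R) :+ x :* (y :* (n :* (F :* R) :+ x :* d))
                                 := x :* y :* ((con 1 :+ n) :* (F :* R) :+ x :* d)) refl
                 F (X- x) (X- x ^ m) R n (θ R) ⟩
      Y * ((1# + n) * (F * R) + X- x * θ R)
        ≈⟨ *-congˡ (+-congʳ (*-congʳ (const-+ K.1# (suc m K.×ⁿ K.1#)))) ⟨
      Y * (const (suc (suc m) K.×ⁿ K.1#) * (F * R) + X- x * θ R) ∎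
      where
      Y n : Pol
      Y = X- x ^ suc m
      n = const (suc m K.×ⁿ K.1#)

    module _ (x : K.Carrier) (F[x]≉0 : ¬ (ev x F K.≈ K.0#)) where

      -- The value of θ^m f at `x` is m! F(x)^m R(x), and m! F(x)^m can be cancelled because `m` is
      -- below p.
      cofactor-root : ∀ m f R → f ≈ X- x ^ m * R → m ℕ.< p → ev x (iter θ m f) K.≈ K.0# → ev x R K.≈ K.0#
      cofactor-root zero    f R e _   v = K.trans (ev-cong x (trans (sym (*-identityˡ R)) (sym e))) v
      cofactor-root (suc m) f R e m<p v = cancel (K.zero-product _ _ n·FR≈0)
        where
        n = suc m K.×ⁿ K.1#
        v′ : ev x (const n * (F * R) + X- x * θ R) K.≈ K.0#
        v′ = cofactor-root m (θ f) _ (trans (θ-cong e) (θ-power x m R)) (ℕₚ.<-trans (ℕₚ.n<1+n m) m<p) v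
        n·FR≈0 : n K.* (ev x F K.* ev x R) K.≈ K.0#
        n·FR≈0 = K.trans (K.sym (K.trans (ev-+ x _ _) (K.trans
          (K.+-cong (K.trans (ev-* x _ _) (K.*-cong (ev-const x n) (ev-* x F R)))
                    (K.trans (ev-* x _ _) (K.trans (K.*-congʳ (K.trans (ev-X- x x) (K.-‿inverseʳ x))) (K.zeroˡ _))))
          (K.+-identityʳ _)))) v′
        cancel : n K.≈ K.0# ⊎ ev x F K.* ev x R K.≈ K.0# → ev x R K.≈ K.0#
        cancel (inj₁ n≈0) = contradiction n≈0 (K.characteristic (suc m) (s≤s z≤n) m<p)
        cancel (inj₂ FR≈0) with K.zero-product _ _ FR≈0
        ... | inj₁ F≈0 = contradiction F≈0 F[x]≉0
        ... | inj₂ R≈0 = R≈0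

      vanishing-order : ∀ M f → M ℕ.≤ p → (∀ j → j ℕ.< M → ev x (iter θ j f) K.≈ K.0#) → X- x ^ M ∣ᴾ f
      vanishing-order zero    f _   v = f , sym (*-identityˡ f)
      vanishing-order (suc M) f M<p v with vanishing-order M f (ℕₚ.<⇒≤ M<p) (λ j j<M → v j (ℕₚ.m≤n⇒m≤1+n j<M))
      ... | R , f≈ with factor-root x R (cofactor-root M f R f≈ M<p (v M (ℕₚ.n<1+n M)))
      ...   | q , R≈ = q , trans f≈ (trans (*-congˡ R≈)
              (solve 3 (λ a b q → a :* (b :* q) := b :* a :* q) refl (X- x ^ M) (X- x) q))

    θ-diffOp : ∀ {m} (c : Fin m → Pol) → ∃[ d ] ∀ g → θ (diffOp θ c g) ≈ diffOp θ {suc m} d g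
    θ-diffOp {zero} c = (λ _ → 0#) ,
      λ g → trans (Additive.0-hom θ-additive) (sym (trans (+-identityʳ _) (zeroˡ g)))
    θ-diffOp {suc m} c with θ-diffOp (c ∘ suc)
    ... | d , eq = d′ , λ g → begin
      θ (c zero * g + diffOp θ (c ∘ suc) (θ g))
        ≈⟨ θ-+ _ _ ⟩
      θ (c zero * g) + θ (diffOp θ (c ∘ suc) (θ g))
        ≈⟨ +-cong (θ-* (c zero) g) (eq (θ g)) ⟩
      θ (c zero) * g + c zero * θ g + (d zero * θ g + diffOp θ (d ∘ suc) (θ (θ g)))
        ≈⟨ solve 6 (λ a g c t d y → a :* g :+ c :* t :+ (d :* t :+ y) := a :* g :+ ((c :+ d) :* t :+ y)) refl
                 (θ (c zero)) g (c zero) (θ g) (d zero) _ ⟩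
      diffOp θ d′ g ∎
      where
      d′ : Fin (suc (suc m)) → Pol
      d′ zero          = θ (c zero)
      d′ (suc zero)    = c zero + d zero
      d′ (suc (suc i)) = d (suc i)

    iter-suc : ∀ j g → θ (iter θ j g) ≈ iter θ (suc j) g
    iter-suc zero    g = refl
    iter-suc (suc j) g = iter-suc j (θ g)

    -- A linear differential equation is propagated to all higher orders with
    -- the same leading coefficient l, so where l does not vanish the first r
    -- derivatives of a solution determine all the others.
    module _ {r : ℕ} (c : Fin r → Pol) (l g : Pol) (eq : diffOp θ c g + l * iter θ r g ≈ 0#) where

      prolong : ∀ m → ∃[ d ] diffOp θ {m ℕ.+ r} d g + l * iter θ (m ℕ.+ r) g ≈ 0#
      prolong zero    = c , eq
      prolong (suc m) with prolong m
      ... | d , eq′ with θ-diffOp d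
      -- The term `θ l * y` has the same order as the last term of `d′`, so it joins the lower part,
      -- and `l` remains the leading coefficient.
      ...   | d′ , θ-eq with diffOp-absorb θ d′ (θ l)
      ...     | d″ , absorb = d″ , (begin
        diffOp θ d″ g + l * iter θ (suc (m ℕ.+ r)) g
          ≈⟨ +-cong (sym (absorb g)) (*-congˡ (sym (iter-suc (m ℕ.+ r) g))) ⟩
        diffOp θ d′ g + θ l * y + l * θ y            ≈⟨ +-assoc _ _ _ ⟩
        diffOp θ d′ g + (θ l * y + l * θ y)          ≈⟨ +-cong (θ-eq g) (θ-* l y) ⟨
        θ (diffOp θ d g) + θ (l * y)                 ≈⟨ θ-+ _ _ ⟨
        θ (diffOp θ d g + l * y)                     ≈⟨ θ-cong eq′ ⟩
        θ 0#                                     ≈⟨ Additive.0-hom θ-additive ⟩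
        0#                                       ∎)
        where y = iter θ (m ℕ.+ r) g

      all-derivatives-vanish : ∀ x → ¬ (ev x l K.≈ K.0#) → (∀ j → j ℕ.< r → ev x (iter θ j g) K.≈ K.0#) →
                               ∀ j → ev x (iter θ j g) K.≈ K.0#
      all-derivatives-vanish x l≉0 initial = <-rec _ step
        where
        step : ∀ j → (∀ {i} → i ℕ.< j → ev x (iter θ i g) K.≈ K.0#) → ev x (iter θ j g) K.≈ K.0#
        step j lower with j ℕₚ.<? r
        ... | yes j<r = initial j j<r
        ... | no  j≮r = ≡.subst (λ j → ev x (iter θ j g) K.≈ K.0#) j≡ (top (K.zero-product _ _ l·y≈0))
          where
          k = j ℕ.∸ r
          j≡ : k ℕ.+ r ≡ j
          j≡ = ℕₚ.m∸n+n≡m (ℕₚ.≮⇒≥ j≮r)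
          l·y≈0 : ev x l K.* ev x (iter θ (k ℕ.+ r) g) K.≈ K.0#
          l·y≈0 = K.trans (K.sym (K.trans (ev-+ x _ _) (K.trans
            (K.+-cong (ev-diffOp θ x (proj₁ (prolong k)) g λ i i<k+r → lower (≡.subst (i ℕ.<_) j≡ i<k+r)) (ev-* x l _))
            (K.+-identityˡ _)))) (ev-0 x _ (proj₂ (prolong k)))
          top : ev x l K.≈ K.0# ⊎ ev x (iter θ (k ℕ.+ r) g) K.≈ K.0# → ev x (iter θ (k ℕ.+ r) g) K.≈ K.0#
          top (inj₁ e) = contradiction e l≉0
          top (inj₂ e) = e

  opaque
    unfolding θ

    θ-*-left : ∀ F G f → θ (F * G) f ≈ F * θ G f
    θ-*-left F G f = *-assoc F G (deriv f)

    θ-*-right : ∀ F G f → θ (F * G) f ≈ G * θ F f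
    θ-*-right F G f = trans (*-congʳ (*-comm F G)) (*-assoc G F (deriv f))

-- Linear independence and Stepanov's bound

-- Each of the `s` equations has `c` coefficients more than an unknown has. With E = 1 + Q c the
-- total excess s c is below E, so a single additional unknown pays for it.
fewer-equations : ∀ s Q c → s ℕ.≤ Q → s ℕ.* (suc (Q ℕ.* c) ℕ.+ c) ℕ.< suc s ℕ.* suc (Q ℕ.* c)
fewer-equations s Q c s≤Q = begin-strict
  s ℕ.* (E ℕ.+ c)          ≡⟨ ℕₚ.*-distribˡ-+ s E c ⟩
  s ℕ.* E ℕ.+ s ℕ.* c      <⟨ ℕₚ.+-monoʳ-< (s ℕ.* E) (s≤s (ℕₚ.*-monoˡ-≤ c s≤Q)) ⟩
  s ℕ.* E ℕ.+ E            ≡⟨ ℕₚ.+-comm (s ℕ.* E) E ⟩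
  suc s ℕ.* E              ∎
  where
  open ℕₚ.≤-Reasoning
  E = suc (Q ℕ.* c)

module Stepanov {p : ℕ} (𝕂 : FinitePrimeField p) where
  open FieldPolynomials 𝕂
  open Differential 𝕂

  -- Abstracts the family W_q: θ acts on H * W i as a small operator on H, and
  -- two members are too different to be related by coefficients of length ≤ T.
  record ExponentialSystem (F : Pol) (Δ T w : ℕ) {s : ℕ} (W : Fin s → Pol) : Set where
    field
      log-deriv     : Fin s → Pol
      θ-W           : ∀ i → θ F (W i) ≈ log-deriv i * W i
      Len-log-deriv : ∀ i → Len (suc Δ) (log-deriv i)
      Len-W         : ∀ i → Len (suc w) (W i)
      W-regular     : ∀ i U → U * W i ≈ 0# → U ≈ 0#
      W-separated   : ∀ i j → i ≢ j → ∀ U U′ → Len T U → Len T U′ →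
                      U * W i + U′ * W j ≈ 0# → U ≈ 0# × U′ ≈ 0#

  reindex : ∀ {F Δ T w s s′} {W : Fin s → Pol} (ρ : Fin s′ → Fin s) → (∀ {i j} → ρ i ≡ ρ j → i ≡ j) →
            ExponentialSystem F Δ T w W → ExponentialSystem F Δ T w (W ∘ ρ)
  reindex ρ ρ-inj sys = record
    { log-deriv     = log-deriv ∘ ρ
    ; θ-W           = θ-W ∘ ρ
    ; Len-log-deriv = Len-log-deriv ∘ ρ
    ; Len-W         = Len-W ∘ ρ
    ; W-regular     = W-regular ∘ ρ
    ; W-separated   = λ i j i≢j → W-separated (ρ i) (ρ j) (i≢j ∘ ρ-inj) }
    where open ExponentialSystem sys

  module Twisted {F : Pol} {Δ T w s : ℕ} (lF : Len (suc Δ) F) {W : Fin s → Pol}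
                 (sys : ExponentialSystem F Δ T w W) where
    open ExponentialSystem sys

    -- θ conjugated by multiplication with `W i`. It acts on the short factor alone, so the length
    -- estimates never see the large degree of `W i`.
    D : Fin s → Pol → Pol
    D i H = θ F H + log-deriv i * H

    D-additive : ∀ i → Additive (D i)
    D-additive i = mkAdditive
      (λ f g → trans (+-cong (+-hom f g) (distribˡ _ f g))
        (solve 4 (λ a b c d → a :+ b :+ (c :+ d) := a :+ c :+ (b :+ d)) refl _ _ _ _))
      (λ e → +-cong (cong e) (*-congˡ e))
      where open Additive (θ-additive F)

    Len-D : ∀ i {L f} → Len L f → Len (Δ ℕ.+ L) (D i f)
    Len-D i l = Len-+ (Len-θ F lF l) (Len-* (Len-log-deriv i) l)

    θ-HW : ∀ i H → θ F (H * W i) ≈ D i H * W i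
    θ-HW i H = begin
      θ F (H * W i)                            ≈⟨ θ-* F H (W i) ⟩
      θ F H * W i + H * θ F (W i)              ≈⟨ +-congˡ (*-congˡ (θ-W i)) ⟩
      θ F H * W i + H * (log-deriv i * W i)    ≈⟨ solve 4 (λ t w h v → t :* w :+ h :* (v :* w) := (t :+ v :* h) :* w) refl _ (W i) H _ ⟩
      D i H * W i                              ∎

    iter-HW : ∀ i j H → iter (θ F) j (H * W i) ≈ iter (D i) j H * W i
    iter-HW i zero    H = refl
    iter-HW i (suc j) H = trans (Additive.cong (iter-additive (θ-additive F) j) (θ-HW i H)) (iter-HW i j (D i H))

    diffOp-HW : ∀ i {m} (c : Fin m → Pol) H → diffOp (θ F) c (H * W i) ≈ diffOp (D i) c H * W i
    diffOp-HW i {zero}  c H = sym (zeroˡ _)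
    diffOp-HW i {suc m} c H = begin
      c zero * (H * W i) + diffOp (θ F) (c ∘ suc) (θ F (H * W i))
        ≈⟨ +-congˡ (Additive.cong (diffOp-additive (θ-additive F) (c ∘ suc)) (θ-HW i H)) ⟩
      c zero * (H * W i) + diffOp (θ F) (c ∘ suc) (D i H * W i)
        ≈⟨ +-congˡ (diffOp-HW i (c ∘ suc) (D i H)) ⟩
      c zero * (H * W i) + diffOp (D i) (c ∘ suc) (D i H) * W i
        ≈⟨ solve 4 (λ c h w y → c :* (h :* w) :+ y :* w := (c :* h :+ y) :* w) refl _ _ _ _ ⟩
      diffOp (D i) c H * W i ∎

  diffOp-const-* : ∀ F {m} (c : Fin m → Pol) {μ} g → Len 1 μ → diffOp (θ F) c (μ * g) ≈ μ * diffOp (θ F) c g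
  diffOp-const-* F {zero}  c g l = sym (zeroʳ _)
  diffOp-const-* F {suc m} c {μ} g l = begin
    c zero * (μ * g) + diffOp (θ F) (c ∘ suc) (θ F (μ * g))
      ≈⟨ +-congˡ (trans (Additive.cong (diffOp-additive (θ-additive F) (c ∘ suc)) (θ-const-* F g l))
                        (diffOp-const-* F (c ∘ suc) (θ F g) l)) ⟩
    c zero * (μ * g) + μ * diffOp (θ F) (c ∘ suc) (θ F g)
      ≈⟨ solve 4 (λ c μ g y → c :* (μ :* g) :+ μ :* y := μ :* (c :* g :+ y)) refl _ μ g _ ⟩
    μ * diffOp (θ F) c g ∎

  sum-0 : ∀ {n} (f : Fin n → Pol) → (∀ i → f i ≈ 0#) → sum f ≈ 0#
  sum-0 {zero}  f e = refl
  sum-0 {suc n} f e = trans (+-cong (e zero) (sum-0 (f ∘ suc) (e ∘ suc))) (+-identityˡ 0#)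

  nonzero-product : ∀ {f} g → ¬ (f ≈ 0#) → f * g ≈ 0# → g ≈ 0#
  nonzero-product g f≉0 = *-cancel-0 g (proj₂ (∃Deg _ f≉0))

  -- The three inequalities serve three steps: `E+≤T` keeps the coefficients short enough for
  -- `W-separated` after the operator has acted, `E+Δ≤p` provides a point where neither `F` nor the
  -- leading coefficient vanishes, and `A+w≤p` makes a combination of the terms zero once it
  -- vanishes to order p at one point.
  module Independence (F : Pol) (F≉0 : ¬ (F ≈ 0#)) (Δ T w Q A : ℕ) (lF : Len (suc Δ) F)
    (E+≤T : suc (Q ℕ.* (A ℕ.+ Q ℕ.* Δ)) ℕ.+ (A ℕ.+ Q ℕ.* Δ) ℕ.≤ T)
    (E+Δ≤p : suc (Q ℕ.* (A ℕ.+ Q ℕ.* Δ)) ℕ.+ Δ ℕ.≤ p) (A+w≤p : A ℕ.+ w ℕ.≤ p) where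

    E : ℕ
    E = suc (Q ℕ.* (A ℕ.+ Q ℕ.* Δ))

    Len-HW : ∀ {s} {W : Fin s → Pol} → ExponentialSystem F Δ T w W → ∀ i {H} → Len A H → Len (A ℕ.+ w) (H * W i)
    Len-HW {W = W} sys i {H} lH =
      Len-cong (*-comm (W i) H) (≡.subst (λ n → Len n (W i * H)) (ℕₚ.+-comm w A)
        (Len-* (ExponentialSystem.Len-W sys i) lH))

    Independent : ℕ → Set
    Independent s = ∀ {W : Fin s → Pol} → s ℕ.≤ Q → ExponentialSystem F Δ T w W →
      (H : Fin s → Pol) → (∀ i → Len A (H i)) → sum (λ i → H i * W i) ≈ 0# → ∀ i → H i ≈ 0#

    independent-step : ∀ s → Independent (suc s) → Independent (suc (suc s))
    independent-step s smaller-independent {W} s≤Q sys H lH ΣHW≈0 with Finₚ.any? (λ i → zero? (H i))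
    ... | yes (i , Hi≈0) = all-zero
      where
      smaller : ∀ j → H (punchIn i j) ≈ 0#
      smaller = smaller-independent (ℕₚ.<⇒≤ s≤Q) (reindex (punchIn i) (λ {j} {k} → Finₚ.punchIn-injective i j k) sys)
        (H ∘ punchIn i) (lH ∘ punchIn i) (begin
          sum (removeAt (λ i → H i * W i) i)                  ≈⟨ +-identityˡ _ ⟨
          0# + sum (removeAt (λ i → H i * W i) i)             ≈⟨ +-congʳ (trans (*-congʳ Hi≈0) (zeroˡ _)) ⟨
          H i * W i + sum (removeAt (λ i → H i * W i) i)      ≈⟨ sum-remove {i = i} (λ i → H i * W i) ⟨
          sum (λ i → H i * W i)                               ≈⟨ ΣHW≈0 ⟩
          0#                                                  ∎)
      all-zero : ∀ k → H k ≈ 0#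
      all-zero k with i Finₚ.≟ k
      ... | yes ≡.refl = Hi≈0
      ... | no  i≢k    = ≡.subst (λ k → H k ≈ 0#) (Finₚ.punchIn-punchOut i≢k) (smaller (punchOut i≢k))
    ... | no H≉0 = contradiction μ≈0 μ≉0
      where
      open ExponentialSystem sys
      open Twisted lF sys
      L′ = E ℕ.+ (A ℕ.+ Q ℕ.* Δ)
      s<Q : suc s ℕ.≤ Q
      s<Q = ℕₚ.<⇒≤ s≤Q

      -- An operator of order ≤ s that annihilates s of the s + 2 terms; by
      -- separation it annihilates the remaining two as well.
      diffOp-len : ∀ (c : Fin (suc s) → Pol) → (∀ j → Len E (c j)) → ∀ i → Len L′ (diffOp (D i) c (H i))
      diffOp-len c lc i = Len-mono (ℕₚ.+-monoʳ-≤ E (ℕₚ.+-monoʳ-≤ A (ℕₚ.*-monoˡ-≤ Δ s<Q)))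
        (Len-diffOp (D i) Δ (Len-D i) lc (lH i))
      sL′<[1+s]E : s ℕ.* L′ ℕ.< suc s ℕ.* E
      sL′<[1+s]E = fewer-equations s Q (A ℕ.+ Q ℕ.* Δ) (ℕₚ.<⇒≤ s<Q)
      module S₁ = Siegel (suc s) E s L′ sL′<[1+s]E (λ c i → diffOp (D (suc (suc i))) c (H (suc (suc i))))
        (λ c d i → diffOp-+ (D (suc (suc i))) c d _) (λ c d e i → diffOp-cong (D (suc (suc i))) c d _ e)
        (λ c lc i → diffOp-len c lc (suc (suc i)))
      c = proj₁ S₁.kernel
      lc = proj₁ (proj₂ S₁.kernel)
      c≉0 = proj₁ (proj₂ (proj₂ S₁.kernel))
      term : Fin (suc (suc s)) → Pol
      term i = H i * W i
      U : Fin (suc (suc s)) → Pol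
      U i = diffOp (D i) c (H i)
      U₀,U₁≈0 : U zero ≈ 0# × U (suc zero) ≈ 0#
      U₀,U₁≈0 = W-separated zero (suc zero) (λ ()) _ _
        (Len-mono E+≤T (diffOp-len c lc zero)) (Len-mono E+≤T (diffOp-len c lc (suc zero))) (begin
          U zero * W zero + U (suc zero) * W (suc zero)
            ≈⟨ +-congˡ (+-identityʳ _) ⟨
          U zero * W zero + (U (suc zero) * W (suc zero) + 0#)
            ≈⟨ +-congˡ (+-congˡ (sum-0 (λ i → U (suc (suc i)) * W (suc (suc i)))
                 (λ i → trans (*-congʳ (proj₂ (proj₂ (proj₂ S₁.kernel)) i)) (zeroˡ _)))) ⟨
          sum (λ i → U i * W i)
            ≈⟨ sum-cong-≋ (λ i → diffOp-HW i c (H i)) ⟨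
          sum (λ i → diffOp (θ F) c (term i))
            ≈⟨ Additive.sum-hom (diffOp-additive (θ-additive F) c) term ⟨
          diffOp (θ F) c (sum term)
            ≈⟨ Additive.cong (diffOp-additive (θ-additive F) c) ΣHW≈0 ⟩
          diffOp (θ F) c 0#
            ≈⟨ Additive.0-hom (diffOp-additive (θ-additive F) c) ⟩
          0# ∎)
      U≈0 : ∀ i → U i ≈ 0#
      U≈0 zero          = proj₁ U₀,U₁≈0
      U≈0 (suc zero)    = proj₂ U₀,U₁≈0
      U≈0 (suc (suc i)) = proj₂ (proj₂ (proj₂ S₁.kernel)) i
      annihilated : ∀ i → diffOp (θ F) c (term i) ≈ 0#
      annihilated i = trans (diffOp-HW i c (H i)) (trans (*-congʳ (U≈0 i)) (zeroˡ _))

      leading = leading-coefficient (θ F) c c≉0 lc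
      r = proj₁ leading
      c′ = proj₁ (proj₂ leading)
      l = proj₁ (proj₂ (proj₂ leading))
      r<1+s = proj₁ (proj₂ (proj₂ (proj₂ leading)))
      l≉0 = proj₁ (proj₂ (proj₂ (proj₂ (proj₂ leading))))
      len-l = proj₁ (proj₂ (proj₂ (proj₂ (proj₂ (proj₂ leading)))))
      leading-eq = proj₂ (proj₂ (proj₂ (proj₂ (proj₂ (proj₂ leading)))))

      -- Two conditions on one point: `F` must not vanish so that θ measures the order there, and
      -- `l` must not vanish so that the equation determines the higher derivatives.
      good-point : ∃[ x ] ¬ (ev x (F * l) K.≈ K.0#)
      good-point = nonroot (F * l) (λ e → l≉0 (nonzero-product l F≉0 e))
        (Len-mono (ℕₚ.≤-trans (ℕₚ.≤-reflexive (ℕₚ.+-comm Δ E)) E+Δ≤p) (Len-* lF len-l))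
      x = proj₁ good-point
      F[x]≉0 : ¬ (ev x F K.≈ K.0#)
      F[x]≉0 e = proj₂ good-point (K.trans (ev-* x F l) (K.trans (K.*-congʳ e) (K.zeroˡ _)))
      l[x]≉0 : ¬ (ev x l K.≈ K.0#)
      l[x]≉0 e = proj₂ good-point (K.trans (ev-* x F l) (K.trans (K.*-congˡ e) (K.zeroʳ _)))

      -- A constant combination of the last s + 1 terms that vanishes to order r at x.
      combination : (Fin (suc s) → Pol) → Pol
      combination μ = sum (λ i → μ i * term (suc i))
      derivative-at-x : (Fin (suc s) → Pol) → Fin r → Pol
      derivative-at-x μ j = const (ev x (iter (θ F) (toℕ j) (combination μ)))
      module θʲ (j : ℕ) = Additive (iter-additive (θ-additive F) j)
      const-cong : ∀ {a b} → a K.≈ b → const a ≈ const b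
      const-cong e = mk≋ λ { zero → K.trans (cf-const-0 _) (K.trans e (K.sym (cf-const-0 _)))
                           ; (suc n) → K.trans (cf-const-suc _ n) (K.sym (cf-const-suc _ n)) }
      module S₂ = Siegel (suc s) 1 r 1 (ℕₚ.*-monoˡ-< 1 r<1+s) derivative-at-x
        (λ μ ν j → trans (const-cong (K.trans
          (ev-cong x (trans (θʲ.cong (toℕ j) (trans
              (sum-cong-≋ (λ i → distribʳ (term (suc i)) (μ i) (ν i)))
              (∑-distrib-+ (λ i → μ i * term (suc i)) (λ i → ν i * term (suc i)))))
            (θʲ.+-hom (toℕ j) (combination μ) (combination ν))))
          (ev-+ x _ _))) (const-+ _ _))
        (λ μ ν e j → const-cong (ev-cong x (θʲ.cong (toℕ j) (sum-cong-≋ (λ i → *-congʳ {term (suc i)} (e i))))))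
        (λ _ _ _ → Len-const _)
      μ = proj₁ S₂.kernel
      lμ = proj₁ (proj₂ S₂.kernel)
      μ≉0 = proj₁ (proj₂ (proj₂ S₂.kernel))
      g = combination μ
      initial : ∀ j → j ℕ.< r → ev x (iter (θ F) j g) K.≈ K.0#
      initial j j<r = ≡.subst (λ j → ev x (iter (θ F) j g) K.≈ K.0#) (Finₚ.toℕ-fromℕ< j<r)
        (K.trans (K.sym (cf-const-0 _)) (at (proj₂ (proj₂ (proj₂ S₂.kernel)) (Fin.fromℕ< j<r)) 0))
      equation : diffOp (θ F) c′ g + l * iter (θ F) r g ≈ 0#
      equation = trans (sym (leading-eq g)) (trans (Additive.sum-hom (diffOp-additive (θ-additive F) c) (λ i → μ i * term (suc i)))
        (sum-0 _ (λ i → trans (diffOp-const-* F c (term (suc i)) (lμ i))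
          (trans (*-congˡ (annihilated (suc i))) (zeroʳ _)))))
      -- All multiplicity is concentrated at the single point `x`: a zero of order p against a
      -- length of at most p.
      g≈0 : g ≈ 0#
      g≈0 = too-many-zeros p (x ∷ []) g ([] ∷ [])
        (vanishing-order F x F[x]≉0 p g ℕₚ.≤-refl
          (λ j _ → all-derivatives-vanish F c′ l g equation x l[x]≉0 initial j) ∷ [])
        (Len-sum _ (λ i → Len-cong (*-assoc (μ i) (H (suc i)) (W (suc i)))
           (Len-HW sys (suc i) (Len-* {0} (lμ i) (lH (suc i))))))
        (ℕₚ.≤-trans A+w≤p (ℕₚ.≤-reflexive (≡.sym (ℕₚ.+-identityʳ p))))
      -- The `μ i` are constants, so the coefficients `μ i * H (suc i)` keep length `A` and the
      -- induction hypothesis applies with the same parameters.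
      μH≈0 : ∀ i → μ i * H (suc i) ≈ 0#
      μH≈0 = smaller-independent s<Q (reindex suc Finₚ.suc-injective sys) (λ i → μ i * H (suc i))
        (λ i → Len-* {0} (lμ i) (lH (suc i)))
        (trans (sum-cong-≋ (λ i → *-assoc (μ i) (H (suc i)) (W (suc i)))) g≈0)
      μ≈0 : ∀ i → μ i ≈ 0#
      μ≈0 i = nonzero-product (μ i) (λ e → H≉0 (suc i , e)) (trans (*-comm _ _) (μH≈0 i))

    independent : ∀ s → Independent s
    independent zero          _ _ _ _ _ ()
    independent (suc zero)    _ sys H _ ΣHW≈0 zero =
      ExponentialSystem.W-regular sys zero (H zero) (trans (sym (+-identityʳ _)) ΣHW≈0)
    independent (suc (suc s)) = independent-step s (independent (suc s))

    module _ {W : Fin Q → Pol} (sys : ExponentialSystem F Δ T w W) where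
      open Twisted lF sys

      -- Every `W i` equals 1 at the points of `xs`, so there θ^j Ψ takes the same value as ∑ D_i^j
      -- H_i. Making these short polynomials vanish identically for all j < M costs M (A + M Δ)
      -- linear conditions, however many points there are and however large `w` is. Independence
      -- then rules out Ψ = 0.
      stepanov-bound : ∀ M → M ℕ.≤ p → M ℕ.* (A ℕ.+ M ℕ.* Δ) ℕ.< Q ℕ.* A → ∀ xs → Distinct xs →
        All (λ x → ¬ (ev x F K.≈ K.0#) × (∀ i → ev x (W i) K.≈ K.1#)) xs →
        length xs ℕ.* M ℕ.≤ A ℕ.+ w
      stepanov-bound M M≤p count xs distinct good with length xs ℕ.* M ℕₚ.≤? A ℕ.+ w
      ... | yes bound = bound
      ... | no ¬bound = contradiction H≈0 H≉0
        where
        conditions : (Fin Q → Pol) → Fin M → Pol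
        conditions H j = sum (λ i → iter (D i) (toℕ j) (H i))
        module Dʲ (i : Fin Q) (j : ℕ) = Additive (iter-additive (D-additive i) j)
        module S = Siegel Q A M (A ℕ.+ M ℕ.* Δ) count conditions
          (λ H G j → trans (sum-cong-≋ (λ i → Dʲ.+-hom i (toℕ j) (H i) (G i))) (∑-distrib-+ (λ i → iter (D i) (toℕ j) (H i)) _))
          (λ H G e j → sum-cong-≋ (λ i → Dʲ.cong i (toℕ j) (e i)))
          (λ H lH j → Len-sum _ (λ i → Len-mono (ℕₚ.+-monoʳ-≤ A (ℕₚ.*-monoˡ-≤ Δ (ℕₚ.<⇒≤ (Finₚ.toℕ<n j))))
            (Len-iter (D i) Δ (Len-D i) (toℕ j) (lH i))))
        H = proj₁ S.kernel
        lH = proj₁ (proj₂ S.kernel)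
        H≉0 = proj₁ (proj₂ (proj₂ S.kernel))
        Ψ : Pol
        Ψ = sum (λ i → H i * W i)
        derivative : ∀ x → (∀ i → ev x (W i) K.≈ K.1#) → ∀ j → j ℕ.< M → ev x (iter (θ F) j Ψ) K.≈ K.0#
        derivative x W[x]≈1 j j<M = K.trans (ev-cong x (trans
            (Additive.sum-hom (iter-additive (θ-additive F) j) (λ i → H i * W i))
            (sum-cong-≋ (λ i → iter-HW i j (H i)))))
          (K.trans (ev-sum-W (λ i → iter (D i) j (H i)))
            (ev-0 x _ (≡.subst (λ j → sum (λ i → iter (D i) j (H i)) ≈ 0#) (Finₚ.toℕ-fromℕ< j<M)
              (proj₂ (proj₂ (proj₂ S.kernel)) (Fin.fromℕ< j<M)))))
          where
          ev-sum-V : ∀ {n} (V : Fin n → Pol) → (∀ i → ev x (V i) K.≈ K.1#) → (G : Fin n → Pol) →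
                     ev x (sum (λ i → G i * V i)) K.≈ ev x (sum G)
          ev-sum-V {zero}  V e G = K.refl
          ev-sum-V {suc n} V e G = K.trans (ev-+ x _ _) (K.trans
            (K.+-cong (K.trans (ev-* x _ _) (K.trans (K.*-congˡ (e zero)) (K.*-identityʳ _)))
                      (ev-sum-V (V ∘ suc) (e ∘ suc) (G ∘ suc)))
            (K.sym (ev-+ x _ _)))
          ev-sum-W : (G : Fin Q → Pol) → ev x (sum (λ i → G i * W i)) K.≈ ev x (sum G)
          ev-sum-W = ev-sum-V W W[x]≈1
        Ψ≈0 : Ψ ≈ 0#
        Ψ≈0 = too-many-zeros M xs Ψ distinct
          (All.map (λ {x} (F≉0 , W≈1) → vanishing-order F x F≉0 M Ψ M≤p (derivative x W≈1)) good)
          (Len-sum _ (λ i → Len-HW sys i (lH i))) (ℕₚ.<⇒≤ (ℕₚ.≰⇒> ¬bound))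
        H≈0 : ∀ i → H i ≈ 0#
        H≈0 = independent Q ℕₚ.≤-refl sys H lH Ψ≈0

-- Products of powers of pairwise comaximal polynomials

module CoprimeFamily {p : ℕ} (𝕂 : FinitePrimeField p) where
  open FieldPolynomials 𝕂
  open Differential 𝕂
  open Stepanov 𝕂

  Len-product : ∀ {n a} (g : Fin n → Pol) → (∀ i → Len (suc a) (g i)) → Len (suc (n ℕ.* a)) (product g)
  Len-product {zero}  g l = Len-const _
  Len-product {suc n} {a} g l = ≡.subst (λ L → Len L (product g)) (ℕₚ.+-suc a (n ℕ.* a))
    (Len-* (l zero) (Len-product (g ∘ suc) (l ∘ suc)))

  Deg-product : ∀ {n} (g : Fin n → Pol) → (∀ i → ∃[ m ] Deg (g i) m) → ∃[ m ] Deg (product g) m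
  Deg-product {zero}  g d = 0 , Deg-1
  Deg-product {suc n} g d = _ , Deg-* (proj₂ (d zero)) (proj₂ (Deg-product (g ∘ suc) (d ∘ suc)))

  record LogDerivative (F w : Pol) (Δ : ℕ) : Set where
    constructor mkLogDerivative
    field
      value : Pol
      eq    : θ F w ≈ value * w
      len   : Len (suc Δ) value

  -- The value is e F′, formed by repeated addition; its length depends on `F` but not on the
  -- exponent.
  log-derivative-^ : ∀ {F Δ} e → Len (suc Δ) F → LogDerivative F (F ^ e) Δ
  log-derivative-^ {F} zero    l = mkLogDerivative 0# (trans (θ-const F (Len-const _)) (sym (zeroˡ _))) Len-0
  log-derivative-^ {F} (suc e) l with log-derivative-^ e l
  ... | mkLogDerivative v eq lv = mkLogDerivative (deriv F + v)
    (begin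
      θ F (F * F ^ e)                          ≈⟨ θ-* F F (F ^ e) ⟩
      θ F F * F ^ e + F * θ F (F ^ e)          ≈⟨ +-cong (*-congʳ (θ-self F)) (*-congˡ eq) ⟩
      deriv F * F * F ^ e + F * (v * F ^ e)    ≈⟨ solve 4 (λ d F y v → d :* F :* y :+ F :* (v :* y) := (d :+ v) :* (F :* y)) refl _ F _ v ⟩
      (deriv F + v) * (F * F ^ e)              ∎)
    (Len-+ (Len-deriv F l) lv)

  -- Each factor is differentiated with its own `f i`, and its value is then multiplied by the
  -- remaining `f j`.
  log-derivative-product : ∀ {n Δ} (f w : Fin n → Pol) → (∀ i → Len (suc Δ) (f i)) →
    (∀ i → LogDerivative (f i) (w i) Δ) → LogDerivative (product f) (product w) (n ℕ.* Δ)
  log-derivative-product {zero}      f w l d = mkLogDerivative 0# (trans (θ-const _ (Len-const _)) (sym (zeroˡ _))) Len-0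
  log-derivative-product {suc n} {Δ} f w l d
    with d zero | log-derivative-product (f ∘ suc) (w ∘ suc) (l ∘ suc) (d ∘ suc)
  ... | mkLogDerivative v eq lv | mkLogDerivative v′ eq′ lv′ = mkLogDerivative (F′ * v + f zero * v′)
    (begin
      θ (f zero * F′) (w zero * w′)
        ≈⟨ θ-* _ (w zero) w′ ⟩
      θ (f zero * F′) (w zero) * w′ + w zero * θ (f zero * F′) w′
        ≈⟨ +-cong (*-congʳ (trans (θ-*-right (f zero) F′ (w zero)) (*-congˡ eq)))
                  (*-congˡ (trans (θ-*-left (f zero) F′ w′) (*-congˡ eq′))) ⟩
      F′ * (v * w zero) * w′ + w zero * (f zero * (v′ * w′))
        ≈⟨ solve 6 (λ F v w w′ f v′ → F :* (v :* w) :* w′ :+ w :* (f :* (v′ :* w′))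
                                   := (F :* v :+ f :* v′) :* (w :* w′)) refl F′ v (w zero) w′ (f zero) v′ ⟩
      (F′ * v + f zero * v′) * (w zero * w′) ∎)
    (Len-+
      (≡.subst (λ L → Len L (F′ * v))
        (≡.trans (ℕₚ.+-suc (n ℕ.* Δ) Δ) (≡.cong suc (ℕₚ.+-comm (n ℕ.* Δ) Δ)))
        (Len-* (Len-product (f ∘ suc) (l ∘ suc)) lv))
      (≡.subst (λ L → Len L (f zero * v′)) (ℕₚ.+-suc Δ (n ℕ.* Δ)) (Len-* (l zero) lv′)))
    where
    F′ w′ : Pol
    F′ = product (f ∘ suc)
    w′ = product (w ∘ suc)

  ev-^-1 : ∀ x {g} n → ev x g K.≈ K.1# → ev x (g ^ n) K.≈ K.1#
  ev-^-1 x zero    e = ev-const x K.1#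
  ev-^-1 x (suc n) e = K.trans (ev-* x _ _) (K.trans (K.*-cong e (ev-^-1 x n e)) (K.*-identityˡ _))

  ev-product-1 : ∀ x {n} (g : Fin n → Pol) → (∀ i → ev x (g i) K.≈ K.1#) → ev x (product g) K.≈ K.1#
  ev-product-1 x {zero}  g e = ev-const x K.1#
  ev-product-1 x {suc n} g e =
    K.trans (ev-* x _ _) (K.trans (K.*-cong (e zero) (ev-product-1 x (g ∘ suc) (e ∘ suc))) (K.*-identityˡ _))

  ev-product-≉0 : ∀ x {n} (g : Fin n → Pol) → (∀ i → ¬ (ev x (g i) K.≈ K.0#)) → ¬ (ev x (product g) K.≈ K.0#)
  ev-product-≉0 x {zero}  g e p = K.1≉0 (K.trans (K.sym (ev-const x K.1#)) p)
  ev-product-≉0 x {suc n} g e p with K.zero-product _ _ (K.trans (K.sym (ev-* x _ _)) p)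
  ... | inj₁ q = e zero q
  ... | inj₂ q = ev-product-≉0 x (g ∘ suc) (e ∘ suc) q

  Deg⇒≉0 : ∀ {f m} → Deg f m → ¬ (f ≈ 0#)
  Deg⇒≉0 d e = lead≉0 d (at e _)

  module Separation {n : ℕ} (f : Fin (suc n) → Pol) (coprime : ∀ i j → i ≢ j → Comaximal (f i) (f j))
                    (i : Fin (suc n)) (regular : ∃[ m ] Deg (f i) m) where

    W-of : (Fin (suc n) → ℕ) → Pol
    W-of e = product λ i → f i ^ e i

    rest : (Fin (suc n) → ℕ) → Pol
    rest e = product (removeAt (λ i → f i ^ e i) i)

    W-split : ∀ e → W-of e ≈ f i ^ e i * rest e
    W-split e = product-remove {i = i} (λ i → f i ^ e i)

    comaximal-rest : ∀ e → Comaximal (f i) (rest e)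
    comaximal-rest e = comaximal-product _ λ j →
      comaximal-^ (e (punchIn i j)) (coprime i (punchIn i j) (Finₚ.punchInᵢ≢i i j ∘ ≡.sym))

    -- Both terms contain `f i ^ e i`. Once it is cancelled, `f i ^ t` divides `rest e * U`, and
    -- `rest e` consists of factors comaximal to `f i`.
    divides-coefficient : ∀ t e e′ → e i ℕ.+ t ℕ.≤ e′ i → ∀ U U′ →
      U * W-of e + U′ * W-of e′ ≈ 0# → f i ^ t ∣ᴾ U
    divides-coefficient t e e′ e+t≤e′ U U′ eq =
      comaximal-∣ U (comaximal-sym (comaximal-^ t (comaximal-sym (comaximal-rest e)))) (V , RU≈)
      where
      k = e′ i ℕ.∸ (e i ℕ.+ t)
      a = f i ^ e i
      V = - (U′ * (f i ^ k * rest e′))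
      e′≡ : e′ i ≡ e i ℕ.+ (t ℕ.+ k)
      e′≡ = ≡.trans (≡.sym (ℕₚ.m+[n∸m]≡n e+t≤e′)) (ℕₚ.+-assoc (e i) t k)
      a*[]≈0 : a * (rest e * U + f i ^ t * (U′ * (f i ^ k * rest e′))) ≈ 0#
      a*[]≈0 = begin
        a * (rest e * U + f i ^ t * (U′ * (f i ^ k * rest e′)))
          ≈⟨ solve 7 (λ a r U u b c s → a :* (r :* U :+ u :* (b :* (c :* s)))
                                     := U :* (a :* r) :+ b :* (a :* (u :* c) :* s)) refl
                   a (rest e) U (f i ^ t) U′ (f i ^ k) (rest e′) ⟩
        U * (a * rest e) + U′ * (a * (f i ^ t * f i ^ k) * rest e′)
          ≈⟨ +-congˡ (*-congˡ (*-congʳ (*-congˡ (^-homo-* (f i) t k)))) ⟨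
        U * (a * rest e) + U′ * (a * f i ^ (t ℕ.+ k) * rest e′)
          ≈⟨ +-congˡ (*-congˡ (*-congʳ (^-homo-* (f i) (e i) (t ℕ.+ k)))) ⟨
        U * (a * rest e) + U′ * (f i ^ (e i ℕ.+ (t ℕ.+ k)) * rest e′)
          ≡⟨ ≡.cong (λ m → U * (a * rest e) + U′ * (f i ^ m * rest e′)) e′≡ ⟨
        U * (a * rest e) + U′ * (f i ^ e′ i * rest e′)
          ≈⟨ +-cong (*-congˡ (W-split e)) (*-congˡ (W-split e′)) ⟨
        U * W-of e + U′ * W-of e′
          ≈⟨ eq ⟩
        0# ∎
      sum≈0 : rest e * U + f i ^ t * (U′ * (f i ^ k * rest e′)) ≈ 0#
      sum≈0 = *-cancel-0 _ (Deg-^ (e i) (proj₂ regular)) a*[]≈0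
      RU≈ : rest e * U ≈ f i ^ t * V
      RU≈ = trans (GroupProperties.inverseˡ-unique +-group _ _ sum≈0) (RingProperties.-‿distribʳ-* ring _ _)

  divides-coefficient : ∀ {n} (f : Fin n → Pol) → (∀ i j → i ≢ j → Comaximal (f i) (f j)) →
    (∀ i → ∃[ m ] Deg (f i) m) → ∀ t (e e′ : Fin n → ℕ) i → e i ℕ.+ t ℕ.≤ e′ i → ∀ U U′ →
    U * product (λ i → f i ^ e i) + U′ * product (λ i → f i ^ e′ i) ≈ 0# → f i ^ t ∣ᴾ U
  divides-coefficient {suc n} f coprime regular t e e′ i =
    Separation.divides-coefficient f coprime i (regular i) t e e′

  module Powers {n : ℕ} (f : Fin n → Pol) (d : ℕ)
    (degree : ∀ i → ∃[ m ] 1 ℕ.≤ m × m ℕ.≤ d × Deg (f i) m)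
    (coprime : ∀ i j → i ≢ j → Comaximal (f i) (f j))
    (t B : ℕ) where

    Len-f : ∀ i → Len (suc d) (f i)
    Len-f i = let m , _ , m≤d , deg = degree i in Len-mono (s≤s m≤d) (len deg)

    -- `q` codes its `n` exponents as digits in base `B`. Multiplying them by `t` does two things:
    -- the product is 1 wherever all `f i ^ t` are, and for distinct `q` the exponents of some `f i`
    -- differ by at least `t`.
    W : Fin (B ℕ.^ n) → Pol
    W q = product λ i → f i ^ (t ℕ.* toℕ (finToFun {B} {n} q i))

    private
      exponent : Fin (B ℕ.^ n) → Fin n → ℕ
      exponent q i = toℕ (finToFun {B} {n} q i)

      factors : Fin (B ℕ.^ n) → Fin n → Pol
      factors q i = f i ^ (t ℕ.* exponent q i)

    Len-W : ∀ q → Len (suc (n ℕ.* (t ℕ.* B ℕ.* d))) (W q)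
    Len-W q = Len-product (factors q) λ i → let m , _ , m≤d , deg = degree i in
      Len-mono (s≤s (ℕₚ.*-mono-≤ (ℕₚ.*-monoʳ-≤ t (ℕₚ.<⇒≤ (Finₚ.toℕ<n (finToFun {B} {n} q i)))) m≤d))
        (len (Deg-^ (t ℕ.* exponent q i) deg))

    W-regular : ∀ q U → U * W q ≈ 0# → U ≈ 0#
    W-regular q U e = *-cancel-0 U
      (proj₂ (Deg-product (factors q) λ i → let m , _ , _ , deg = degree i in _ , Deg-^ (t ℕ.* exponent q i) deg))
      (trans (*-comm _ _) e)

    -- As `f i` has positive degree, `f i ^ t` has degree at least `t`, too much for a divisor of a
    -- nonzero polynomial of length `t`.
    divisible-short : ∀ i U → f i ^ t ∣ᴾ U → Len t U → U ≈ 0#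
    divisible-short i U (h , U≈) l with degree i
    ... | m , 1≤m , _ , deg = trans U≈ (trans (*-congˡ (Len0⇒≈0 (Len-quotient 0 h (Deg-^ t deg)
            (Len-cong U≈ (Len-mono t≤ l))))) (zeroʳ _))
      where
      t≤ : t ℕ.≤ t ℕ.* m ℕ.+ 0
      t≤ = ℕₚ.≤-trans (ℕₚ.≤-reflexive (≡.sym (ℕₚ.*-identityʳ t)))
             (ℕₚ.≤-trans (ℕₚ.*-monoʳ-≤ t 1≤m) (ℕₚ.m≤m+n _ 0))

    private
      Zero₂ : Fin (B ℕ.^ n) → Fin (B ℕ.^ n) → Set
      Zero₂ q q′ = ∀ U U′ → Len t U → Len t U′ → U * W q + U′ * W q′ ≈ 0# → U ≈ 0# × U′ ≈ 0#

      separated-< : ∀ q q′ i → exponent q i ℕ.< exponent q′ i → Zero₂ q q′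
      separated-< q q′ i b<b′ U U′ lU lU′ e = U≈0 , W-regular q′ U′
          (trans (trans (sym (+-identityˡ _)) (+-congʳ (sym (trans (*-congʳ U≈0) (zeroˡ _))))) e)
        where
        U≈0 : U ≈ 0#
        U≈0 = divisible-short i U (divides-coefficient f coprime (λ i → let m , _ , _ , deg = degree i in m , deg)
          t (λ i → t ℕ.* exponent q i) (λ i → t ℕ.* exponent q′ i) i
          (ℕₚ.≤-trans (ℕₚ.≤-reflexive (≡.trans (ℕₚ.+-comm _ t) (≡.sym (ℕₚ.*-suc t (exponent q i)))))
                      (ℕₚ.*-monoʳ-≤ t b<b′)) U U′ e) lU

      exponents-injective : ∀ q q′ → (∀ i → finToFun {B} {n} q i ≡ finToFun {B} {n} q′ i) → q ≡ q′
      exponents-injective q q′ e = ≡.trans (≡.sym (Finₚ.funToFin-finToFin {n} {B} q))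
        (≡.trans (funToFin-cong (finToFun q) (finToFun q′) e) (Finₚ.funToFin-finToFin {n} {B} q′))

    W-separated : ∀ q q′ → q ≢ q′ → Zero₂ q q′
    W-separated q q′ q≢q′ U U′ lU lU′ e
      with Finₚ.¬∀⟶∃¬ n _ (λ i → finToFun {B} {n} q i Finₚ.≟ finToFun {B} {n} q′ i) (q≢q′ ∘ exponents-injective q q′)
    ... | i , b≢b′ with ℕₚ.<-cmp (exponent q i) (exponent q′ i)
    ...   | tri< b<b′ _ _ = separated-< q q′ i b<b′ U U′ lU lU′ e
    ...   | tri≈ _ b≡b′ _ = contradiction (Finₚ.toℕ-injective b≡b′) b≢b′
    ...   | tri> _ _ b′<b = swap (separated-< q′ q i b′<b U′ U lU′ lU (trans (+-comm _ _) e))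

    F : Pol
    F = product f

    Len-F : Len (suc (n ℕ.* d)) F
    Len-F = Len-product f Len-f

    F≉0 : ¬ (F ≈ 0#)
    F≉0 = Deg⇒≉0 (proj₂ (Deg-product f λ i → let m , _ , _ , deg = degree i in m , deg))

    system : ExponentialSystem F (n ℕ.* d) t (n ℕ.* (t ℕ.* B ℕ.* d)) W
    system = record
      { log-deriv     = λ q → LogDerivative.value (dlog q)
      ; θ-W           = λ q → LogDerivative.eq (dlog q)
      ; Len-log-deriv = λ q → LogDerivative.len (dlog q)
      ; Len-W         = Len-W
      ; W-regular     = W-regular
      ; W-separated   = W-separated }
      where
      dlog : ∀ q → LogDerivative F (W q) (n ℕ.* d)
      dlog q = log-derivative-product f (factors q) Len-f λ i → log-derivative-^ (t ℕ.* exponent q i) (Len-f i)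

    few-zeros : ∀ xs → Distinct xs → All (λ x → ev x F K.≈ K.0#) xs → length xs ℕ.≤ n ℕ.* d
    few-zeros xs distinct zeros with length xs ℕₚ.≤? n ℕ.* d
    ... | yes bound = bound
    ... | no ¬bound = contradiction (zero-by-values xs F distinct zeros Len-F (ℕₚ.≰⇒> ¬bound)) F≉0

    few-unit-powers : ∀ A M → 1 ℕ.≤ t → M ℕ.≤ p →
      (let Δ = n ℕ.* d; Q = B ℕ.^ n; E = suc (Q ℕ.* (A ℕ.+ Q ℕ.* Δ)); w = n ℕ.* (t ℕ.* B ℕ.* d)) →
      E ℕ.+ (A ℕ.+ Q ℕ.* Δ) ℕ.≤ t → E ℕ.+ Δ ℕ.≤ p → A ℕ.+ w ℕ.≤ p → M ℕ.* (A ℕ.+ M ℕ.* Δ) ℕ.< Q ℕ.* A →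
      ∀ xs → Distinct xs → All (λ x → ∀ i → ev x (f i ^ t) K.≈ K.1#) xs → length xs ℕ.* M ℕ.≤ A ℕ.+ w
    few-unit-powers A M 1≤t M≤p E+≤t E+Δ≤p A+w≤p count xs distinct unit =
      Independence.stepanov-bound F F≉0 (n ℕ.* d) t (n ℕ.* (t ℕ.* B ℕ.* d)) (B ℕ.^ n) A Len-F E+≤t E+Δ≤p A+w≤p
        system M M≤p count xs distinct (All.map (λ {x} u → F[x]≉0 x u , W[x]≈1 x u) unit)
      where
      module _ (x : K.Carrier) (u : ∀ i → ev x (f i ^ t) K.≈ K.1#) where
        W[x]≈1 : ∀ q → ev x (W q) K.≈ K.1#
        W[x]≈1 q = ev-product-1 x (factors q) λ i →
          K.trans (ev-cong x (sym (^-assocʳ (f i) t (exponent q i)))) (ev-^-1 x (exponent q i) (u i))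
        f[x]≉0 : ∀ t → 1 ℕ.≤ t → ∀ i → ev x (f i ^ t) K.≈ K.1# → ¬ (ev x (f i) K.≈ K.0#)
        f[x]≉0 (suc t) _ i u e = K.1≉0 (K.trans (K.sym u)
          (K.trans (ev-* x _ _) (K.trans (K.*-congʳ e) (K.zeroˡ _))))
        F[x]≉0 : ¬ (ev x F K.≈ K.0#)
        F[x]≉0 = ev-product-≉0 x f λ i → f[x]≉0 t 1≤t i (u i)

-- Finite sets, the field of integers modulo p, and its subgroups

module FiniteSets where
  open Subset using (inside; outside)
  open ≡ using (refl; sym; trans; cong)

  injective⇒surjective : ∀ {n} (f : Fin n → Fin n) → (∀ {i j} → f i ≡ f j → i ≡ j) → ∀ y → ∃[ x ] f x ≡ y
  injective⇒surjective {suc n} f inj y with Finₚ.any? (λ x → f x Finₚ.≟ y)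
  ... | yes found = found
  ... | no missed = contradiction (inj (Finₚ.punchOut-injective (y≢f i) (y≢f j) eq)) (Finₚ.<⇒≢ i<j)
    where
    y≢f : ∀ x → ¬ (y ≡ f x)
    y≢f x e = missed (x , sym e)
    collision = Finₚ.pigeonhole (ℕₚ.n<1+n n) (λ x → punchOut (y≢f x))
    i = proj₁ collision
    j = proj₁ (proj₂ collision)
    i<j = proj₁ (proj₂ (proj₂ collision))
    eq = proj₂ (proj₂ (proj₂ collision))

  elements : ∀ {n} → Subset n → List (Fin n)
  elements []            = []
  elements (inside ∷ s)  = zero ∷ List.map suc (elements s)
  elements (outside ∷ s) = List.map suc (elements s)

  length-elements : ∀ {n} (s : Subset n) → length (elements s) ≡ ∣ s ∣
  length-elements []            = refl
  length-elements (inside ∷ s)  = cong suc (trans (Listₚ.length-map suc (elements s)) (length-elements s))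
  length-elements (outside ∷ s) = trans (Listₚ.length-map suc (elements s)) (length-elements s)

  ∈-elements⁺ : ∀ {n} {s : Subset n} {x} → x Subset.∈ s → x ∈ˡ elements s
  ∈-elements⁺ {s = inside ∷ s}  here      = here refl
  ∈-elements⁺ {s = inside ∷ s}  (there h) = there (∈ₚ.∈-map⁺ suc (∈-elements⁺ h))
  ∈-elements⁺ {s = outside ∷ s} (there h) = ∈ₚ.∈-map⁺ suc (∈-elements⁺ h)

  ∈-elements⁻ : ∀ {n} (s : Subset n) {x} → x ∈ˡ elements s → x Subset.∈ s
  ∈-elements⁻ (inside ∷ s)  (here refl) = here
  ∈-elements⁻ (inside ∷ s)  (there h) with y , y∈ , refl ← ∈ₚ.∈-map⁻ suc h = there (∈-elements⁻ s y∈)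
  ∈-elements⁻ (outside ∷ s) h with y , y∈ , refl ← ∈ₚ.∈-map⁻ suc h = there (∈-elements⁻ s y∈)

  elements-unique : ∀ {n} (s : Subset n) → Unique (elements s)
  elements-unique []            = []
  elements-unique (inside ∷ s)  =
    Allₚ.map⁺ (All.universal (λ _ ()) (elements s)) ∷ Uniqueₚ.map⁺ Finₚ.suc-injective (elements-unique s)
  elements-unique (outside ∷ s) = Uniqueₚ.map⁺ Finₚ.suc-injective (elements-unique s)

  lookup-injective : ∀ {A : Set} {xs : List A} → Unique xs → ∀ i j → List.lookup xs i ≡ List.lookup xs j → i ≡ j
  lookup-injective (x∉ ∷ u) zero    zero    e = refl
  lookup-injective (x∉ ∷ u) zero    (suc j) e = contradiction e (All.lookup x∉ (∈ₚ.∈-lookup j))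
  lookup-injective (x∉ ∷ u) (suc i) zero    e = contradiction (sym e) (All.lookup x∉ (∈ₚ.∈-lookup i))
  lookup-injective (x∉ ∷ u) (suc i) (suc j) e = cong suc (lookup-injective u i j e)

  Unique-⊆⇒length≤ : ∀ {A : Set} (xs ys : List A) → Unique xs → (∀ {x} → x ∈ˡ xs → x ∈ˡ ys) → length xs ℕ.≤ length ys
  Unique-⊆⇒length≤ xs ys u xs⊆ys = Finₚ.injective⇒≤ {f = λ i → Any.index (xs⊆ys (∈ₚ.∈-lookup {xs = xs} i))}
    λ {i} {j} e → lookup-injective u i j (trans (Anyₚ.lookup-index (xs⊆ys (∈ₚ.∈-lookup {xs = xs} i)))
      (trans (cong (List.lookup ys) e) (sym (Anyₚ.lookup-index (xs⊆ys (∈ₚ.∈-lookup {xs = xs} j))))))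

module PrimeField (p : ℕ) .{{_ : NonZero p}} (p-prime : Prime p) where
  open ≡ using (refl; sym; trans; cong; cong₂; subst; isEquivalence; module ≡-Reasoning)
  open FiniteSets

  F = Fin p

  private
    1<p : 1 ℕ.< p
    1<p = ℕ.nonTrivial⇒n>1 p {{prime⇒nonTrivial p-prime}}

    [_] : ℕ → F
    [ a ] = a mod p

    toℕ-[] : ∀ a → toℕ [ a ] ≡ a % p
    toℕ-[] a = Finₚ.toℕ-fromℕ< (m%n<n a p)

    []-cong : ∀ {a b} → a % p ≡ b % p → [ a ] ≡ [ b ]
    []-cong e = Finₚ.toℕ-injective (trans (toℕ-[] _) (trans e (sym (toℕ-[] _))))

    []-toℕ : ∀ x → [ toℕ x ] ≡ x
    []-toℕ x = Finₚ.toℕ-injective (trans (toℕ-[] _) (m<n⇒m%n≡m (Finₚ.toℕ<n x)))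

    _+ᶠ_ _*ᶠ_ : F → F → F
    x +ᶠ y = [ toℕ x ℕ.+ toℕ y ]
    x *ᶠ y = [ toℕ x ℕ.* toℕ y ]

    []-+ : ∀ a b → [ a ] +ᶠ [ b ] ≡ [ a ℕ.+ b ]
    []-+ a b = []-cong (begin
      (toℕ [ a ] ℕ.+ toℕ [ b ]) % p   ≡⟨ cong₂ (λ a b → (a ℕ.+ b) % p) (toℕ-[] a) (toℕ-[] b) ⟩
      (a % p ℕ.+ b % p) % p           ≡⟨ %-distribˡ-+ a b p ⟨
      (a ℕ.+ b) % p                   ∎)
      where open ≡-Reasoning

    []-* : ∀ a b → [ a ] *ᶠ [ b ] ≡ [ a ℕ.* b ]
    []-* a b = []-cong (begin
      (toℕ [ a ] ℕ.* toℕ [ b ]) % p   ≡⟨ cong₂ (λ a b → (a ℕ.* b) % p) (toℕ-[] a) (toℕ-[] b) ⟩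
      (a % p ℕ.* (b % p)) % p         ≡⟨ %-distribˡ-* a b p ⟨
      (a ℕ.* b) % p                   ∎)
      where open ≡-Reasoning

    +-assoc : ∀ x y z → (x +ᶠ y) +ᶠ z ≡ x +ᶠ (y +ᶠ z)
    +-assoc x y z = begin
      [ X ℕ.+ Y ] +ᶠ z               ≡⟨ cong ([ X ℕ.+ Y ] +ᶠ_) ([]-toℕ z) ⟨
      [ X ℕ.+ Y ] +ᶠ [ Z ]           ≡⟨ []-+ (X ℕ.+ Y) Z ⟩
      [ X ℕ.+ Y ℕ.+ Z ]              ≡⟨ cong [_] (ℕₚ.+-assoc X Y Z) ⟩
      [ X ℕ.+ (Y ℕ.+ Z) ]            ≡⟨ []-+ X (Y ℕ.+ Z) ⟨
      [ X ] +ᶠ [ Y ℕ.+ Z ]           ≡⟨ cong (_+ᶠ [ Y ℕ.+ Z ]) ([]-toℕ x) ⟩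
      x +ᶠ [ Y ℕ.+ Z ]               ∎
      where open ≡-Reasoning ; X = toℕ x ; Y = toℕ y ; Z = toℕ z

    *-assoc : ∀ x y z → (x *ᶠ y) *ᶠ z ≡ x *ᶠ (y *ᶠ z)
    *-assoc x y z = begin
      [ X ℕ.* Y ] *ᶠ z               ≡⟨ cong ([ X ℕ.* Y ] *ᶠ_) ([]-toℕ z) ⟨
      [ X ℕ.* Y ] *ᶠ [ Z ]           ≡⟨ []-* (X ℕ.* Y) Z ⟩
      [ X ℕ.* Y ℕ.* Z ]              ≡⟨ cong [_] (ℕₚ.*-assoc X Y Z) ⟩
      [ X ℕ.* (Y ℕ.* Z) ]            ≡⟨ []-* X (Y ℕ.* Z) ⟨
      [ X ] *ᶠ [ Y ℕ.* Z ]           ≡⟨ cong (_*ᶠ [ Y ℕ.* Z ]) ([]-toℕ x) ⟩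
      x *ᶠ [ Y ℕ.* Z ]               ∎
      where open ≡-Reasoning ; X = toℕ x ; Y = toℕ y ; Z = toℕ z

    distribˡ : ∀ x y z → x *ᶠ (y +ᶠ z) ≡ (x *ᶠ y) +ᶠ (x *ᶠ z)
    distribˡ x y z = begin
      x *ᶠ [ Y ℕ.+ Z ]               ≡⟨ cong (_*ᶠ [ Y ℕ.+ Z ]) ([]-toℕ x) ⟨
      [ X ] *ᶠ [ Y ℕ.+ Z ]           ≡⟨ []-* X (Y ℕ.+ Z) ⟩
      [ X ℕ.* (Y ℕ.+ Z) ]            ≡⟨ cong [_] (ℕₚ.*-distribˡ-+ X Y Z) ⟩
      [ X ℕ.* Y ℕ.+ X ℕ.* Z ]        ≡⟨ []-+ (X ℕ.* Y) (X ℕ.* Z) ⟨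
      (x *ᶠ y) +ᶠ (x *ᶠ z)           ∎
      where open ≡-Reasoning ; X = toℕ x ; Y = toℕ y ; Z = toℕ z

    +-comm : ∀ x y → x +ᶠ y ≡ y +ᶠ x
    +-comm x y = cong [_] (ℕₚ.+-comm (toℕ x) (toℕ y))

    *-comm : ∀ x y → x *ᶠ y ≡ y *ᶠ x
    *-comm x y = cong [_] (ℕₚ.*-comm (toℕ x) (toℕ y))

    +-identityˡ : ∀ x → [ 0 ] +ᶠ x ≡ x
    +-identityˡ x = trans (cong ([ 0 ] +ᶠ_) (sym ([]-toℕ x))) (trans ([]-+ 0 (toℕ x)) ([]-toℕ x))

    *-identityˡ : ∀ x → [ 1 ] *ᶠ x ≡ x
    *-identityˡ x = trans (cong ([ 1 ] *ᶠ_) (sym ([]-toℕ x)))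
      (trans ([]-* 1 (toℕ x)) (trans (cong [_] (ℕₚ.*-identityˡ (toℕ x))) ([]-toℕ x)))

    -‿inverseˡ : ∀ x → [ p ℕ.∸ toℕ x ] +ᶠ x ≡ [ 0 ]
    -‿inverseˡ x = begin
      [ p ℕ.∸ toℕ x ] +ᶠ x               ≡⟨ cong ([ p ℕ.∸ toℕ x ] +ᶠ_) ([]-toℕ x) ⟨
      [ p ℕ.∸ toℕ x ] +ᶠ [ toℕ x ]       ≡⟨ []-+ (p ℕ.∸ toℕ x) (toℕ x) ⟩
      [ p ℕ.∸ toℕ x ℕ.+ toℕ x ]          ≡⟨ cong [_] (ℕₚ.m∸n+n≡m (ℕₚ.<⇒≤ (Finₚ.toℕ<n x))) ⟩
      [ p ]                              ≡⟨ []-cong (trans (n%n≡0 p) (sym (m<n⇒m%n≡m (ℕₚ.<-trans (s≤s z≤n) 1<p)))) ⟩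
      [ 0 ]                              ∎
      where open ≡-Reasoning

    0%p : 0 % p ≡ 0
    0%p = m<n⇒m%n≡m (ℕₚ.<-trans (s≤s z≤n) 1<p)

    []≡0⇒∣ : ∀ a → [ a ] ≡ [ 0 ] → p ∣ a
    []≡0⇒∣ a e = m%n≡0⇒n∣m a p (trans (sym (toℕ-[] a)) (trans (cong toℕ e) (trans (toℕ-[] 0) 0%p)))

    ∣⇒≡0 : ∀ x → p ∣ toℕ x → x ≡ [ 0 ]
    ∣⇒≡0 x d = trans (sym ([]-toℕ x)) ([]-cong (trans (n∣m⇒m%n≡0 (toℕ x) p d) (sym 0%p)))

  commutativeRing : CommutativeRing 0ℓ 0ℓ
  commutativeRing = record
    { Carrier = F ; _≈_ = _≡_ ; _+_ = _+ᶠ_ ; _*_ = _*ᶠ_ ; -_ = λ x → [ p ℕ.∸ toℕ x ] ; 0# = [ 0 ] ; 1# = [ 1 ]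
    ; isCommutativeRing = record
      { isRing = record
        { +-isAbelianGroup = record
          { isGroup = record
            { isMonoid = record
              { isSemigroup = record
                { isMagma = record { isEquivalence = isEquivalence ; ∙-cong = cong₂ _+ᶠ_ }
                ; assoc = +-assoc }
              ; identity = +-identityˡ , λ x → trans (+-comm x _) (+-identityˡ x) }
            ; inverse = -‿inverseˡ , λ x → trans (+-comm x _) (-‿inverseˡ x)
            ; ⁻¹-cong = cong (λ x → [ p ℕ.∸ toℕ x ]) }
          ; comm = +-comm }
        ; *-cong = cong₂ _*ᶠ_
        ; *-assoc = *-assoc
        ; *-identity = *-identityˡ , λ x → trans (*-comm x _) (*-identityˡ x)
        ; distrib = distribˡ , λ x y z → trans (*-comm (y +ᶠ z) x)
                      (trans (distribˡ x y z) (cong₂ _+ᶠ_ (*-comm x y) (*-comm x z))) }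
      ; *-comm = *-comm } }

  open CommutativeRing commutativeRing using (_+_; _*_; -_; 0#; 1#; zeroˡ; zeroʳ; *-identityʳ; +-rawMonoid; +-group; semiring; ring)
  open import Algebra.Properties.Ring ring using (-‿distribʳ-*)
  open import Algebra.Properties.Group +-group using (inverseˡ-unique; ⁻¹-involutive)

  private
    zero-product : ∀ x y → x * y ≡ 0# → x ≡ 0# ⊎ y ≡ 0#
    zero-product x y e = Sum.map (∣⇒≡0 x) (∣⇒≡0 y) (euclidsLemma (toℕ x) (toℕ y) p-prime ([]≡0⇒∣ _ e))

    *-cancelˡ : ∀ x {y z} → ¬ (x ≡ 0#) → x * y ≡ x * z → y ≡ z
    *-cancelˡ x {y} {z} x≢0 e with zero-product x (y + - z)
      (trans (distribˡ x y (- z)) (trans (cong₂ _+_ e (sym (-‿distribʳ-* x z))) (trans (+-comm (x * z) _) (-‿inverseˡ (x * z)))))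
    ... | inj₁ x≡0 = contradiction x≡0 x≢0
    ... | inj₂ e′  = trans (inverseˡ-unique y (- z) e′) (⁻¹-involutive z)

    0≢1 : ¬ (1# ≡ 0#)
    0≢1 e = ℕₚ.1+n≢0 (trans (sym (m<n⇒m%n≡m 1<p)) (trans (sym (toℕ-[] 1)) (trans (cong toℕ e) (trans (toℕ-[] 0) 0%p))))

    open RawMonoidDefinitions +-rawMonoid using () renaming (_×_ to _×ⁿ_)

    ×-1 : ∀ n → n ×ⁿ 1# ≡ [ n ]
    ×-1 zero    = refl
    ×-1 (suc n) = trans (cong (1# +_) (×-1 n)) ([]-+ 1 n)

  𝔽ₚ : FinitePrimeField p
  𝔽ₚ = record
    { commutativeRing = commutativeRing
    ; _≟_ = Finₚ._≟_
    ; 1≉0 = 0≢1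
    ; zero-product = zero-product
    ; inverse = λ x x≢0 → injective⇒surjective (x *_) (*-cancelˡ x x≢0) 1#
    ; characteristic = λ { (suc n) _ n<p e → ℕₚ.<⇒≱ n<p (∣⇒≤ ([]≡0⇒∣ (suc n) (trans (sym (×-1 (suc n))) e))) }
    ; 1<p = 1<p
    ; index = λ x → x
    ; elem = λ x → x
    ; elem-index = λ _ → refl
    ; index-elem = λ _ _ e → e }

  open SemiringExp semiring using (_^_)

  -- Multiplication by x permutes G, so the product of all elements of G is
  -- unchanged when it is multiplied by x ^ ∣ G ∣.
  lagrange : (G : Subset p) → IsSubgroup G → ∀ x → x Subset.∈ G → x ^ ∣ G ∣ ≡ 1#
  lagrange G G-subgroup x x∈G = *-cancelˡ Π Π≢0 (begin
    Π * x ^ ∣ G ∣                  ≡⟨ *-comm Π _ ⟩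
    x ^ ∣ G ∣ * Π                  ≡⟨ cong (λ n → x ^ n * Π) (length-elements G) ⟨
    x ^ length gs * Π              ≡⟨ product-map gs ⟨
    product (List.map (x *_) gs)   ≡⟨ Permutationₚ.foldr-commMonoid (≡.setoid F) *-isCommutativeMonoid (↭⇒↭ₛ permuted) ⟩
    Π                              ≡⟨ *-identityʳ Π ⟨
    Π * 1#                         ∎)
    where
    open ≡-Reasoning
    open IsSubgroup G-subgroup
    open CommutativeRing commutativeRing using (*-isCommutativeMonoid)
    gs = elements G
    product : List F → F
    product = foldr _*_ 1#
    Π = product gs
    ≢0 : ∀ y → y Subset.∈ G → ¬ (y ≡ 0#)
    ≢0 y y∈G refl = 0∉ y∈G
    product≢0 : ∀ ys → (∀ {y} → y ∈ˡ ys → ¬ (y ≡ 0#)) → ¬ (product ys ≡ 0#)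
    product≢0 []       _ = 0≢1
    product≢0 (y ∷ ys) h e with zero-product y _ e
    ... | inj₁ y≡0 = h (here refl) y≡0
    ... | inj₂ e′  = product≢0 ys (h ∘ there) e′
    Π≢0 : ¬ (Π ≡ 0#)
    Π≢0 = product≢0 gs λ y∈gs → ≢0 _ (∈-elements⁻ G y∈gs)
    product-map : ∀ ys → product (List.map (x *_) ys) ≡ x ^ length ys * product ys
    product-map []       = sym (*-identityʳ 1#)
    product-map (y ∷ ys) = begin
      x * y * product (List.map (x *_) ys)       ≡⟨ cong (x * y *_) (product-map ys) ⟩
      x * y * (x ^ length ys * product ys)       ≡⟨ *-assoc x y (x ^ length ys * product ys) ⟩
      x * (y * (x ^ length ys * product ys))     ≡⟨ cong (x *_) (*-assoc y (x ^ length ys) (product ys)) ⟨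
      x * (y * x ^ length ys * product ys)       ≡⟨ cong (λ z → x * (z * product ys)) (*-comm y (x ^ length ys)) ⟩
      x * (x ^ length ys * y * product ys)       ≡⟨ cong (x *_) (*-assoc (x ^ length ys) y (product ys)) ⟩
      x * (x ^ length ys * (y * product ys))     ≡⟨ *-assoc x (x ^ length ys) (y * product ys) ⟨
      x * x ^ length ys * (y * product ys)       ∎
    into : ∀ {y} → y ∈ˡ List.map (x *_) gs → y ∈ˡ gs
    into h with z , z∈ , refl ← ∈ₚ.∈-map⁻ (x *_) h = ∈-elements⁺ (*-closed x z x∈G (∈-elements⁻ G z∈))
    onto : ∀ {y} → y ∈ˡ gs → y ∈ˡ List.map (x *_) gs
    onto {y} y∈ with x⁻¹ , x⁻¹∈G , xx⁻¹≡1 ← inverse x x∈G =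
      subst (_∈ˡ List.map (x *_) gs)
        (trans (sym (*-assoc x x⁻¹ y)) (trans (cong (_* y) xx⁻¹≡1) (*-identityˡ y)))
        (∈ₚ.∈-map⁺ (x *_) (∈-elements⁺ (*-closed x⁻¹ y x⁻¹∈G (∈-elements⁻ G y∈))))
    permuted : List.map (x *_) gs ↭ gs
    permuted = ∼bag⇒↭ (unique∧set⇒bag (Uniqueₚ.map⁺ (*-cancelˡ x (≢0 x x∈G)) (elements-unique G))
      (elements-unique G) (mk⇔ into onto))

-- Composition and iterates of polynomials

module Iterates {p : ℕ} (𝕂 : FinitePrimeField p) where
  open FieldPolynomials 𝕂

  comp : Pol → Pol → Pol
  comp []      g = 0#
  comp (a ∷ f) g = const a + g * comp f g

  ev-comp : ∀ x f g → ev x (comp f g) K.≈ ev (ev x g) f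
  ev-comp x []      g = ev-0 x 0# refl
  ev-comp x (a ∷ f) g = K.trans (ev-+ x _ _)
    (K.+-cong (ev-const x a) (K.trans (ev-* x g _) (K.*-congˡ (ev-comp x f g))))

  -- Substitution respects congruences modulo `h`. Since the residue is kept as a constant, repeated
  -- use makes the residues of successive iterates run through an orbit of `f`.
  comp-mod : ∀ f {g h c} → (∃[ q ] g ≈ const c + h * q) → ∃[ q ] comp f g ≈ const (ev c f) + h * q
  comp-mod []      {h = h} _ = 0# , sym (trans (+-cong (const≈0 K.refl) (zeroʳ h)) (+-identityˡ 0#))
  comp-mod (a ∷ f) {g} {h} {c} (q , g≈) with comp-mod f {g} {h} {c} (q , g≈)
  ... | q′ , f≈ = const c * q′ + q * (const (ev c f) + h * q′) , (begin
    const a + g * comp f g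
      ≈⟨ +-congˡ (*-cong g≈ f≈) ⟩
    const a + (const c + h * q) * (const (ev c f) + h * q′)
      ≈⟨ solve 6 (λ a c h q e q′ → a :+ (c :+ h :* q) :* (e :+ h :* q′)
                               := (a :+ c :* e) :+ h :* (c :* q′ :+ q :* (e :+ h :* q′))) refl
               (const a) (const c) h q (const (ev c f)) q′ ⟩
    const a + const c * const (ev c f) + h * (const c * q′ + q * (const (ev c f) + h * q′))
      ≈⟨ +-congʳ (trans (const-+ a _) (+-congˡ (const-* c (ev c f)))) ⟨
    const (ev c (a ∷ f)) + h * (const c * q′ + q * (const (ev c f) + h * q′)) ∎)

  comp-0 : ∀ f g → f ≈ 0# → comp f g ≈ 0#
  comp-0 []      g e = refl
  comp-0 (a ∷ f) g e = trans (+-cong (const≈0 (at e 0)) (trans (*-congˡ (comp-0 f g (tail≈0 e))) (zeroʳ g)))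
                             (+-identityˡ 0#)

  Deg-const+ : ∀ a {h m} → Deg h (suc m) → Deg (const a + h) (suc m)
  Deg-const+ a {h} {m} (mkDeg h≉0 l) = mkDeg
    (λ e → h≉0 (K.trans (K.sym (K.trans (cf-⊞ (const a) h (suc m))
      (K.trans (K.+-congʳ (cf-const-suc a m)) (K.+-identityˡ _)))) e))
    (Len-+ (Len-mono (s≤s z≤n) (Len-const a)) l)

  -- With an inner polynomial of positive degree, the constant added in each Horner step lies below
  -- the leading term and cannot disturb it.
  Deg-comp : ∀ f {g m e} → Deg f m → Deg g (suc e) → Deg (comp f g) (m ℕ.* suc e)
  Deg-comp []      (mkDeg f≉0 _) _ = contradiction K.refl f≉0
  Deg-comp (a ∷ f) {g} {zero} (mkDeg a≉0 (mkLen v)) _ =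
    Deg-cong (sym (trans (+-congˡ (trans (*-congˡ (comp-0 f g (mk≋ λ n → v (suc n) (s≤s z≤n)))) (zeroʳ g))) (+-identityʳ _)))
      (mkDeg (λ e → a≉0 (K.trans (K.sym (cf-const-0 a)) e)) (Len-const a))
  Deg-comp (a ∷ f) {g} {suc m} (mkDeg f≉0 (mkLen v)) dg =
    Deg-const+ a (Deg-* dg (Deg-comp f (mkDeg f≉0 (mkLen λ i m<i → v (suc i) (s≤s m<i))) dg))

  iterate : Pol → ℕ → Pol
  iterate f zero    = X
  iterate f (suc j) = comp f (iterate f j)

  Deg-X : Deg X 1
  Deg-X = mkDeg (λ e → K.1≉0 (K.trans (K.sym (K.trans (cf-X-suc 0) (cf-const-0 _))) e))
    (mkLen λ { (suc (suc i)) _ → K.trans (cf-X-suc (suc i)) (cf-const-suc _ i) ; (suc zero) (s≤s ()) })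

  Deg-iterate : ∀ f {m} → 1 ℕ.≤ m → Deg f m → ∀ j → Deg (iterate f j) (m ℕ.^ j)
  Deg-iterate f         1≤m df zero    = Deg-X
  Deg-iterate f {suc m} 1≤m df (suc j) = go (suc m ℕ.^ j) (ℕₚ.m^n>0 (suc m) j) (Deg-iterate f 1≤m df j)
    where
    go : ∀ e → 0 ℕ.< e → Deg (iterate f j) e → Deg (comp f (iterate f j)) (suc m ℕ.* e)
    go (suc e) _ = Deg-comp f df

  ev-iterate-suc : ∀ x f j → ev x (iterate f (suc j)) K.≈ ev (ev x (iterate f j)) f
  ev-iterate-suc x f j = ev-comp x f (iterate f j)

  iterate-mod : ∀ f i m → ∃[ q ] iterate f (m ℕ.+ i) ≈ const (ev K.0# (iterate f m)) + iterate f i * q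
  iterate-mod f i zero    = 1# , sym (trans (+-cong (const≈0 (ev-X K.0#)) (*-identityʳ _)) (+-identityˡ _))
  iterate-mod f i (suc m) with comp-mod f (iterate-mod f i m)
  ... | q , e = q , trans e (+-congʳ (mk≋ λ
    { zero    → K.trans (cf-const-0 _) (K.trans (K.sym (ev-iterate-suc K.0# f m)) (K.sym (cf-const-0 _)))
    ; (suc n) → K.trans (cf-const-suc _ n) (K.sym (cf-const-suc _ n)) }))

  iterates-comaximal : ∀ f i m → ¬ (ev K.0# (iterate f m) K.≈ K.0#) → Comaximal (iterate f (m ℕ.+ i)) (iterate f i)
  iterates-comaximal f i m c≉0 = comaximal-factor (comaximal-shift c≉0 (proj₂ (iterate-mod f i m)))

  ev-product-0 : ∀ x {m} (g : Fin m → Pol) i → ev x (g i) K.≈ K.0# → ev x (product g) K.≈ K.0#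
  ev-product-0 x g zero    e = K.trans (ev-* x _ _) (K.trans (K.*-congʳ e) (K.zeroˡ _))
  ev-product-0 x g (suc i) e = K.trans (ev-* x _ _)
    (K.trans (K.*-congˡ (ev-product-0 x (g ∘ suc) i e)) (K.zeroʳ _))

  open SemiringExp K.semiring using () renaming (_^_ to _^ᴷ_)

  ev-^ : ∀ x g m → ev x (g ^ m) K.≈ ev x g ^ᴷ m
  ev-^ x g zero    = ev-const x K.1#
  ev-^ x g (suc m) = K.trans (ev-* x _ _) (K.*-congˡ (ev-^ x g m))

-- The orbit: words, return times to 0, and covering by special points

m∸[m∸n]≤n : ∀ m n → m ℕ.∸ (m ℕ.∸ n) ℕ.≤ n
m∸[m∸n]≤n m n = ℕₚ.m≤n+o⇒m∸n≤o m (m ℕ.∸ n)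
  (ℕₚ.≤-trans (ℕₚ.m≤n+m∸n m n) (ℕₚ.≤-reflexive (ℕₚ.+-comm n (m ℕ.∸ n))))

length-cartesianProductWith : ∀ {A B C : Set} (f : A → B → C) xs ys →
  length (cartesianProductWith f xs ys) ≡ length xs ℕ.* length ys
length-cartesianProductWith f []       ys = ≡.refl
length-cartesianProductWith f (x ∷ xs) ys = ≡.trans (Listₚ.length-++ (map (f x) ys))
  (≡.cong₂ ℕ._+_ (Listₚ.length-map (f x) ys) (length-cartesianProductWith f xs ys))

-- All lengths up to the second argument occur. How many words there are depends on `k` and this
-- length only, so their number can enter the constant of the theorem.
words : ∀ k → ℕ → List (List (Fin k))
words k zero    = [] ∷ []
words k (suc n) = [] ∷ cartesianProductWith _∷_ (allFin k) (words k n)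

∈-words : ∀ {k} n (is : List (Fin k)) → length is ℕ.≤ n → is ∈ˡ words k n
∈-words zero    []       _       = here ≡.refl
∈-words (suc n) []       _       = here ≡.refl
∈-words (suc n) (i ∷ is) (s≤s l) = there (∈ₚ.∈-cartesianProductWith⁺ _∷_ (∈ₚ.∈-allFin i) (∈-words n is l))

module Orbit (p : ℕ) .{{_ : NonZero p}} (p-prime : Prime p) where
  open FiniteSets
  open PrimeField p p-prime
  open FieldPolynomials 𝔽ₚ
  open Iterates 𝔽ₚ

  orbit₀ : Pol → ℕ → Fin p
  orbit₀ f zero    = K.0#
  orbit₀ f (suc m) = eval (𝔽 p) f (orbit₀ f m)

  orbit₀≡ev : ∀ f m → ev K.0# (iterate f m) ≡ orbit₀ f m
  orbit₀≡ev f zero    = ev-X K.0#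
  orbit₀≡ev f (suc m) = ≡.trans (ev-iterate-suc K.0# f m) (≡.cong (eval (𝔽 p) f) (orbit₀≡ev f m))

  orbit₀-shift : ∀ f k {i j} → orbit₀ f i ≡ orbit₀ f j → orbit₀ f (k ℕ.+ i) ≡ orbit₀ f (k ℕ.+ j)
  orbit₀-shift f zero    e = e
  orbit₀-shift f (suc k) e = ≡.cong (eval (𝔽 p) f) (orbit₀-shift f k e)

  module _ (L : CommutativeRing 0ℓ 0ℓ) (ι : Fin p → CommutativeRing.Carrier L) (closure : IsAlgebraicClosure p L ι) where
    private
      module L = CommutativeRing L
      module C = IsAlgebraicClosure closure
    open RingMorphisms.IsRingHomomorphism C.homomorphism

    ι-injective : ∀ x y → ι x L.≈ ι y → x ≡ y
    ι-injective x y e with (x K.- y) K.≟ K.0#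
    ... | yes x-y≡0 = ≡.trans (GroupProperties.inverseˡ-unique K.+-group x (K.- y) x-y≡0)
                              (GroupProperties.⁻¹-involutive K.+-group y)
    ... | no  x-y≢0 with K.inverse _ x-y≢0
    ...   | z , [x-y]z≡1 = contradiction 1≈0 C.1≉0
      where
      1≈0 : L.1# L.≈ L.0#
      1≈0 = L.trans (L.sym 1#-homo) (L.trans (L.reflexive (≡.cong ι (≡.sym [x-y]z≡1)))
        (L.trans (*-homo (x K.- y) z) (L.trans (L.*-congʳ (L.trans (+-homo x (K.- y))
          (L.trans (L.+-cong e (-‿homo y)) (L.-‿inverseʳ (ι y))))) (L.zeroˡ _))))

    eval-ι : ∀ f x → eval L.rawRing (map ι f) (ι x) L.≈ ι (eval (𝔽 p) f x)
    eval-ι []      x = L.sym 0#-homo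
    eval-ι (a ∷ f) x = L.trans (L.+-congˡ (L.trans (L.*-congˡ (eval-ι f x)) (L.sym (*-homo x _)))) (L.sym (+-homo a _))

    -- The first return of 0 to itself after m steps traces a genuine cycle of length m. Were two of
    -- its m points equal, applying the polynomial until the later one reaches 0 would yield an
    -- earlier return. `ι-injective` carries the distinctness over to the algebraic closure.
    no-short-period : ∀ {k} (f : Fin k → Pol) (i₀ : Fin k) c → C₀≥ L ι f c →
      ∀ m → 1 ℕ.≤ m → m ℕ.< c → ¬ (orbit₀ (f i₀) m ≡ K.0#)
    no-short-period {k} f i₀ c C₀≥c = <-rec _ step
      where
      o = orbit₀ (f i₀)
      step : ∀ m → (∀ {j} → j ℕ.< m → 1 ℕ.≤ j → j ℕ.< c → ¬ (o j ≡ K.0#)) → 1 ℕ.≤ m → m ℕ.< c → ¬ (o m ≡ K.0#)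
      step (suc m-1) minimal 1≤m m<c om≡0 = ℕₚ.<⇒≱ m<c (C₀≥c m record
        { vertex            = vertex
        ; edge              = λ j → vertex j , i₀
        ; joins             = λ j → inj₁ (L.refl , joins j)
        ; vertices-distinct = distinct
        ; edges-distinct    = λ i j e _ → distinct i j e
        ; through-0         = zero , 0#-homo })
        where
        m = suc m-1
        vertex : Fin m → L.Carrier
        vertex j = ι (o (toℕ j))
        o-mod : ∀ j → o (suc (toℕ j)) ≡ o (toℕ (suc (toℕ j) mod m))
        o-mod j with ℕₚ.m≤n⇒m<n∨m≡n (Finₚ.toℕ<n j)
        ... | inj₁ 1+j<m = ≡.cong o (≡.sym (≡.trans (Finₚ.toℕ-fromℕ< (m%n<n (suc (toℕ j)) m)) (m<n⇒m%n≡m 1+j<m)))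
        ... | inj₂ 1+j≡m = ≡.trans (≡.trans (≡.cong o 1+j≡m) om≡0) (≡.cong o (≡.sym
          (≡.trans (Finₚ.toℕ-fromℕ< (m%n<n (suc (toℕ j)) m)) (≡.trans (≡.cong (ℕ._% m) 1+j≡m) (n%n≡0 m)))))
        joins : ∀ j → eval L.rawRing (map ι (f i₀)) (vertex j) L.≈ vertex (suc (toℕ j) mod m)
        joins j = L.trans (eval-ι (f i₀) _) (L.reflexive (≡.cong ι (o-mod j)))
        o-distinct : ∀ {i j} → i ℕ.< j → j ℕ.< m → ¬ (o i ≡ o j)
        o-distinct {i} {j} i<j j<m e = minimal {m ℕ.∸ j ℕ.+ i} shorter
          (ℕₚ.≤-trans (ℕₚ.m<n⇒0<n∸m j<m) (ℕₚ.m≤m+n _ i)) (ℕₚ.<-trans shorter m<c)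
          (≡.trans (orbit₀-shift (f i₀) (m ℕ.∸ j) e)
            (≡.trans (≡.cong o (ℕₚ.m∸n+n≡m (ℕₚ.<⇒≤ j<m))) om≡0))
          where
          shorter : m ℕ.∸ j ℕ.+ i ℕ.< m
          shorter = ℕₚ.<-≤-trans (ℕₚ.+-monoʳ-< (m ℕ.∸ j) i<j) (ℕₚ.≤-reflexive (ℕₚ.m∸n+n≡m (ℕₚ.<⇒≤ j<m)))
        distinct : ∀ i j → vertex i L.≈ vertex j → i ≡ j
        distinct i j e with ℕₚ.<-cmp (toℕ i) (toℕ j)
        ... | tri< i<j _ _ = contradiction (ι-injective _ _ e) (o-distinct i<j (Finₚ.toℕ<n j))
        ... | tri≈ _ i≡j _ = Finₚ.toℕ-injective i≡j
        ... | tri> _ _ j<i = contradiction (≡.sym (ι-injective _ _ e)) (o-distinct j<i (Finₚ.toℕ<n i))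

  module Counting {k : ℕ} (f : Fin k → Pol) (i₀ : Fin k) (d n : ℕ) (1≤n : 1 ℕ.≤ n)
    (degree : ∀ i → ∃[ m ] 1 ℕ.≤ m × m ℕ.≤ d × HasDegree (𝔽 p) (f i) m)
    (o≢0 : ∀ m → 1 ℕ.≤ m → m ℕ.< n → ¬ (orbit₀ (f i₀) m ≡ K.0#))
    (u : Fin p) (N : ℕ) (𝒱 𝒢 : Subset p) (isOrbit : IsOrbit f u N 𝒱)
    (isSubgroup : IsSubgroup 𝒢) (contains : ContainsNonzero 𝒢 𝒱) where

    t : ℕ
    t = ∣ 𝒢 ∣

    h : Fin n → Pol
    h i = iterate (f i₀) (suc (toℕ i))

    h-degree : ∀ i → ∃[ m ] 1 ℕ.≤ m × m ℕ.≤ d ℕ.^ n × Deg (h i) m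
    h-degree i with degree i₀
    ... | m , 1≤m , m≤d , f≉0 , v = m ℕ.^ suc (toℕ i) , positive m 1≤m ,
      ℕₚ.≤-trans (ℕₚ.^-monoˡ-≤ (suc (toℕ i)) m≤d) (power-mono d (ℕₚ.≤-trans 1≤m m≤d) (Finₚ.toℕ<n i)) ,
      Deg-iterate (f i₀) 1≤m (mkDeg f≉0 (mkLen v)) (suc (toℕ i))
      where
      positive : ∀ m → 1 ℕ.≤ m → 1 ℕ.≤ m ℕ.^ suc (toℕ i)
      positive (suc m) _ = ℕₚ.m^n>0 (suc m) (suc (toℕ i))
      power-mono : ∀ d {a b} → 1 ℕ.≤ d → a ℕ.≤ b → d ℕ.^ a ℕ.≤ d ℕ.^ b
      power-mono (suc d) _ a≤b = ℕₚ.^-monoʳ-≤ (suc d) a≤b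

    h-comaximal-< : ∀ i j → toℕ i ℕ.< toℕ j → Comaximal (h j) (h i)
    h-comaximal-< i j i<j = ≡.subst (λ m → Comaximal (iterate (f i₀) m) (h i)) eq
      (iterates-comaximal (f i₀) (suc (toℕ i)) (toℕ j ℕ.∸ toℕ i) λ e →
        o≢0 (toℕ j ℕ.∸ toℕ i) (ℕₚ.m<n⇒0<n∸m i<j) (ℕₚ.≤-<-trans (ℕₚ.m∸n≤m (toℕ j) (toℕ i)) (Finₚ.toℕ<n j))
          (≡.trans (≡.sym (orbit₀≡ev (f i₀) (toℕ j ℕ.∸ toℕ i))) e))
      where
      eq : toℕ j ℕ.∸ toℕ i ℕ.+ suc (toℕ i) ≡ suc (toℕ j)
      eq = ≡.trans (ℕₚ.+-suc _ (toℕ i)) (≡.cong suc (ℕₚ.m∸n+n≡m (ℕₚ.<⇒≤ i<j)))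

    h-comaximal : ∀ i j → i ≢ j → Comaximal (h i) (h j)
    h-comaximal i j i≢j with ℕₚ.<-cmp (toℕ i) (toℕ j)
    ... | tri< i<j _ _ = comaximal-sym (h-comaximal-< i j i<j)
    ... | tri≈ _ i≡j _ = contradiction (Finₚ.toℕ-injective i≡j) i≢j
    ... | tri> _ _ j<i = h-comaximal-< j i j<i

    -- The two kinds of starting points: where some `h i` vanishes, only the degree of the product
    -- limits their number; elsewhere all values lie in `𝒢`, and Lagrange's theorem puts the point
    -- into `good`, which Stepanov's method bounds.
    zeros good : List (Fin p)
    zeros = filter (λ x → ev x (product h) K.≟ K.0#) (allFin p)
    good  = filter (λ x → Finₚ.all? λ i → ev x (h i ^ t) K.≟ K.1#) (allFin p)

    private
      run : Fin p → List (Fin k) → Fin p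
      run = foldr (λ i → eval (𝔽 p) (f i))

      ev-h : ∀ x j → ev x (iterate (f i₀) j) ≡ run x (replicate j i₀)
      ev-h x zero    = ev-X x
      ev-h x (suc j) = ≡.trans (ev-iterate-suc x (f i₀) j) (≡.cong (eval (𝔽 p) (f i₀)) (ev-h x j))

      core : List (Fin k) → Fin p
      core is = run u is

    core-covered : n ℕ.≤ N → ∀ is → length is ℕ.≤ N ℕ.∸ n → core is ∈ˡ zeros ++ good
    core-covered n≤N is short with Finₚ.any? (λ i → ev (core is) (h i) K.≟ K.0#)
    ... | yes (i , e) = ∈ₚ.∈-++⁺ˡ (∈ₚ.∈-filter⁺ (λ x → ev x (product h) K.≟ K.0#) (∈ₚ.∈-allFin _)
                          (ev-product-0 (core is) h i e))
    ... | no nonzero = ∈ₚ.∈-++⁺ʳ zeros (∈ₚ.∈-filter⁺ (λ x → Finₚ.all? λ i → ev x (h i ^ t) K.≟ K.1#)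
        (∈ₚ.∈-allFin _) λ i → ≡.trans (ev-^ (core is) (h i) t)
          (lagrange 𝒢 isSubgroup _ (contains _ (in-orbit i) (λ e → nonzero (i , e)))))
      where
      in-orbit : ∀ i → ev (core is) (h i) Subset.∈ 𝒱
      in-orbit i = Equivalence.from (isOrbit _) (replicate (suc (toℕ i)) i₀ ++ is , long , value)
        where
        value : ev (core is) (h i) ≡ run u (replicate (suc (toℕ i)) i₀ ++ is)
        value = ≡.trans (ev-h (core is) (suc (toℕ i)))
          (≡.sym (Listₚ.foldr-++ (λ i → eval (𝔽 p) (f i)) u (replicate (suc (toℕ i)) i₀) is))
        long : length (replicate (suc (toℕ i)) i₀ ++ is) ℕ.≤ N
        long = ℕₚ.≤-trans (ℕₚ.≤-reflexive (≡.trans (Listₚ.length-++ (replicate (suc (toℕ i)) i₀))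
            (≡.cong (ℕ._+ length is) (Listₚ.length-replicate (suc (toℕ i))))))
          (ℕₚ.≤-trans (ℕₚ.+-mono-≤ (Finₚ.toℕ<n i) short) (ℕₚ.≤-reflexive (ℕₚ.m+[n∸m]≡n n≤N)))

    -- `run` applies the last letter of a word first. The final N - n letters thus lead from `u` to
    -- a point of `xs`, and at most `n` letters remain to act on it, so the orbit is an image of
    -- `words k n` times `xs`.
    cover : ∀ xs → (∀ is → length is ℕ.≤ N ℕ.∸ n → core is ∈ˡ xs) → ∣ 𝒱 ∣ ℕ.≤ length (words k n) ℕ.* length xs
    cover xs covered = ℕₚ.≤-trans (ℕₚ.≤-reflexive (≡.sym (length-elements 𝒱)))
      (ℕₚ.≤-trans (Unique-⊆⇒length≤ (elements 𝒱) ys (elements-unique 𝒱) inside)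
        (ℕₚ.≤-reflexive (length-cartesianProductWith (λ w x → run x w) (words k n) xs)))
      where
      ys = cartesianProductWith (λ w x → run x w) (words k n) xs
      inside : ∀ {y} → y ∈ˡ elements 𝒱 → y ∈ˡ ys
      inside y∈ with Equivalence.to (isOrbit _) (∈-elements⁻ 𝒱 y∈)
      ... | is , short , ≡.refl = ≡.subst (_∈ˡ ys)
        (≡.trans (≡.sym (Listₚ.foldr-++ (λ i → eval (𝔽 p) (f i)) u (take m is) (drop m is)))
                 (≡.cong (run u) (Listₚ.take++drop≡id m is)))
        (∈ₚ.∈-cartesianProductWith⁺ (λ w x → run x w) (∈-words n (take m is) take-short) (covered (drop m is) drop-short))
        where
        r = N ℕ.∸ n
        -- For a word of length at most `r` the subtraction truncates to 0 and the whole word goes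
        -- into the core.
        m = length is ℕ.∸ r
        take-short : length (take m is) ℕ.≤ n
        take-short = ℕₚ.≤-trans (ℕₚ.≤-reflexive (Listₚ.length-take m is)) (ℕₚ.≤-trans (ℕₚ.m⊓n≤m m (length is))
          (ℕₚ.≤-trans (ℕₚ.∸-monoˡ-≤ r short) (m∸[m∸n]≤n N n)))
        drop-short : length (drop m is) ℕ.≤ r
        drop-short = ℕₚ.≤-trans (ℕₚ.≤-reflexive (Listₚ.length-drop m is)) (m∸[m∸n]≤n (length is) r)

    open CoprimeFamily 𝔽ₚ
    module P B = Powers h (d ℕ.^ n) h-degree h-comaximal t B

    1≤d^n : 1 ℕ.≤ d ℕ.^ n
    1≤d^n with degree i₀
    ... | m , 1≤m , m≤d , _ = positive d (ℕₚ.≤-trans 1≤m m≤d)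
      where
      positive : ∀ d → 1 ℕ.≤ d → 1 ℕ.≤ d ℕ.^ n
      positive (suc d) _ = ℕₚ.m^n>0 (suc d) n

    orbit-size : ∣ 𝒱 ∣ ℕ.≤ length (words k n) ℕ.* (n ℕ.* d ℕ.^ n ℕ.+ length good)
    orbit-size with n ℕₚ.≤? N
    ... | yes n≤N = ℕₚ.≤-trans (cover (zeros ++ good) (core-covered n≤N))
      (ℕₚ.*-monoʳ-≤ (length (words k n)) (ℕₚ.≤-trans (ℕₚ.≤-reflexive (Listₚ.length-++ zeros))
        (ℕₚ.+-monoˡ-≤ (length good) (P.few-zeros 0 zeros (Uniqueₚ.filter⁺ _ (Uniqueₚ.allFin⁺ p))
          (Allₚ.all-filter (λ x → ev x (product h) K.≟ K.0#) (allFin p))))))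
    -- Here N - n truncates to 0, the only core is `u` itself, and the factor n d^n ≥ 1 accounts for
    -- it.
    ... | no n≰N = ℕₚ.≤-trans (cover (u ∷ []) λ is short → here (core-u is
        (ℕₚ.≤-trans short (ℕₚ.≤-reflexive (ℕₚ.m≤n⇒m∸n≡0 (ℕₚ.<⇒≤ (ℕₚ.≰⇒> n≰N)))))))
      (ℕₚ.*-monoʳ-≤ (length (words k n)) (ℕₚ.≤-trans (ℕₚ.*-mono-≤ 1≤n 1≤d^n) (ℕₚ.m≤m+n _ (length good))))
      where
      core-u : ∀ is → length is ℕ.≤ 0 → core is ≡ u
      core-u [] _ = ≡.refl

    -- This crude bound handles groups of bounded order, too small for the parameters of Stepanov's
    -- method; the extra 1 stands for the element 0.
    orbit-in-group : ∣ 𝒱 ∣ ℕ.≤ suc t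
    orbit-in-group = ℕₚ.≤-trans (ℕₚ.≤-reflexive (≡.sym (length-elements 𝒱)))
      (ℕₚ.≤-trans (Unique-⊆⇒length≤ (elements 𝒱) (K.0# ∷ elements 𝒢) (elements-unique 𝒱) inside)
        (s≤s (ℕₚ.≤-reflexive (length-elements 𝒢))))
      where
      inside : ∀ {y} → y ∈ˡ elements 𝒱 → y ∈ˡ K.0# ∷ elements 𝒢
      inside {y} y∈ with y K.≟ K.0#
      ... | yes y≡0 = here y≡0
      ... | no  y≢0 = there (∈-elements⁺ (contains y (∈-elements⁻ 𝒱 y∈) y≢0))

    private
      nonempty : ∀ {x : Fin p} (S : Subset p) → x Subset.∈ S → 1 ℕ.≤ ∣ S ∣
      nonempty S x∈S = ℕₚ.≤-trans (go (∈-elements⁺ x∈S)) (ℕₚ.≤-reflexive (length-elements S))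
        where
        go : ∀ {x : Fin p} {xs} → x ∈ˡ xs → 1 ℕ.≤ length xs
        go (here _)  = s≤s z≤n
        go (there _) = s≤s z≤n

    1≤t : 1 ℕ.≤ t
    1≤t = nonempty 𝒢 (IsSubgroup.1∈ isSubgroup)

    1≤V : 1 ℕ.≤ ∣ 𝒱 ∣
    1≤V = nonempty 𝒱 (Equivalence.from (isOrbit u) ([] , z≤n , ≡.refl))

    t≤p : t ℕ.≤ p
    t≤p = Subsetₚ.∣p∣≤n 𝒢

    good-size : ∀ B A M → M ℕ.≤ p →
      (let Δ = n ℕ.* d ℕ.^ n; Q = B ℕ.^ n; E = suc (Q ℕ.* (A ℕ.+ Q ℕ.* Δ)); w = n ℕ.* (t ℕ.* B ℕ.* d ℕ.^ n)) →
      E ℕ.+ (A ℕ.+ Q ℕ.* Δ) ℕ.≤ t → E ℕ.+ Δ ℕ.≤ p → A ℕ.+ w ℕ.≤ p → M ℕ.* (A ℕ.+ M ℕ.* Δ) ℕ.< Q ℕ.* A →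
      length good ℕ.* M ℕ.≤ A ℕ.+ w
    good-size B A M M≤p E+≤t E+Δ≤p A+w≤p count = P.few-unit-powers B A M 1≤t M≤p E+≤t E+Δ≤p A+w≤p count
      good (Uniqueₚ.filter⁺ _ (Uniqueₚ.allFin⁺ p))
      (Allₚ.all-filter (λ x → Finₚ.all? λ i → ev x (h i ^ t) K.≟ K.1#) (allFin p))

-- Choice of the parameters and the resulting inequalities

module Parameters where
  open ℕₚ
  open ≡ using (refl; cong; cong₂; sym; trans; subst)
  open import Data.Nat.Base using (_+_; _*_; _^_)

  1≤m^n : ∀ {m} n → 1 ≤ m → 1 ≤ m ^ n
  1≤m^n {suc m} n _ = m^n>0 (suc m) n

  ^-distribʳ-* : ∀ o m n → (m * n) ^ o ≡ m ^ o * n ^ o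
  ^-distribʳ-* zero    m n = refl
  ^-distribʳ-* (suc o) m n = trans (cong (m * n *_) (^-distribʳ-* o m n))
    (solve 4 (λ m n x y → m :* n :* (x :* y) := m :* x :* (n :* y)) refl m n (m ^ o) (n ^ o))
    where open +-*-Solver

  m≤m*n′ : ∀ m {n} → 1 ≤ n → m ≤ m * n
  m≤m*n′ m {suc n} _ = m≤m*n m (suc n)

  m≤n*m′ : ∀ m {n} → 1 ≤ n → m ≤ n * m
  m≤n*m′ m {suc n} _ = m≤n*m m (suc n)

  cancelʳ : ∀ {m n} o → 1 ≤ o → m * o ≤ n * o → m ≤ n
  cancelʳ {m} {n} (suc o) _ = *-cancelʳ-≤ m n (suc o)

  -- A search upwards from 1: as g (t + 1) ≥ t + 1 > t, it stops within `t` steps.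
  last-below : ∀ (g : ℕ → ℕ) t → (∀ m → m ≤ g m) → g 1 ≤ t → ∃[ β ] 1 ≤ β × g β ≤ t × t < g (suc β)
  last-below g t m≤g g1≤t = go t 1 (s≤s z≤n) g1≤t (≤-trans (≤-reflexive (+-comm 1 t)) (m≤g (t + 1)))
    where
    go : ∀ fuel β → 1 ≤ β → g β ≤ t → t < g (fuel + β) → ∃[ β ] 1 ≤ β × g β ≤ t × t < g (suc β)
    go zero       β 1≤β gβ≤t t<gβ = contradiction t<gβ (≤⇒≯ gβ≤t)
    go (suc fuel) β 1≤β gβ≤t t<g with g (suc β) ≤? t
    ... | yes g≤t = go fuel (suc β) (s≤s z≤n) g≤t (subst (λ m → t < g m) (sym (+-suc fuel β)) t<g)
    ... | no  g≰t = β , 1≤β , gβ≤t , ≰⇒> g≰t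

  -- With B ≈ β and M ≈ β ^ n, where β ^ 2n ≈ t, Stepanov's bound is J ^ 2n ≲ t ^ (n + 1);
  -- for n = 2 b - 1 this is J ^ (2 - 1 / b) ≲ t.
  module _ (c K d : ℕ) (1≤d : 1 ≤ d) where
    b n Δ κ γ C₀ C₁ C₂ P₁ P₂ P₃ C : ℕ
    b  = suc c
    n  = suc (c + c)
    Δ  = n * d ^ n
    κ  = 3 ^ n
    γ  = (1 + κ) * Δ
    -- `C₀ * (M * M)` dominates E + (A + Q Δ), which must not exceed t; its summand 1 pays for the
    -- `suc` in E. `C₁` is the factor of t β in the bound for A + w, and `C₂` expresses that β is
    -- chosen maximal: t ≤ `C₂ * (M * M)`.
    C₀ = 1 + κ * γ + γ
    C₁ = 1 + 3 * Δ
    C₂ = C₀ * (2 ^ n * 2 ^ n)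
    -- One constant for each case: t below `C₀`, p below `t * β * C₁`, and the range in which
    -- Stepanov's bound applies.
    P₁ = 2 ^ n * C₀ ^ c
    P₂ = C₁ ^ c
    P₃ = (K * (Δ + 1)) ^ n * (C₁ ^ n * C₂ ^ c)
    C  = P₁ + P₂ + P₃

    private
      1≤Δ : 1 ≤ Δ
      1≤Δ = *-mono-≤ {1} {n} {1} {d ^ n} (s≤s z≤n) (1≤m^n n 1≤d)

    SizeBound : ℕ → ℕ → ℕ → Set
    SizeBound t p J = ∀ B A M → M ≤ p →
      (let Q = B ^ n; E = suc (Q * (A + Q * Δ)); w = n * (t * B * d ^ n)) →
      E + (A + Q * Δ) ≤ t → E + Δ ≤ p → A + w ≤ p → M * (A + M * Δ) < Q * A → J * M ≤ A + w

    module _ (t p V J : ℕ) (1≤t : 1 ≤ t) (t≤p : t ≤ p) (V≤1+t : V ≤ suc t) (V≤ : V ≤ K * (Δ + J))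
      (good-size : SizeBound t p J) where
      open ≤-Reasoning
      open +-*-Solver

      private
        t^n : t ^ n ≡ t ^ b * t ^ c
        t^n = ^-distribˡ-+-* t b c

      small : t < C₀ → V ^ n ≤ 2 ^ n * C₀ ^ c * t ^ b
      small t<C₀ = begin
        V ^ n                       ≤⟨ ^-monoˡ-≤ n (≤-trans V≤1+t (+-mono-≤ 1≤t (≤-reflexive (sym (+-identityʳ t))))) ⟩
        (2 * t) ^ n                 ≡⟨ ^-distribʳ-* n 2 t ⟩
        2 ^ n * t ^ n               ≡⟨ cong (2 ^ n *_) t^n ⟩
        2 ^ n * (t ^ b * t ^ c)     ≤⟨ *-monoʳ-≤ (2 ^ n) (*-monoʳ-≤ (t ^ b) (^-monoˡ-≤ c (<⇒≤ t<C₀))) ⟩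
        2 ^ n * (t ^ b * C₀ ^ c)    ≡⟨ solve 3 (λ x y z → x :* (y :* z) := x :* z :* y) refl (2 ^ n) (t ^ b) (C₀ ^ c) ⟩
        2 ^ n * C₀ ^ c * t ^ b      ∎

      module Large (β : ℕ) (1≤β : 1 ≤ β) (below : C₀ * (β ^ n * β ^ n) ≤ t) (above : t < C₀ * (suc β ^ n * suc β ^ n)) where
        B M A Q w : ℕ
        -- With A = M Δ the two summands of A + M Δ agree, so the dimension count asks for 2 M < Q.
        -- The factor 3 gives Q = 3^n M ≥ 3 M.
        B = 3 * β
        M = β ^ n
        A = M * Δ
        Q = B ^ n
        w = n * (t * B * d ^ n)

        1≤M : 1 ≤ M
        1≤M = 1≤m^n n 1≤β

        Q≡ : Q ≡ κ * M
        Q≡ = ^-distribʳ-* n 3 β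

        A+QΔ≡ : A + Q * Δ ≡ M * γ
        A+QΔ≡ = trans (cong (λ Q → A + Q * Δ) Q≡)
          (solve 3 (λ M κ Δ → M :* Δ :+ κ :* M :* Δ := M :* ((con 1 :+ κ) :* Δ)) refl M κ Δ)

        E+≤t : suc (Q * (A + Q * Δ)) + (A + Q * Δ) ≤ t
        E+≤t = begin
          suc (Q * (A + Q * Δ)) + (A + Q * Δ)      ≡⟨ cong₂ (λ q x → suc (q * x) + x) Q≡ A+QΔ≡ ⟩
          1 + κ * M * (M * γ) + M * γ
            ≤⟨ +-mono-≤ (+-monoˡ-≤ (κ * M * (M * γ)) (*-mono-≤ 1≤M 1≤M)) (m≤n*m′ (M * γ) 1≤M) ⟩
          M * M + κ * M * (M * γ) + M * (M * γ)
            ≡⟨ solve 3 (λ M κ γ → M :* M :+ κ :* M :* (M :* γ) :+ M :* (M :* γ)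
                               := (con 1 :+ κ :* γ :+ γ) :* (M :* M)) refl M κ γ ⟩
          C₀ * (M * M)                             ≤⟨ below ⟩
          t                                        ∎

        E+Δ≤p : suc (Q * (A + Q * Δ)) + Δ ≤ p
        E+Δ≤p = ≤-trans (+-monoʳ-≤ (suc (Q * (A + Q * Δ))) (≤-trans (m≤n*m′ Δ 1≤M) (m≤m+n A (Q * Δ)))) (≤-trans E+≤t t≤p)

        MM≤t : M * M ≤ t
        MM≤t = ≤-trans (m≤n*m′ (M * M) {C₀} (s≤s z≤n)) below

        M≤p : M ≤ p
        M≤p = ≤-trans (m≤m*n′ M 1≤M) (≤-trans MM≤t t≤p)

        A≤t : A ≤ t
        A≤t = ≤-trans (m≤m+n A (Q * Δ)) (≤-trans (m≤n+m (A + Q * Δ) (suc (Q * (A + Q * Δ)))) E+≤t)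

        w≡ : w ≡ t * β * (3 * Δ)
        w≡ = solve 4 (λ n t β D → n :* (t :* (con 3 :* β) :* D) := t :* β :* (con 3 :* (n :* D))) refl n t β (d ^ n)

        A+w≤ : A + w ≤ t * β * C₁
        A+w≤ = begin
          A + w                             ≤⟨ +-mono-≤ (≤-trans A≤t (m≤m*n′ t 1≤β)) (≤-reflexive w≡) ⟩
          t * β + t * β * (3 * Δ)           ≡⟨ solve 2 (λ x y → x :+ x :* y := x :* (con 1 :+ y)) refl (t * β) (3 * Δ) ⟩
          t * β * C₁                        ∎

        count : M * (A + M * Δ) < Q * A
        count = begin-strict
          M * (A + A)            ≡⟨ solve 2 (λ m a → m :* (a :+ a) := con 2 :* (m :* a)) refl M A ⟩
          2 * (M * A)            <⟨ *-monoˡ-< (M * A) {{ℕ.>-nonZero (*-mono-≤ 1≤M (*-mono-≤ 1≤M 1≤Δ))}} (n<1+n 2) ⟩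
          3 * (M * A)            ≤⟨ *-monoˡ-≤ (M * A) (m≤m*n′ 3 (1≤m^n (c + c) (s≤s z≤n))) ⟩
          κ * (M * A)            ≡⟨ *-assoc κ M A ⟨
          κ * M * A              ≡⟨ cong (_* A) Q≡ ⟨
          Q * A                  ∎

        -- If p is too small for Stepanov's method, t is already large against p: since β^c ≤ M M ≤
        -- t, the bound (t β)^c costs at most one more factor t, and c + 1 = b.
        large-p : p < t * β * C₁ → p ^ c ≤ C₁ ^ c * t ^ b
        large-p p< = begin
          p ^ c                          ≤⟨ ^-monoˡ-≤ c (<⇒≤ p<) ⟩
          (t * β * C₁) ^ c               ≡⟨ ^-distribʳ-* c (t * β) C₁ ⟩
          (t * β) ^ c * C₁ ^ c           ≡⟨ cong (_* C₁ ^ c) (^-distribʳ-* c t β) ⟩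
          t ^ c * β ^ c * C₁ ^ c         ≤⟨ *-monoˡ-≤ (C₁ ^ c) (*-monoʳ-≤ (t ^ c) β^c≤t) ⟩
          t ^ c * t * C₁ ^ c             ≡⟨ solve 3 (λ x t C → x :* t :* C := C :* (t :* x)) refl (t ^ c) t (C₁ ^ c) ⟩
          C₁ ^ c * t ^ b                 ∎
          where
          β^c≤t : β ^ c ≤ t
          β^c≤t = ≤-trans (m≤m*n′ (β ^ c) (1≤m^n b 1≤β)) (≤-trans (≤-reflexive (trans (sym (^-distribˡ-+-* β c b)) (cong (β ^_) (+-suc c c))))
                    (≤-trans (m≤m*n′ M 1≤M) MM≤t))

        J*β^2c≤ : t * β * C₁ ≤ p → J * β ^ (c + c) ≤ C₁ * t
        J*β^2c≤ ≤p = cancelʳ β 1≤β (begin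
          J * β ^ (c + c) * β      ≡⟨ solve 3 (λ J x β → J :* x :* β := J :* (β :* x)) refl J (β ^ (c + c)) β ⟩
          J * M                    ≤⟨ good-size B A M M≤p E+≤t E+Δ≤p (≤-trans A+w≤ ≤p) count ⟩
          A + w                    ≤⟨ A+w≤ ⟩
          t * β * C₁               ≡⟨ solve 3 (λ t β C → t :* β :* C := C :* t :* β) refl t β C₁ ⟩
          C₁ * t * β               ∎)

        t≤C₂MM : t ≤ C₂ * (M * M)
        t≤C₂MM = begin
          t                                          ≤⟨ <⇒≤ above ⟩
          C₀ * (suc β ^ n * suc β ^ n)               ≤⟨ *-monoʳ-≤ C₀ (*-mono-≤ 1+β≤ 1+β≤) ⟩
          C₀ * (2 ^ n * M * (2 ^ n * M))             ≡⟨ solve 3 (λ C x M → C :* (x :* M :* (x :* M)) := C :* (x :* x) :* (M :* M)) refl C₀ (2 ^ n) M ⟩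
          C₂ * (M * M)                               ∎
          where
          1+β≤ : suc β ^ n ≤ 2 ^ n * M
          1+β≤ = ≤-trans (^-monoˡ-≤ n (+-mono-≤ 1≤β (≤-reflexive (sym (+-identityʳ β))))) (≤-reflexive (^-distribʳ-* n 2 β))

        [MM]^c : (M * M) ^ c ≡ (β ^ (c + c)) ^ n
        [MM]^c = begin-equality
          (M * M) ^ c              ≡⟨ cong (_^ c) (^-distribˡ-+-* β n n) ⟨
          (β ^ (n + n)) ^ c        ≡⟨ ^-*-assoc β (n + n) c ⟩
          β ^ ((n + n) * c)        ≡⟨ cong (β ^_) (solve 2 (λ n c → (n :+ n) :* c := (c :+ c) :* n) refl n c) ⟩
          β ^ ((c + c) * n)        ≡⟨ ^-*-assoc β (c + c) n ⟨
          (β ^ (c + c)) ^ n        ∎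

        -- In the n-th power of J β^(2c) ≤ C₁ t, the right side splits as t^n = t^b t^c. By the
        -- maximality of β, t^c is at most a constant times β^(2cn), exactly the power on the left.
        J^n≤ : t * β * C₁ ≤ p → J ^ n ≤ C₁ ^ n * C₂ ^ c * t ^ b
        J^n≤ ≤p = cancelʳ Y (1≤m^n n (1≤m^n (c + c) 1≤β)) (begin
          J ^ n * Y                                  ≡⟨ ^-distribʳ-* n J (β ^ (c + c)) ⟨
          (J * β ^ (c + c)) ^ n                      ≤⟨ ^-monoˡ-≤ n (J*β^2c≤ ≤p) ⟩
          (C₁ * t) ^ n                               ≡⟨ ^-distribʳ-* n C₁ t ⟩
          C₁ ^ n * t ^ n                             ≡⟨ cong (C₁ ^ n *_) t^n ⟩
          C₁ ^ n * (t ^ b * t ^ c)                   ≤⟨ *-monoʳ-≤ (C₁ ^ n) (*-monoʳ-≤ (t ^ b) (^-monoˡ-≤ c t≤C₂MM)) ⟩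
          C₁ ^ n * (t ^ b * (C₂ * (M * M)) ^ c)      ≡⟨ cong (λ x → C₁ ^ n * (t ^ b * x)) (trans (^-distribʳ-* c C₂ (M * M)) (cong (C₂ ^ c *_) [MM]^c)) ⟩
          C₁ ^ n * (t ^ b * (C₂ ^ c * Y))            ≡⟨ solve 4 (λ a t z y → a :* (t :* (z :* y)) := a :* z :* t :* y) refl (C₁ ^ n) (t ^ b) (C₂ ^ c) Y ⟩
          C₁ ^ n * C₂ ^ c * t ^ b * Y                ∎)
          where
          Y = (β ^ (c + c)) ^ n

        V^n≤ : t * β * C₁ ≤ p → V ^ n ≤ (K * (Δ + 1)) ^ n * (C₁ ^ n * C₂ ^ c) * t ^ b
        V^n≤ ≤p = begin
          V ^ n                                  ≤⟨ ^-monoˡ-≤ n V≤KJ ⟩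
          (K * (Δ + 1) * (1 ℕ.⊔ J)) ^ n          ≡⟨ ^-distribʳ-* n (K * (Δ + 1)) (1 ℕ.⊔ J) ⟩
          (K * (Δ + 1)) ^ n * (1 ℕ.⊔ J) ^ n      ≤⟨ *-monoʳ-≤ ((K * (Δ + 1)) ^ n) (max J (J^n≤ ≤p)) ⟩
          (K * (Δ + 1)) ^ n * (C₁ ^ n * C₂ ^ c * t ^ b)   ≡⟨ *-assoc ((K * (Δ + 1)) ^ n) (C₁ ^ n * C₂ ^ c) (t ^ b) ⟨
          (K * (Δ + 1)) ^ n * (C₁ ^ n * C₂ ^ c) * t ^ b   ∎
          where
          -- Replacing J by 1 ⊔ J turns the additive Δ into a factor; `max` then treats J = 0, where
          -- the bound to be met is at least 1.
          V≤KJ : V ≤ K * (Δ + 1) * (1 ℕ.⊔ J)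
          V≤KJ = begin
            V                                      ≤⟨ V≤ ⟩
            K * (Δ + J)                            ≤⟨ *-monoʳ-≤ K (+-mono-≤ (m≤m*n′ Δ (m≤m⊔n 1 J)) (m≤n⊔m 1 J)) ⟩
            K * (Δ * (1 ℕ.⊔ J) + (1 ℕ.⊔ J))        ≡⟨ solve 3 (λ K Δ m → K :* (Δ :* m :+ m) := K :* (Δ :+ con 1) :* m) refl K Δ (1 ℕ.⊔ J) ⟩
            K * (Δ + 1) * (1 ℕ.⊔ J)                ∎
          1≤C₂ : 1 ≤ C₂
          1≤C₂ = *-mono-≤ {1} {C₀} (s≤s z≤n) (*-mono-≤ (1≤m^n {2} n (s≤s z≤n)) (1≤m^n {2} n (s≤s z≤n)))
          max : ∀ j → j ^ n ≤ C₁ ^ n * C₂ ^ c * t ^ b → (1 ℕ.⊔ j) ^ n ≤ C₁ ^ n * C₂ ^ c * t ^ b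
          max zero    _ = ≤-trans (≤-reflexive (^-zeroˡ n)) (*-mono-≤ {1} (*-mono-≤ {1} (1≤m^n {C₁} n (s≤s z≤n)) (1≤m^n c 1≤C₂)) (1≤m^n b 1≤t))
          max (suc j) h = h

      dichotomy : V ^ n ≤ C * t ^ b ⊎ p ^ c ≤ C * t ^ b
      dichotomy with t <? C₀
      ... | yes t<C₀ = inj₁ (≤-trans (small t<C₀) (*-monoˡ-≤ (t ^ b) (≤-trans (m≤m+n P₁ P₂) (m≤m+n (P₁ + P₂) P₃))))
      ... | no  t≮C₀ with last-below (λ β → C₀ * (β ^ n * β ^ n)) t m≤g
              (≤-trans (≤-reflexive (trans (cong₂ (λ x y → C₀ * (x * y)) (^-zeroˡ n) (^-zeroˡ n)) (*-identityʳ C₀))) (≮⇒≥ t≮C₀))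
        where
        m≤g : ∀ m → m ≤ C₀ * (m ^ n * m ^ n)
        m≤g zero    = z≤n
        m≤g (suc m) = ≤-trans (m≤m*n′ (suc m) (1≤m^n {suc m} (c + c) (s≤s z≤n)))
          (≤-trans (m≤m*n′ (suc m ^ n) (1≤m^n {suc m} n (s≤s z≤n))) (m≤n*m′ (suc m ^ n * suc m ^ n) {C₀} (s≤s z≤n)))
      ...   | β , 1≤β , below , above with t * β * C₁ ≤? p
      ...     | yes ≤p = inj₁ (≤-trans (L.V^n≤ ≤p) (*-monoˡ-≤ (t ^ b) (m≤n+m P₃ (P₁ + P₂))))
        where module L = Large β 1≤β below above
      ...     | no  ≰p = inj₂ (≤-trans (L.large-p (≰⇒> ≰p)) (*-monoˡ-≤ (t ^ b) (≤-trans (m≤n+m P₂ P₁) (m≤m+n (P₁ + P₂) P₃))))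
        where module L = Large β 1≤β below above

-- Powers with rational and real exponents

module RationalPowers where
  open import Data.Integer.Base using (+_; -[1+_]; +[1+_])
  open ≡ using (refl; cong; sym; trans; subst)
  open SemiringExp (CommutativeRing.semiring ℚₚ.+-*-commutativeRing) using (_^_; ^-assocʳ)
  open ℚₚ.≤-Reasoning

  <⇒≱ : ∀ {x y} → x ℚ.< y → ¬ (y ℚ.≤ x)
  <⇒≱ x<y y≤x = ℚₚ.<-irrefl refl (ℚₚ.<-≤-trans x<y y≤x)

  toℚᵘ-fromℕ : ∀ n → toℚᵘ (fromℕ n) ℚᵘ.≃ mkℚᵘ (+ n) 0
  toℚᵘ-fromℕ n = ℚₚ.toℚᵘ-fromℚᵘ (mkℚᵘ (+ n) 0)

  fromℕ-mono-≤ : ∀ {m n} → m ℕ.≤ n → fromℕ m ℚ.≤ fromℕ n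
  fromℕ-mono-≤ {m} {n} m≤n = ℚₚ.toℚᵘ-cancel-≤ (ℚᵘₚ.≤-respˡ-≃ (ℚᵘₚ.≃-sym (toℚᵘ-fromℕ m))
    (ℚᵘₚ.≤-respʳ-≃ (ℚᵘₚ.≃-sym (toℚᵘ-fromℕ n)) (*≤* (ℤₚ.*-monoʳ-≤-nonNeg (+ 1) (ℤ.+≤+ m≤n)))))

  fromℕ-* : ∀ m n → fromℕ (m ℕ.* n) ≡ fromℕ m ℚ.* fromℕ n
  fromℕ-* m n = ℚₚ.toℚᵘ-injective (ℚᵘₚ.≃-trans (toℚᵘ-fromℕ (m ℕ.* n)) (ℚᵘₚ.≃-trans
    (*≡* (cong (ℤ._* + 1) (ℤₚ.pos-* m n)))
    (ℚᵘₚ.≃-sym (ℚᵘₚ.≃-trans (ℚₚ.toℚᵘ-homo-* (fromℕ m) (fromℕ n)) (ℚᵘₚ.*-cong (toℚᵘ-fromℕ m) (toℚᵘ-fromℕ n))))))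

  fromℕ-^ : ∀ m n → fromℕ (m ℕ.^ n) ≡ fromℕ m ^ n
  fromℕ-^ m zero    = refl
  fromℕ-^ m (suc n) = trans (fromℕ-* m (m ℕ.^ n)) (cong (fromℕ m ℚ.*_) (fromℕ-^ m n))

  0≤fromℕ : ∀ n → 0ℚ ℚ.≤ fromℕ n
  0≤fromℕ n = fromℕ-mono-≤ {0} {n} z≤n

  1≤fromℕ : ∀ {n} → 1 ℕ.≤ n → 1ℚ ℚ.≤ fromℕ n
  1≤fromℕ {n} = fromℕ-mono-≤ {1} {n}

  0≤^ : ∀ {x} n → 0ℚ ℚ.≤ x → 0ℚ ℚ.≤ x ^ n
  0≤^ zero    0≤x = 0≤fromℕ 1
  0≤^ {x} (suc n) 0≤x = begin
    0ℚ            ≡⟨ ℚₚ.*-zeroˡ (x ^ n) ⟨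
    0ℚ ℚ.* x ^ n  ≤⟨ ℚₚ.*-monoʳ-≤-nonNeg (x ^ n) {{ℚ.nonNegative (0≤^ n 0≤x)}} 0≤x ⟩
    x ℚ.* x ^ n   ∎

  0<^ : ∀ {x} n → 0ℚ ℚ.< x → 0ℚ ℚ.< x ^ n
  0<^ zero    0<x = ℚₚ.positive⁻¹ 1ℚ
  0<^ {x} (suc n) 0<x = begin-strict
    0ℚ            ≡⟨ ℚₚ.*-zeroˡ (x ^ n) ⟨
    0ℚ ℚ.* x ^ n  <⟨ ℚₚ.*-monoˡ-<-pos (x ^ n) {{ℚ.positive (0<^ n 0<x)}} 0<x ⟩
    x ℚ.* x ^ n   ∎

  ^-mono-≤ : ∀ {x y} n → 0ℚ ℚ.≤ x → x ℚ.≤ y → x ^ n ℚ.≤ y ^ n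
  ^-mono-≤ zero    0≤x x≤y = ℚₚ.≤-refl
  ^-mono-≤ {x} {y} (suc n) 0≤x x≤y = begin
    x ℚ.* x ^ n  ≤⟨ ℚₚ.*-monoˡ-≤-nonNeg x {{ℚ.nonNegative 0≤x}} (^-mono-≤ n 0≤x x≤y) ⟩
    x ℚ.* y ^ n  ≤⟨ ℚₚ.*-monoʳ-≤-nonNeg (y ^ n) {{ℚ.nonNegative (0≤^ n (ℚₚ.≤-trans 0≤x x≤y))}} x≤y ⟩
    y ℚ.* y ^ n  ∎

  ^-mono-< : ∀ {x y} n → 0ℚ ℚ.≤ x → x ℚ.< y → x ^ suc n ℚ.< y ^ suc n
  ^-mono-< {x} {y} n 0≤x x<y = begin-strict
    x ℚ.* x ^ n  ≤⟨ ℚₚ.*-monoˡ-≤-nonNeg x {{ℚ.nonNegative 0≤x}} (^-mono-≤ n 0≤x (ℚₚ.<⇒≤ x<y)) ⟩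
    x ℚ.* y ^ n  <⟨ ℚₚ.*-monoˡ-<-pos (y ^ n) {{ℚ.positive (0<^ n (ℚₚ.≤-<-trans 0≤x x<y))}} x<y ⟩
    y ℚ.* y ^ n  ∎

  ^-cancel-≤ : ∀ {x y} n → 0ℚ ℚ.≤ y → x ^ suc n ℚ.≤ y ^ suc n → x ℚ.≤ y
  ^-cancel-≤ {x} {y} n 0≤y x^n≤y^n with x ℚₚ.≤? y
  ... | yes x≤y = x≤y
  ... | no  x≰y = contradiction x^n≤y^n (<⇒≱ (^-mono-< n 0≤y (ℚₚ.≰⇒> x≰y)))

  -- The hypothesis on numerators encodes q ≤ e / b; it is void for q < 0.
  power-bound : ∀ {r m} (q : ℚ) b-1 e → 1 ℕ.≤ m → 0ℚ ℚ.< r →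
    (∀ a → ↥ q ≡ + a → a ℕ.* suc b-1 ℕ.≤ e ℕ.* ↧ₙ q) → r < m ^ℚ q → r ^ suc b-1 ℚ.≤ fromℕ (m ℕ.^ e)
  power-bound q b-1 e 1≤m 0<r q≤e/b (inj₁ r≤0) = contradiction r≤0 (<⇒≱ 0<r)
  power-bound {r} {m@(suc _)} q@(mkℚ num d-1 _) b-1 e 1≤m 0<r q≤e/b (inj₂ r^d<) =
    let a , ab≤ed , r^d≤ = numerator num refl r^d< in ^-cancel-≤ d-1 (0≤fromℕ (m ℕ.^ e)) (begin
      (r ^ b) ^ d                  ≡⟨ ^-assocʳ r b d ⟩
      r ^ (b ℕ.* d)                ≡⟨ cong (r ^_) (ℕₚ.*-comm b d) ⟩
      r ^ (d ℕ.* b)                ≡⟨ ^-assocʳ r d b ⟨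
      (r ^ d) ^ b                  ≤⟨ ^-mono-≤ b (0≤^ d (ℚₚ.<⇒≤ 0<r)) r^d≤ ⟩
      fromℕ (m ℕ.^ a) ^ b          ≡⟨ fromℕ-^ (m ℕ.^ a) b ⟨
      fromℕ ((m ℕ.^ a) ℕ.^ b)      ≡⟨ cong fromℕ (ℕₚ.^-*-assoc m a b) ⟩
      fromℕ (m ℕ.^ (a ℕ.* b))      ≤⟨ fromℕ-mono-≤ (ℕₚ.^-monoʳ-≤ m ab≤ed) ⟩
      fromℕ (m ℕ.^ (e ℕ.* d))      ≡⟨ cong fromℕ (ℕₚ.^-*-assoc m e d) ⟨
      fromℕ ((m ℕ.^ e) ℕ.^ d)      ≡⟨ fromℕ-^ (m ℕ.^ e) d ⟩
      fromℕ (m ℕ.^ e) ^ d          ∎)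
    where
    b d : ℕ
    b = suc b-1
    d = suc d-1
    numerator : ∀ i → i ≡ num → r ^ d < m ^ᶻ i →
                ∃[ a ] a ℕ.* b ℕ.≤ e ℕ.* d × r ^ d ℚ.≤ fromℕ (m ℕ.^ a)
    numerator (+ a)    i≡num r^d<m^a = a , q≤e/b a (sym i≡num) , ℚₚ.<⇒≤ r^d<m^a
    numerator -[1+ a ] _     r^d*<1  = 0 , z≤n , (begin
      r ^ d                          ≡⟨ ℚₚ.*-identityʳ (r ^ d) ⟨
      r ^ d ℚ.* 1ℚ
        ≤⟨ ℚₚ.*-monoˡ-≤-nonNeg (r ^ d) {{ℚ.nonNegative (0≤^ d (ℚₚ.<⇒≤ 0<r))}} (1≤fromℕ (ℕₚ.m^n>0 m (suc a))) ⟩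
      r ^ d ℚ.* fromℕ (m ℕ.^ suc a)  ≤⟨ ℚₚ.<⇒≤ r^d*<1 ⟩
      1ℚ                             ∎)

  -- A positive fraction with denominator b is at least 1/b. For q = a/d this gives a/d < x - 1/b =
  -- e/b, and it remains to clear denominators.
  exponent-bound : ∀ (δ q : ℚ) x e → 0ℚ ℚ.< δ → δ ℚ.< fromℕ x ℚ.- q → suc e ≡ x ℕ.* ↧ₙ δ →
                   ∀ a → ↥ q ≡ + a → a ℕ.* ↧ₙ δ ℕ.≤ e ℕ.* ↧ₙ q
  exponent-bound (mkℚ (+ zero) _ _) q x e (ℚ.*<* (ℤ.+<+ ()))
  exponent-bound (mkℚ -[1+ _ ] _ _) q x e (ℚ.*<* ())
  exponent-bound δ@(mkℚ +[1+ m ] b-1 _) q@(mkℚ (+ a) d-1 _) x e 0<δ δ<x-q 1+e≡xb .a refl =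
    ℕₚ.<⇒≤ (ℕₚ.+-cancelˡ-< d (a ℕ.* b) (e ℕ.* d) (ℤₚ.drop‿+<+ (subst₂< lhs rhs shifted)))
    where
    b d : ℕ
    b = suc b-1
    d = suc d-1
    unnormalised : toℚᵘ δ ℚᵘ.< mkℚᵘ (+ x) 0 ℚᵘ.- toℚᵘ q
    unnormalised = ℚᵘₚ.<-respʳ-≃ (ℚᵘₚ.≃-trans (ℚₚ.toℚᵘ-homo-+ (fromℕ x) (ℚ.- q))
      (ℚᵘₚ.+-cong (toℚᵘ-fromℕ x) (ℚₚ.toℚᵘ-homo‿- q))) (ℚₚ.toℚᵘ-mono-< δ<x-q)
    cross : + suc m ℤ.* + (1 ℕ.* d) ℤ.< (+ x ℤ.* + d ℤ.+ ℤ.- (+ a) ℤ.* + 1) ℤ.* + b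
    cross = ℚᵘₚ.drop-*<* unnormalised
    shifted : + d ℤ.+ + a ℤ.* + b ℤ.< (+ x ℤ.* + d ℤ.+ ℤ.- (+ a) ℤ.* + 1) ℤ.* + b ℤ.+ + a ℤ.* + b
    shifted = ℤₚ.+-monoˡ-< (+ a ℤ.* + b) (ℤₚ.≤-<-trans
      (ℤₚ.≤-trans (ℤ.+≤+ (ℕₚ.≤-trans (ℕₚ.≤-reflexive (sym (ℕₚ.*-identityˡ d))) (ℕₚ.m≤n*m (1 ℕ.* d) (suc m))))
                  (ℤₚ.≤-reflexive (ℤₚ.pos-* (suc m) (1 ℕ.* d)))) cross)
    lhs : + d ℤ.+ + a ℤ.* + b ≡ + (d ℕ.+ a ℕ.* b)
    lhs = trans (cong (ℤ._+_ (+ d)) (sym (ℤₚ.pos-* a b))) (sym (ℤₚ.pos-+ d (a ℕ.* b)))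
    rhs : (+ x ℤ.* + d ℤ.+ ℤ.- (+ a) ℤ.* + 1) ℤ.* + b ℤ.+ + a ℤ.* + b ≡ + (d ℕ.+ e ℕ.* d)
    rhs = trans (solve 4 (λ x d a b → (x :* d :+ :- a :* con (+ 1)) :* b :+ a :* b := x :* b :* d) refl (+ x) (+ d) (+ a) (+ b))
      (trans (cong (ℤ._* + d) (trans (sym (ℤₚ.pos-* x b)) (cong +_ (sym 1+e≡xb)))) (sym (ℤₚ.pos-* (suc e) d)))
      where open ℤSolver.+-*-Solver
    subst₂< : ∀ {i j k l : ℤ} → i ≡ j → k ≡ l → i ℤ.< k → j ℤ.< l
    subst₂< refl refl i<k = i<k

  -- The rational δ below ε enters only through its denominator b: 1 / b ≤ δ.
  cut-bound : (ε : ℝ) (δ : ℚ) → 0ℚ ℚ.< δ → ℝ.lower ε δ → ∀ x e → suc e ≡ x ℕ.* ↧ₙ δ →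
    ∀ {m r} → 1 ℕ.≤ m → 0ℚ ℚ.< r → (m ^ᴸ (fromℕ x -ᴸ ε)) r → r ^ ↧ₙ δ ℚ.≤ fromℕ (m ℕ.^ e)
  cut-bound ε δ@(mkℚ _ b-1 _) 0<δ δ<ε x e 1+e≡xb {m} {r} 1≤m 0<r (q , ε<x-q , r<m^q) =
    power-bound q b-1 e 1≤m 0<r (exponent-bound δ q x e 0<δ δ<x-q 1+e≡xb) r<m^q
    where
    -- By definition of `-ᴸ`, x - q lies in the upper cut of ε. If it were at most δ, it would lie
    -- in the lower cut as well, against disjointness.
    δ<x-q : δ ℚ.< fromℕ x ℚ.- q
    δ<x-q with fromℕ x ℚ.- q ℚₚ.≤? δ
    ... | no  x-q≰δ = ℚₚ.≰⇒> x-q≰δ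
    ... | yes x-q≤δ = contradiction (lower , ε<x-q) (ℝ.disjoint ε _)
      where
      lower : ℝ.lower ε (fromℕ x ℚ.- q)
      lower with fromℕ x ℚ.- q ℚₚ.<? δ
      ... | yes x-q<δ = Equivalence.from (ℝ.lower-rounded ε _) (δ , x-q<δ , δ<ε)
      ... | no  x-q≮δ = subst (ℝ.lower ε) (ℚₚ.≤-antisym (ℚₚ.≮⇒≥ x-q≮δ) x-q≤δ) δ<ε

  reciprocal-bound : ∀ {r} C t → r ℚ.≤ fromℕ (suc C ℕ.* t) → (+ 1 ℚ./ suc C) ℚ.* r ℚ.≤ fromℕ t
  reciprocal-bound {r} C t r≤ = begin
    c ℚ.* r                                  ≤⟨ ℚₚ.*-monoˡ-≤-nonNeg c {{ℚₚ.normalize-nonNeg 1 (suc C)}} r≤ ⟩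
    c ℚ.* fromℕ (suc C ℕ.* t)                ≡⟨ cong (c ℚ.*_) (fromℕ-* (suc C) t) ⟩
    c ℚ.* (fromℕ (suc C) ℚ.* fromℕ t)        ≡⟨ ℚₚ.*-assoc c (fromℕ (suc C)) (fromℕ t) ⟨
    c ℚ.* fromℕ (suc C) ℚ.* fromℕ t          ≡⟨ cong (ℚ._* fromℕ t) c*C≡1 ⟩
    1ℚ ℚ.* fromℕ t                           ≡⟨ ℚₚ.*-identityˡ (fromℕ t) ⟩
    fromℕ t                                  ∎
    where
    c = + 1 ℚ./ suc C
    c*C≡1 : c ℚ.* fromℕ (suc C) ≡ 1ℚ
    c*C≡1 = ℚₚ.toℚᵘ-injective (ℚᵘₚ.≃-trans (ℚₚ.toℚᵘ-homo-* c (fromℕ (suc C)))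
      (ℚᵘₚ.≃-trans (ℚᵘₚ.*-cong (ℚₚ.toℚᵘ-fromℚᵘ (mkℚᵘ (+ 1) C)) (toℚᵘ-fromℕ (suc C)))
        (*≡* (trans (ℤₚ.*-identityʳ _) (trans (ℤₚ.*-identityˡ (+ suc C))
          (sym (trans (ℤₚ.*-identityˡ _) (cong +_ (ℕₚ.*-identityʳ (suc C))))))))))

  -- The comparison is made between b-th powers, so no root has to be taken. The constant 1/(C + 1)
  -- rather than 1/C exists for every C, and C ≤ (C + 1)^b absorbs the constant of the dichotomy.
  conclude : ∀ {r} b-1 C t X → 0ℚ ℚ.< r → r ^ suc b-1 ℚ.≤ fromℕ X → X ℕ.≤ C ℕ.* t ℕ.^ suc b-1 →
             (+ 1 ℚ./ suc C) ℚ.* r ℚ.≤ fromℕ t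
  conclude {r} b-1 C t X 0<r r^b≤X X≤ = reciprocal-bound C t (^-cancel-≤ b-1 (0≤fromℕ (suc C ℕ.* t)) (begin
    r ^ suc b-1                              ≤⟨ r^b≤X ⟩
    fromℕ X                                  ≤⟨ fromℕ-mono-≤ X≤[Ct]^b ⟩
    fromℕ ((suc C ℕ.* t) ℕ.^ suc b-1)        ≡⟨ fromℕ-^ (suc C ℕ.* t) (suc b-1) ⟩
    fromℕ (suc C ℕ.* t) ^ suc b-1            ∎))
    where
    X≤[Ct]^b : X ℕ.≤ (suc C ℕ.* t) ℕ.^ suc b-1
    X≤[Ct]^b = ℕₚ.≤-trans X≤ (ℕₚ.≤-trans
      (ℕₚ.*-monoˡ-≤ (t ℕ.^ suc b-1) (ℕₚ.≤-trans (ℕₚ.n≤1+n C) (Parameters.m≤m*n′ (suc C) (ℕₚ.m^n>0 (suc C) b-1))))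
      (ℕₚ.≤-reflexive (sym (Parameters.^-distribʳ-* (suc b-1) (suc C) t))))

  -- The cuts contain all nonpositive rationals that qualify trivially; the argument with powers is
  -- confined to r > 0, where powers are monotone.
  positive-case : ∀ r C t → (0ℚ ℚ.< r → (+ 1 ℚ./ suc C) ℚ.* r ℚ.≤ fromℕ t) → (+ 1 ℚ./ suc C) ℚ.* r ℚ.≤ fromℕ t
  positive-case r C t h with r ℚₚ.≤? 0ℚ
  ... | yes r≤0 = reciprocal-bound C t (ℚₚ.≤-trans r≤0 (0≤fromℕ (suc C ℕ.* t)))
  ... | no  r≰0 = h (ℚₚ.≰⇒> r≰0)

-- The constants depending on ε, d and k, and the final deduction

theorem1p1 : (ε : ℝ) → Positive ε →
    (k : ℕ) → 1 ≤ k →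
    (d : ℕ) → 2 ≤ d →
    ∃[ c₁ ] ∃[ c₂ ] 0 < c₁ × 0ℚ ℚ.< c₂ ×
    ((p : ℕ) .{{_ : NonZero p}} → Prime p →
    (K : CommutativeRing 0ℓ 0ℓ) (ι : Fin p → CommutativeRing.Carrier K) →
    IsAlgebraicClosure p K ι →
    (f : Fin k → Poly (𝔽 p)) →
    (∀ i → ∃[ m ] 1 ≤ m × m ≤ d × HasDegree (𝔽 p) (f i) m) →
    C₀≥ K ι f c₁ →
    (u : Fin p) (N : ℕ) → 1 ≤ N →
    (𝒱 𝒢 : Subset p) → IsOrbit f u N 𝒱 → IsSmallestSubgroup 𝒱 𝒢 →
    c₂ · minᴸ (∣ 𝒱 ∣ ^ᴸ (fromℕ 2 -ᴸ ε)) (p ^ᴸ (fromℕ 1 -ᴸ ε)) ≤ᴸ fromℕ ∣ 𝒢 ∣)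
theorem1p1 ε ε>0 k 1≤k d 2≤d with Equivalence.to (ℝ.lower-rounded ε 0ℚ) ε>0
... | δ , 0<δ , δ<ε = n , ℤ.+ 1 ℚ./ suc C , s≤s z≤n , ℚₚ.positive⁻¹ (ℤ.+ 1 ℚ./ suc C) {{ℚₚ.normalize-pos 1 (suc C)}} , bound
  where
  open RationalPowers
  c n C : ℕ
  -- `suc c` is the denominator b of δ, so 1/b ≤ δ < ε. With n = 2 b - 1, taking b-th roots in the
  -- dichotomy would compare t with V^(2 - 1/b) or p^(1 - 1/b), exponents at least 2 - ε and 1 - ε;
  -- the same n is the bound c₁ on cycles.
  c = ℚ.denominator-1 δ
  n = suc (c ℕ.+ c)
  1≤d : 1 ≤ d
  1≤d = ℕₚ.<⇒≤ 2≤d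
  C = Parameters.C c (length (words k n)) d 1≤d
  2n≡ : suc n ≡ 2 ℕ.* suc c
  2n≡ = ≡.trans (≡.sym (≡.cong suc (ℕₚ.+-suc c c))) (≡.cong (suc c ℕ.+_) (≡.sym (ℕₚ.+-identityʳ (suc c))))
  bound : (p : ℕ) .{{_ : NonZero p}} → Prime p →
    (K : CommutativeRing 0ℓ 0ℓ) (ι : Fin p → CommutativeRing.Carrier K) →
    IsAlgebraicClosure p K ι →
    (f : Fin k → Poly (𝔽 p)) →
    (∀ i → ∃[ m ] 1 ≤ m × m ≤ d × HasDegree (𝔽 p) (f i) m) →
    C₀≥ K ι f n →
    (u : Fin p) (N : ℕ) → 1 ≤ N →
    (𝒱 𝒢 : Subset p) → IsOrbit f u N 𝒱 → IsSmallestSubgroup 𝒱 𝒢 →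
    (ℤ.+ 1 ℚ./ suc C) · minᴸ (∣ 𝒱 ∣ ^ᴸ (fromℕ 2 -ᴸ ε)) (p ^ᴸ (fromℕ 1 -ᴸ ε)) ≤ᴸ fromℕ ∣ 𝒢 ∣
  bound p p-prime K ι closure f degree C₀≥n u N _ 𝒱 𝒢 isOrbit smallest r (r<V^ , r<p^) =
    positive-case r C t λ 0<r → conclusion 0<r
      (Parameters.dichotomy c (length (words k n)) d 1≤d t p ∣ 𝒱 ∣ (length O.good)
        O.1≤t O.t≤p O.orbit-in-group O.orbit-size O.good-size)
    where
    i₀ = Fin.fromℕ< 1≤k
    module O = Orbit.Counting p p-prime f i₀ d n (s≤s z≤n) degree
      (Orbit.no-short-period p p-prime K ι closure f i₀ n C₀≥n) u N 𝒱 𝒢 isOrbit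
      (IsSmallestSubgroup.isSubgroup smallest) (IsSmallestSubgroup.contains smallest)
    t = ∣ 𝒢 ∣
    conclusion : 0ℚ ℚ.< r → (∣ 𝒱 ∣ ℕ.^ n ≤ C ℕ.* t ℕ.^ suc c) ⊎ (p ℕ.^ c ≤ C ℕ.* t ℕ.^ suc c) →
                 (ℤ.+ 1 ℚ./ suc C) ℚ.* r ℚ.≤ fromℕ t
    conclusion 0<r (inj₁ V^n≤) = conclude c C t (∣ 𝒱 ∣ ℕ.^ n) 0<r (cut-bound ε δ 0<δ δ<ε 2 n 2n≡ O.1≤V 0<r r<V^) V^n≤
    conclusion 0<r (inj₂ p^c≤) = conclude c C t (p ℕ.^ c) 0<r
      (cut-bound ε δ 0<δ δ<ε 1 c (≡.sym (ℕₚ.*-identityˡ (suc c))) (ℕₚ.≤-trans O.1≤t O.t≤p) 0<r r<p^) p^c≤
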